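{- Let $M$ be a matroid of rank $d$ on a finite ground set $E$ and let $\mathbb H$ be a hyperfield with an involution $\tau$. Then there exist bijections $$\Upsilon_\tau:\mathcal M^{\tau,w}_{\mathbb H}(M)\to\mathcal M^{p,w}_{\mathbb H}(M),\qquad \overline{\Upsilon}_\tau:\mathcal R^{\tau,w}_{\mathbb H}(M)\to\mathcal R^{p,w}_{\mathbb H}(M)$$ such that the square they form with the quotient maps $\mathcal M^{\tau,w}_{\mathbb H}(M)\to\mathcal R^{\tau,w}_{\mathbb H}(M)$ (quotient by $\cong_\tau$) and $\mathcal M^{p,w}_{\mathbb H}(M)\to\mathcal R^{p,w}_{\mathbb H}(M)$ (quotient by $\cong_p$) commutes. The same holds in the strong case, i.e. with the superscript $w$ replaced by $s$ throughout. In both cases, if $\mathbb H$ is a topological hyperfield, then $\Upsilon_\tau$ and $\overline\Upsilon_\tau$ are homeomorphisms.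
   Context: Hyperfields. A hyperfield is $(\mathbb H,\boxplus,\odot,0,1)$ with $0\ne1$ where: $\boxplus$ is a commutative, associative hyperoperation (each $a\boxplus b$ is a nonempty subset of $\mathbb H$; for subsets, $A\boxplus B=\bigcup_{a\in A,b\in B}a\boxplus b$) with $0\boxplus x=\{x\}$, each $x$ has a unique $-x$ with $0\in x\boxplus -x$, and $x\in y\boxplus z\iff z\in x\boxplus -y$; $(\mathbb H,\odot,1)$ is a commutative monoid, $0\odot x=0$, $a\odot(x\boxplus y)=(a\odot x)\boxplus(a\odot y)$; and $\mathbb H^*=\mathbb H\setminus\{0\}$ is a group under $\odot$. A homomorphism of hyperfields is a map $f$ with $f(0)=0$, $f(1)=1$, $f(x\odot y)=f(x)\odot f(y)$, $f(x\boxplus y)\subseteq f(x)\boxplus f(y)$. An involution is a homomorphism $\tau:\mathbb H\to\mathbb H$ with $\tau\circ\tau=\mathrm{id}$. A topological hyperfield is a hyperfield with a topology such that $\mathbb H^*$ is open, $\odot:\mathbb H\times\mathbb H\to\mathbb H$ is continuous and inversion $\mathbb H^*\to\mathbb H^*$ is continuous; involutions of topological hyperfields are required to be continuous. Grassmann–Plücker functions. A strong Grassmann–Plücker function of rank $d$ on $E$ is a nonzero alternating function $\varphi:E^d\to\mathbb H$ with $$0\in\boxplus_{k=1}^{d+1}(-1)^k\odot\varphi(x_1,\dots,\hat x_k,\dots,x_{d+1})\odot\varphi(x_k,y_1,\dots,y_{d-1})$$ for all subsets $I=\{x_1,\dots,x_{d+1}\}$, $J=\{y_1,\dots,y_{d-1}\}$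 of $E$. A weak one is a nonzero alternating function whose support is the set of bases of a matroid and which satisfies this condition whenever $|I\setminus J|\le3$. Its underlying matroid is the matroid whose bases are the sets $\{x_1,\dots,x_d\}$ with $\varphi(x_1,\dots,x_d)\neq0$. $\mathcal N^{p,w}_{\mathbb H}(M)$ (resp. $\mathcal N^{p,s}_{\mathbb H}(M)$) is the set of weak (resp. strong) Grassmann–Plücker functions with underlying matroid $M$, topologized (when $\mathbb H$ is topological) as a subset of the product $\mathbb H^{E^d}$. Write $\varphi_1\sim_p\varphi_2$ if $\varphi_1=a\odot\varphi_2$ for some $a\in\mathbb H^*$; $\mathcal M^{p,\bullet}_{\mathbb H}(M)=\mathcal N^{p,\bullet}_{\mathbb H}(M)/\!\sim_p$ for $\bullet\in\{w,s\}$. Write $\varphi_1\approx_p\varphi_2$ if there is $h:E\to\mathbb H^*$ with $\varphi_1(x_1,\dots,x_d)=\left(\bigodot_{j=1}^d h(x_j)\right)\odot\varphi_2(x_1,\dots,x_d)$ for all $(x_1,\dots,x_d)\in E^d$. Two $\sim_p$-classes are $\cong_p$-equivalent if they have $\approx_p$-equivalent representatives; $\mathcal R^{p,\bullet}_{\mathbb H}(M)=\mathcal M^{p,\bullet}_{\mathbb H}(M)/\!\cong_p$. Signatures. Let $\mathfrak C,\mathfrak C^*$ be the sets of circuits and cocircuits of $M$. An $\mathbb H^*$-circuit signature is a family $\gamma=\{\gamma C:C\to\mathbb H^*\}_{C\in\mathfrak C}$; an $\mathbb H^*$-cocircuit signature is a family $\delta=\{\delta D:D\to\mathbb H^*\}_{D\in\mathfrak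 C^*}$. They are strong orthogonal with respect to $\tau$ if $0\in\boxplus_{x\in C\cap D}\gamma C(x)\odot\tau(\delta D(x))$ for all $C\in\mathfrak C$, $D\in\mathfrak C^*$ (an empty sum being $0$), and weak orthogonal if this holds whenever $|C\cap D|\le3$. $\mathcal N^{\tau,w}_{\mathbb H}(M)$ (resp. $\mathcal N^{\tau,s}_{\mathbb H}(M)$) is the set of pairs $(\gamma,\delta)$ that are weak (resp. strong) orthogonal with respect to $\tau$, topologized as a subset of a finite power of $\mathbb H^*$. Write $(\gamma_1,\delta_1)\sim_\tau(\gamma_2,\delta_2)$ if there are functions $C\mapsto b_C\in\mathbb H^*$ on $\mathfrak C$ and $D\mapsto l_D\in\mathbb H^*$ on $\mathfrak C^*$ with $\gamma_1C(x)=b_C\odot\gamma_2C(x)$ and $\delta_1D(y)=l_D\odot\delta_2D(y)$ for all $C$, $x\in C$, $D$, $y\in D$; $\mathcal M^{\tau,\bullet}_{\mathbb H}(M)=\mathcal N^{\tau,\bullet}_{\mathbb H}(M)/\!\sim_\tau$. Write $(\gamma_1,\delta_1)\approx_\tau(\gamma_2,\delta_2)$ if there is $h:E\to\mathbb H^*$ with $\gamma_1C(x)=h(x)\odot\gamma_2C(x)$ and $\delta_1D(y)=\tau(h(y)^{ -1})\odot\delta_2D(y)$ for all $C$, $x\in C$, $D$, $y\in D$. Two $\sim_\tau$-classes are $\cong_\tau$-equivalent if they have $\approx_\tau$-equivalent representatives; $\mathcal R^{\tau,\bullet}_{\mathbb H}(M)=\mathcal M^{\tau,\bullet}_{\mathbb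 H}(M)/\!\cong_\tau$. All quotients carry the quotient topology when $\mathbb H$ is a topological hyperfield. -}

module Defs where

open import Algebra.Structures using (IsCommutativeMonoid; IsGroup)
open import Data.Fin.Base using (Fin; toℕ)
open import Data.Fin.Subset
  using (Subset; ∣_∣; ⁅_⁆; ∁; _∪_; _∩_; _─_; _-_)
  renaming (_∈_ to _∈ˢ_; _⊆_ to _⊆ˢ_; _⊂_ to _⊂ˢ_; ⋃ to ⋃ˢ)
open import Data.Fin.Subset.Properties using (_∈?_; p∩q⊆p; p∩q⊆q)
open import Data.Irrelevant using ([_])
open import Data.List.Base as List using (List; []; _∷_; _++_; mapMaybe; allFin)
open import Data.List.Properties using (map-cong; map-∘; map-tabulate; tabulate-cong)
open import Data.List.Relation.Unary.All using (All; []; _∷_)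
open import Data.List.Relation.Unary.All.Properties using (++⁺; ++⁻ˡ; ++⁻ʳ)
open import Data.Maybe.Base as Maybe using (Maybe)
open import Data.Nat.Base using (ℕ; zero; suc; _≤_)
open import Data.Product.Base using (Σ; Σ-syntax; ∃; ∃₂; _×_; _,_; proj₁; proj₂; uncurry)
open import Data.Refinement as Refinement using (Refinement-syntax; value; _,_)
open import Data.Sum.Base using (_⊎_; inj₁; inj₂)
open import Data.Unit.Base using (⊤)
open import Data.Unit.Polymorphic.Base using () renaming (⊤ to ⊤ᵖ)
open import Data.Vec.Base using (Vec; []; _∷_; lookup; removeAt; _[_]≔_; toList)
open import Data.Vec.Relation.Unary.Unique.Propositional using (Unique)
open import Function.Base using (id)
open import Function.Bundles using (_⇔_; Func; Bijection)
open import Level using (Level; _⊔_) renaming (suc to lsuc)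
open import Relation.Binary.Bundles using (Setoid)
import Relation.Binary.Construct.On as On
open import Relation.Binary.Core using (Rel)
open import Relation.Binary.Definitions using (_Respects_)
open import Relation.Binary.Structures using (IsEquivalence)
open import Relation.Binary.PropositionalEquality
  using (_≡_; _≢_; refl; sym; trans; cong; cong₂; subst; setoid; _→-setoid_; module ≡-Reasoning)
open import Relation.Nullary using (¬_)
open import Relation.Nullary.Decidable using (dec⇒maybe)
open import Relation.Unary using (Pred; Decidable; _∈_; _≐_; _⊢_; ｛_｝; Satisfiable; ⋃)
  renaming (_∩_ to _∩ᴾ_)

private
  variable
    a o : Level
    n d : ℕ

record Hyperfield a : Set (lsuc a) where
  infixl 6 _⊞_ _⊞ᴾ_
  infixl 7 _⊙_ _⊙*_
  infix  8 -_ _⁻¹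
  infix  9 ↑_
  field
    Carrier : Set a
    _⊞_     : Carrier → Carrier → Pred Carrier a
    _⊙_     : Carrier → Carrier → Carrier
    -_      : Carrier → Carrier
    0# 1#   : Carrier

  _⊞ᴾ_ : Pred Carrier a → Pred Carrier a → Pred Carrier a
  (A ⊞ᴾ B) z = ∃₂ λ x y → x ∈ A × y ∈ B × z ∈ x ⊞ y

  _⊙ᴾ_ : Carrier → Pred Carrier a → Pred Carrier a
  (x ⊙ᴾ A) z = ∃ λ y → y ∈ A × z ≡ x ⊙ y

  -- Since the standard library's ⊥ is proof-irrelevant, two elements of H*
  -- with equal first components are definitionally equal.
  H* : Set a
  H* = Σ[ x ∈ Carrier ] x ≢ 0#

  ↑_ : H* → Carrier
  ↑_ = proj₁

  field
    0≢1         : 0# ≢ 1#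
    ⊞-nonempty  : ∀ x y → ∃⟨ x ⊞ y ⟩
    ⊞-comm      : ∀ x y → x ⊞ y ≐ y ⊞ x
    ⊞-assoc     : ∀ x y z → (x ⊞ y) ⊞ᴾ ｛ z ｝ ≐ ｛ x ｝ ⊞ᴾ (y ⊞ z)
    ⊞-identityˡ : ∀ x → 0# ⊞ x ≐ ｛ x ｝
    -‿inverse   : ∀ x → 0# ∈ x ⊞ (- x)
    -‿unique    : ∀ {x y} → 0# ∈ x ⊞ y → y ≡ - x
    reversible  : ∀ {x y z} → x ∈ y ⊞ z ⇔ z ∈ x ⊞ (- y)

    ⊙-isCommutativeMonoid : IsCommutativeMonoid _≡_ _⊙_ 1#
    zeroˡ   : ∀ x → 0# ⊙ x ≡ 0#
    distrib : ∀ x y z → x ⊙ᴾ (y ⊞ z) ≐ (x ⊙ y) ⊞ (x ⊙ z)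

    ⊙-nonzero : ∀ {x y} → x ≢ 0# → y ≢ 0# → x ⊙ y ≢ 0#
    _⁻¹       : H* → H*

  _⊙*_ : H* → H* → H*
  x ⊙* y = proj₁ x ⊙ proj₁ y , ⊙-nonzero (proj₂ x) (proj₂ y)

  1* : H*
  1* = 1# , (λ 1≡0 → 0≢1 (sym 1≡0))

  field
    ⊙*-isGroup : IsGroup _≡_ _⊙*_ 1* _⁻¹

  open IsCommutativeMonoid ⊙-isCommutativeMonoid public
    using () renaming (assoc to ⊙-assoc; comm to ⊙-comm; identityˡ to ⊙-identityˡ)
  open IsGroup ⊙*-isGroup public
    using () renaming (inverseˡ to ⁻¹-inverseˡ; inverseʳ to ⁻¹-inverseʳ)

  ⊞Σ : List Carrier → Pred Carrier a
  ⊞Σ []       = ｛ 0# ｝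
  ⊞Σ (x ∷ xs) = ｛ x ｝ ⊞ᴾ ⊞Σ xs

  [-1]^_ : ℕ → Carrier
  [-1]^ zero  = 1#
  [-1]^ suc k = (- 1#) ⊙ [-1]^ k

  ⨀ : ∀ {n} → (Fin n → H*) → Vec (Fin n) d → Carrier
  ⨀ h []       = 1#
  ⨀ h (x ∷ xs) = proj₁ (h x) ⊙ ⨀ h xs

  zeroʳ : ∀ x → x ⊙ 0# ≡ 0#
  zeroʳ x = trans (⊙-comm x 0#) (zeroˡ x)

  -‿⊙ : ∀ x y → - (x ⊙ y) ≡ x ⊙ (- y)
  -‿⊙ x y = sym (-‿unique (subst (_∈ (x ⊙ y) ⊞ (x ⊙ (- y))) (zeroʳ x)
    (proj₁ (distrib x y (- y)) (0# , -‿inverse y , refl))))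

  ⊞Σ-scale : ∀ x {z} ys → z ∈ ⊞Σ ys → x ⊙ z ∈ ⊞Σ (List.map (x ⊙_) ys)
  ⊞Σ-scale x []       refl = sym (zeroʳ x)
  ⊞Σ-scale x (y ∷ ys) (_ , w , refl , w∈ , z∈) =
    x ⊙ y , x ⊙ w , refl , ⊞Σ-scale x ys w∈ , proj₁ (distrib x y w) (_ , z∈ , refl)

  0∈⊞Σ-scale : ∀ x ys → 0# ∈ ⊞Σ ys → 0# ∈ ⊞Σ (List.map (x ⊙_) ys)
  0∈⊞Σ-scale x ys 0∈ = subst (_∈ ⊞Σ (List.map (x ⊙_) ys)) (zeroʳ x) (⊞Σ-scale x ys 0∈)

  ⊙-swap : ∀ x y z → x ⊙ (y ⊙ z) ≡ y ⊙ (x ⊙ z)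
  ⊙-swap x y z = trans (sym (⊙-assoc x y z)) (trans (cong (_⊙ z) (⊙-comm x y)) (⊙-assoc y x z))

  ⊙-interchange : ∀ w x y z → (w ⊙ x) ⊙ (y ⊙ z) ≡ (w ⊙ y) ⊙ (x ⊙ z)
  ⊙-interchange w x y z = trans (⊙-assoc w x (y ⊙ z))
    (trans (cong (w ⊙_) (⊙-swap x y z)) (sym (⊙-assoc w y (x ⊙ z))))

  ⁻¹-cancelˡ : ∀ (x : H*) y → proj₁ (x ⁻¹) ⊙ (proj₁ x ⊙ y) ≡ y
  ⁻¹-cancelˡ x y = trans (sym (⊙-assoc _ _ y))
    (trans (cong (_⊙ y) (cong proj₁ (⁻¹-inverseˡ x))) (⊙-identityˡ y))

  ⁻¹-solve : ∀ (x : H*) {y z} → y ≡ proj₁ x ⊙ z → z ≡ proj₁ (x ⁻¹) ⊙ y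
  ⁻¹-solve x {y} {z} eq =
    trans (sym (⁻¹-cancelˡ x z)) (cong (proj₁ (x ⁻¹) ⊙_) (sym eq))

  ⨀-1 : ∀ {n} (xs : Vec (Fin n) d) → ⨀ (λ _ → 1*) xs ≡ 1#
  ⨀-1 []       = refl
  ⨀-1 (x ∷ xs) = trans (⊙-identityˡ _) (⨀-1 xs)

  ⨀-⊙ : ∀ {n} (h k : Fin n → H*) (xs : Vec (Fin n) d) →
        ⨀ (λ x → h x ⊙* k x) xs ≡ ⨀ h xs ⊙ ⨀ k xs
  ⨀-⊙ h k []       = sym (⊙-identityˡ 1#)
  ⨀-⊙ h k (x ∷ xs) = trans (cong (_ ⊙_) (⨀-⊙ h k xs)) (⊙-interchange _ _ _ _)

  ⨀-⁻¹ : ∀ {n} (h : Fin n → H*) (xs : Vec (Fin n) d) →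
         ⨀ (λ x → h x ⁻¹) xs ⊙ ⨀ h xs ≡ 1#
  ⨀-⁻¹ h []       = ⊙-identityˡ 1#
  ⨀-⁻¹ h (x ∷ xs) = trans (⊙-interchange _ _ _ _)
    (trans (cong₂ _⊙_ (cong proj₁ (⁻¹-inverseˡ (h x))) (⨀-⁻¹ h xs)) (⊙-identityˡ 1#))

record IsHomomorphism (H K : Hyperfield a)
                      (f : Hyperfield.Carrier H → Hyperfield.Carrier K) : Set a where
  private
    module H = Hyperfield H
    module K = Hyperfield K
  field
    0-homo : f H.0# ≡ K.0#
    1-homo : f H.1# ≡ K.1#
    ⊙-homo : ∀ x y → f (x H.⊙ y) ≡ f x K.⊙ f y
    ⊞-homo : ∀ x y {z} → z ∈ x H.⊞ y → f z ∈ f x K.⊞ f y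

record Involution (H : Hyperfield a) : Set a where
  open Hyperfield H
  field
    τ              : Carrier → Carrier
    isHomomorphism : IsHomomorphism H H τ
    involutive     : ∀ x → τ (τ x) ≡ x
  open IsHomomorphism isHomomorphism public

-- The points of a space form a setoid, so that a quotient is formed by
-- coarsening the equality; open sets are required to respect it.

record Topology (o : Level) (S : Setoid a a) : Set (lsuc (a ⊔ o)) where
  open Setoid S
  field
    Open   : Pred (Pred Carrier a) o
    Open-≈ : ∀ {U} → Open U → U Respects _≈_
    Open-≐ : ∀ {U V} → U ≐ V → Open U → Open V
    Open-⊤ : Open (λ _ → ⊤ᵖ)
    Open-∩ : ∀ {U V} → Open U → Open V → Open (U ∩ᴾ V)
    Open-⋃ : ∀ (I : Set a) {U : I → Pred Carrier a} → (∀ i → Open (U i)) → Open (⋃ I U)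

open Topology using (Open)

module _ {S₁ S₂ : Setoid a a} {o₁ o₂ : Level} where

  Continuous : Topology o₁ S₁ → Topology o₂ S₂ →
               (Setoid.Carrier S₁ → Setoid.Carrier S₂) → Set (lsuc a ⊔ o₁ ⊔ o₂)
  Continuous T₁ T₂ f = ∀ {U} → Open T₂ U → Open T₁ (f ⊢ U)

IsHomeomorphism : ∀ {S₁ S₂ : Setoid a a} {o₁ o₂} → Topology o₁ S₁ → Topology o₂ S₂ →
                  Bijection S₁ S₂ → Set (lsuc a ⊔ o₁ ⊔ o₂)
IsHomeomorphism T₁ T₂ f =
  Continuous T₁ T₂ (Bijection.to f) × Continuous T₂ T₁ (Bijection.to⁻ f)

module _ {S₁ S₂ : Setoid a a} (f : Func S₁ S₂) where
  open Func f using (to) renaming (cong to to-cong)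

  -- The initial topology along f: the subspace topology when f is an inclusion.
  induced : Topology o S₂ → Topology (lsuc a ⊔ o) S₁
  induced T = record
    { Open   = λ U → ∃ λ W → Open T W × U ≐ (to ⊢ W)
    ; Open-≈ = λ (W , oW , U⊆ , ⊆U) x≈y x∈U → ⊆U (T.Open-≈ oW (to-cong x≈y) (U⊆ x∈U))
    ; Open-≐ = λ (U⊆V , V⊆U) (W , oW , U⊆ , ⊆U) →
        W , oW , (λ v → U⊆ (V⊆U v)) , (λ w → U⊆V (⊆U w))
    ; Open-⊤ = _ , T.Open-⊤ , id , id
    ; Open-∩ = λ (W , oW , p , q) (W′ , oW′ , p′ , q′) →
        _ , T.Open-∩ oW oW′ , (λ (u , v) → p u , p′ v) , (λ (u , v) → q u , q′ v)
    ; Open-⋃ = λ I oU → _ , T.Open-⋃ I (λ i → proj₁ (proj₂ (oU i))) ,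
        (λ (i , u) → i , proj₁ (proj₂ (proj₂ (oU i))) u) ,
        (λ (i , w) → i , proj₂ (proj₂ (proj₂ (oU i))) w)
    }
    where module T = Topology T

  -- The final topology along f: the quotient topology when f is a quotient map.
  coinduced : Topology o S₁ → Topology (a ⊔ o) S₂
  coinduced T = record
    { Open   = λ U → U Respects Setoid._≈_ S₂ × Open T (to ⊢ U)
    ; Open-≈ = proj₁
    ; Open-≐ = λ (U⊆V , V⊆U) (r , oU) →
        (λ x≈y v → U⊆V (r x≈y (V⊆U v))) , T.Open-≐ (U⊆V , V⊆U) oU
    ; Open-⊤ = _ , T.Open-⊤
    ; Open-∩ = λ (r , oU) (r′ , oV) →
        (λ x≈y (u , v) → r x≈y u , r′ x≈y v) , T.Open-∩ oU oV
    ; Open-⋃ = λ I oU →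
        (λ x≈y (i , u) → i , proj₁ (oU i) x≈y u) , T.Open-⋃ I (λ i → proj₂ (oU i))
    }
    where module T = Topology T

product : ∀ {A B : Set a} → Topology o (setoid A) → Topology o (setoid B) →
          Topology (lsuc a ⊔ o) (setoid (A × B))
product T₁ T₂ = record
  { Open   = λ W → ∀ {x y} → (x , y) ∈ W →
      ∃₂ λ U V → Open T₁ U × Open T₂ V × x ∈ U × y ∈ V ×
                 (∀ {x′ y′} → x′ ∈ U → y′ ∈ V → (x′ , y′) ∈ W)
  ; Open-≈ = λ { _ refl w → w }
  ; Open-≐ = λ (W⊆ , ⊆W) oW w → let U , V , oU , oV , x∈ , y∈ , UV⊆ = oW (⊆W w) in
      U , V , oU , oV , x∈ , y∈ , λ u v → W⊆ (UV⊆ u v)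
  ; Open-⊤ = λ _ → _ , _ , T₁.Open-⊤ , T₂.Open-⊤ , _ , _ , _
  ; Open-∩ = λ oW oW′ (w , w′) →
      let U , V , oU , oV , x∈ , y∈ , UV⊆ = oW w
          U′ , V′ , oU′ , oV′ , x∈′ , y∈′ , UV⊆′ = oW′ w′
      in _ , _ , T₁.Open-∩ oU oU′ , T₂.Open-∩ oV oV′ , (x∈ , x∈′) , (y∈ , y∈′) ,
         λ (u , u′) (v , v′) → UV⊆ u v , UV⊆′ u′ v′
  ; Open-⋃ = λ I oW (i , w) → let U , V , oU , oV , x∈ , y∈ , UV⊆ = oW i w in
      U , V , oU , oV , x∈ , y∈ , λ u v → i , UV⊆ u v
  }
  where
  module T₁ = Topology T₁
  module T₂ = Topology T₂

-- The product topology on X^I: every point of an open set has a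
-- neighbourhood inside it given by open conditions on finitely many
-- coordinates.
module _ (I : Set) {X : Set a} (T : Topology o (setoid X)) where
  private module T = Topology T

  Condition : Set (lsuc a ⊔ o)
  Condition = I × Σ (Pred X a) (Open T)

  Satisfies : (I → X) → Condition → Set a
  Satisfies f (i , U , _) = f i ∈ U

  private
    satisfies-≗ : ∀ {f g} → (∀ i → f i ≡ g i) → ∀ {cs} → All (Satisfies f) cs → All (Satisfies g) cs
    satisfies-≗ f≗g []                              = []
    satisfies-≗ f≗g {(i , U , _) ∷ _} (f∈U ∷ f∈cs) =
      subst (_∈ U) (f≗g i) f∈U ∷ satisfies-≗ f≗g f∈cs

  power : Topology (lsuc a ⊔ o) (I →-setoid X)
  power = record
    { Open   = λ W → ∀ {f} → f ∈ W →
        ∃ λ cs → All (Satisfies f) cs × (∀ {g} → All (Satisfies g) cs → g ∈ W)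
    ; Open-≈ = λ oW f≗g f∈W → let cs , f∈cs , cs⊆W = oW f∈W in cs⊆W (satisfies-≗ f≗g f∈cs)
    ; Open-≐ = λ (W⊆ , ⊆W) oW w → let cs , f∈cs , cs⊆W = oW (⊆W w) in
        cs , f∈cs , λ g∈cs → W⊆ (cs⊆W g∈cs)
    ; Open-⊤ = λ _ → [] , [] , _
    ; Open-∩ = λ oW oW′ (w , w′) →
        let cs , f∈cs , cs⊆W = oW w
            cs′ , f∈cs′ , cs′⊆W′ = oW′ w′
        in cs ++ cs′ , ++⁺ f∈cs f∈cs′ , λ g∈ → cs⊆W (++⁻ˡ cs g∈) , cs′⊆W′ (++⁻ʳ cs g∈)
    ; Open-⋃ = λ J oW (j , w) → let cs , f∈cs , cs⊆W = oW j w in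
        cs , f∈cs , λ g∈cs → j , cs⊆W g∈cs
    }

record TopologicalHyperfield (o : Level) (H : Hyperfield a) : Set (lsuc (a ⊔ o)) where
  open Hyperfield H
  field
    topology : Topology o (setoid Carrier)

  topology* : Topology (lsuc a ⊔ o) (setoid H*)
  topology* = induced (record { to = ↑_ ; cong = cong ↑_ }) topology

  field
    H*-open       : Open topology (_≢ 0#)
    ⊙-continuous  : Continuous (product topology topology) topology (uncurry _⊙_)
    ⁻¹-continuous : Continuous topology* topology* _⁻¹

-- Decidability of bases holds classically; constructively it says that the
-- set of bases is a genuine (finite) subset of the power set of Fin n.
record Matroid (n : ℕ) : Set₁ where
  field
    IsBasis  : Pred (Subset n) Level.zero
    isBasis? : Decidable IsBasis
    nonempty : ∃⟨ IsBasis ⟩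
    exchange : ∀ {A B x} → IsBasis A → IsBasis B → x ∈ˢ A ─ B →
               ∃ λ y → y ∈ˢ B ─ A × IsBasis ((A - x) ∪ ⁅ y ⁆)

HasRank : Matroid n → ℕ → Set
HasRank M d = ∀ {B} → Matroid.IsBasis M B → ∣ B ∣ ≡ d

module _ (𝓑 : Pred (Subset n) Level.zero) where

  Independent : Pred (Subset n) Level.zero
  Independent S = ∃ λ B → B ∈ 𝓑 × S ⊆ˢ B

  MinimalDependent : Pred (Subset n) Level.zero
  MinimalDependent C = ¬ Independent C × (∀ {S} → S ⊂ˢ C → Independent S)

-- The bases of the dual matroid are the complements of the bases of M.
DualBasis : Matroid n → Pred (Subset n) Level.zero
DualBasis M B = Matroid.IsBasis M (∁ B)

Circuit : Matroid n → Set
Circuit {n} M = [ C ∈ Subset n ∣ MinimalDependent (Matroid.IsBasis M) C ]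

Cocircuit : Matroid n → Set
Cocircuit {n} M = [ D ∈ Subset n ∣ MinimalDependent (DualBasis M) D ]

Element : Subset n → Set
Element {n} S = [ x ∈ Fin n ∣ x ∈ˢ S ]

elements : (S : Subset n) → List (Element S)
elements S = mapMaybe (λ x → Maybe.map (λ x∈S → x , [ x∈S ]) (dec⇒maybe (x ∈? S))) (allFin _)

entries : Vec (Fin n) d → Subset n
entries xs = ⋃ˢ (List.map ⁅_⁆ (toList xs))

data Strength : Set where
  weak strong : Strength

-- Whether the incidence condition is imposed on two sets, k being the
-- size of their difference or intersection.
Required : Strength → ℕ → Set
Required weak   k = k ≤ 3
Required strong k = ⊤

-- Two _~_-classes are linked if they have _≈_-related representatives.
module _ {A : Set a} (_~_ _≈_ : Rel A a) where

  Linked : Rel A a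
  Linked x y = ∃₂ λ x′ y′ → x ~ x′ × y ~ y′ × x′ ≈ y′

  linked-isEquivalence :
    IsEquivalence _~_ → IsEquivalence _≈_ →
    (∀ {x y z} → x ≈ y → y ~ z → ∃ λ w → x ~ w × w ≈ z) →
    IsEquivalence Linked
  linked-isEquivalence E~ E≈ commute = record
    { refl  = _ , _ , E~.refl , E~.refl , E≈.refl
    ; sym   = λ (x′ , y′ , p , q , r) → y′ , x′ , q , p , E≈.sym r
    ; trans = λ (x′ , y′ , p , q , r) (y″ , z″ , p′ , q′ , r′) →
        let w , x′~w , w≈y″ = commute r (E~.trans (E~.sym q) p′)
        in w , z″ , E~.trans p x′~w , q′ , E≈.trans w≈y″ r′
    }
    where
    module E~ = IsEquivalence E~
    module E≈ = IsEquivalence E≈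

module GrassmannPlücker (H : Hyperfield a) {n : ℕ} (M : Matroid n) (d : ℕ) (• : Strength) where
  open Hyperfield H
  open Matroid M

  private
    E : Set
    E = Fin n

  -- Transpositions generate the symmetric group, so it suffices to ask that
  -- they change the sign.  Repeated arguments are treated separately because
  -- x ≡ - x does not imply x ≡ 0#.
  record Alternating (φ : Vec E d → Carrier) : Set a where
    field
      vanishing : ∀ xs {i j} → i ≢ j → lookup xs i ≡ lookup xs j → φ xs ≡ 0#
      swapping  : ∀ xs {i j} → i ≢ j →
                  φ (xs [ i ]≔ lookup xs j [ j ]≔ lookup xs i) ≡ - φ xs

  -- Fin counts from 0, so the k-th term has sign (-1)^(k+1).
  plückerTerm : ∀ {e} → (Vec E (suc e) → Carrier) →
                Vec E (suc (suc e)) → Vec E e → Fin (suc (suc e)) → Carrier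
  plückerTerm φ xs ys k =
    ([-1]^ suc (toℕ k)) ⊙ φ (removeAt xs k) ⊙ φ (lookup xs k ∷ ys)

  -- Unique says that the sets I and J listed by xs and ys really have d + 1
  -- and d - 1 elements.  In rank 0 there is no set J of size d - 1.
  PlückerRelations : ∀ {d} → (Vec E d → Carrier) → Set a
  PlückerRelations {zero}  φ = ⊤ᵖ
  PlückerRelations {suc e} φ =
    ∀ xs ys → Unique xs → Unique ys → Required • ∣ entries xs ─ entries ys ∣ →
    0# ∈ ⊞Σ (List.tabulate (plückerTerm φ xs ys))

  -- The last two fields say that the support of φ consists exactly of the
  -- ordered bases of M, in a positive form that does not presuppose a
  -- decidable equality on H.
  record GPFunction : Set a where
    field
      φ           : Vec E d → Carrier
      nonzero     : ∃ λ xs → φ xs ≢ 0#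
      alternating : Alternating φ
      relations   : PlückerRelations φ
      basis⇒≢0    : ∀ xs → IsBasis (entries xs) → φ xs ≢ 0#
      nonbasis⇒≡0 : ∀ xs → ¬ IsBasis (entries xs) → φ xs ≡ 0#
    open Alternating alternating public

  open GPFunction using (φ)

  _~_ : Rel GPFunction a
  f ~ g = ∃ λ (c : H*) → ∀ xs → φ f xs ≡ ↑ c ⊙ φ g xs

  _≈_ : Rel GPFunction a
  f ≈ g = ∃ λ (h : E → H*) → ∀ xs → φ f xs ≡ ⨀ h xs ⊙ φ g xs

  _≅_ : Rel GPFunction a
  _≅_ = Linked _~_ _≈_

  private
    relations-scale : ∀ {d} (c : Carrier) {φ : Vec E d → Carrier} →
                      PlückerRelations φ → PlückerRelations (λ xs → c ⊙ φ xs)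
    relations-scale {zero}  c     rel = _
    relations-scale {suc e} c {φ} rel xs ys xs! ys! req =
      subst (λ ts → 0# ∈ ⊞Σ ts)
        (trans (map-tabulate (plückerTerm φ xs ys) ((c ⊙ c) ⊙_)) (tabulate-cong scaled))
        (0∈⊞Σ-scale (c ⊙ c) (List.tabulate (plückerTerm φ xs ys)) (rel xs ys xs! ys! req))
      where
      scaled : ∀ k → (c ⊙ c) ⊙ plückerTerm φ xs ys k ≡ plückerTerm (λ xs → c ⊙ φ xs) xs ys k
      scaled k = trans (⊙-interchange c c _ _)
        (cong (_⊙ (c ⊙ φ (lookup xs k ∷ ys))) (⊙-swap c _ _))

  scale : H* → GPFunction → GPFunction
  scale c f = record
    { φ           = λ xs → ↑ c ⊙ f.φ xs
    ; nonzero     = proj₁ f.nonzero , ⊙-nonzero (proj₂ c) (proj₂ f.nonzero)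
    ; alternating = record
      { vanishing = λ xs i≢j eq → trans (cong (↑ c ⊙_) (f.vanishing xs i≢j eq)) (zeroʳ (↑ c))
      ; swapping  = λ xs i≢j → trans (cong (↑ c ⊙_) (f.swapping xs i≢j)) (sym (-‿⊙ (↑ c) _))
      }
    ; relations   = relations-scale (↑ c) f.relations
    ; basis⇒≢0    = λ xs b → ⊙-nonzero (proj₂ c) (f.basis⇒≢0 xs b)
    ; nonbasis⇒≡0 = λ xs ¬b → trans (cong (↑ c ⊙_) (f.nonbasis⇒≡0 xs ¬b)) (zeroʳ (↑ c))
    }
    where module f = GPFunction f

  ~-isEquivalence : IsEquivalence _~_
  ~-isEquivalence = record
    { refl  = 1* , λ xs → sym (⊙-identityˡ _)
    ; sym   = λ (c , eq) → c ⁻¹ , λ xs → ⁻¹-solve c (eq xs)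
    ; trans = λ (c , eq) (c′ , eq′) → c ⊙* c′ , λ xs →
        trans (eq xs) (trans (cong (↑ c ⊙_) (eq′ xs)) (sym (⊙-assoc _ _ _)))
    }

  ≈-isEquivalence : IsEquivalence _≈_
  ≈-isEquivalence = record
    { refl  = (λ _ → 1*) , λ xs → sym (trans (cong (_⊙ _) (⨀-1 xs)) (⊙-identityˡ _))
    ; sym   = λ {f} {g} (h , eq) → (λ x → h x ⁻¹) , λ xs → begin
        φ g xs                                     ≡⟨ ⊙-identityˡ _ ⟨
        1# ⊙ φ g xs                                ≡⟨ cong (_⊙ φ g xs) (⨀-⁻¹ h xs) ⟨
        ⨀ (λ x → h x ⁻¹) xs ⊙ ⨀ h xs ⊙ φ g xs    ≡⟨ ⊙-assoc _ _ _ ⟩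
        ⨀ (λ x → h x ⁻¹) xs ⊙ (⨀ h xs ⊙ φ g xs)  ≡⟨ cong (_ ⊙_) (eq xs) ⟨
        ⨀ (λ x → h x ⁻¹) xs ⊙ φ f xs              ∎
    ; trans = λ {f} {g} {k} (h , eq) (h′ , eq′) → (λ x → h x ⊙* h′ x) , λ xs → begin
        φ f xs                            ≡⟨ eq xs ⟩
        ⨀ h xs ⊙ φ g xs                  ≡⟨ cong (_ ⊙_) (eq′ xs) ⟩
        ⨀ h xs ⊙ (⨀ h′ xs ⊙ φ k xs)     ≡⟨ ⊙-assoc _ _ _ ⟨
        ⨀ h xs ⊙ ⨀ h′ xs ⊙ φ k xs       ≡⟨ cong (_⊙ φ k xs) (⨀-⊙ h h′ xs) ⟨
        ⨀ (λ x → h x ⊙* h′ x) xs ⊙ φ k xs ∎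
    }
    where open ≡-Reasoning

  ≅-isEquivalence : IsEquivalence _≅_
  ≅-isEquivalence = linked-isEquivalence _~_ _≈_ ~-isEquivalence ≈-isEquivalence
    λ {f} {g} (h , eq) (c , eq′) → scale (c ⁻¹) f ,
      IsEquivalence.sym ~-isEquivalence {scale (c ⁻¹) f} {f} (c ⁻¹ , λ _ → refl) ,
      h , λ xs → trans (cong (_ ⊙_) (eq xs))
        (trans (⊙-swap _ _ _) (cong (_ ⊙_) (sym (⁻¹-solve c (eq′ xs)))))

  𝓝 𝓜 𝓡 : Setoid a a
  𝓝 = On.setoid (Vec E d →-setoid Carrier) φ
  𝓜 = record { isEquivalence = ~-isEquivalence }
  𝓡 = record { isEquivalence = ≅-isEquivalence }

  𝓝⟶𝓜 : Func 𝓝 𝓜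
  𝓝⟶𝓜 = record { to = id ; cong = λ f≗g → 1* , λ xs → trans (f≗g xs) (sym (⊙-identityˡ _)) }

  𝓜⟶𝓡 : Func 𝓜 𝓡
  𝓜⟶𝓡 = record
    { to   = id
    ; cong = λ {f} {g} f~g → g , g , f~g , IsEquivalence.refl ~-isEquivalence {g} ,
               IsEquivalence.refl ≈-isEquivalence {g}
    }

  module _ (T : TopologicalHyperfield o H) where
    open TopologicalHyperfield T

    topology𝓝 : Topology (lsuc a ⊔ o) 𝓝
    topology𝓝 = induced (record { to = φ ; cong = id }) (power (Vec E d) topology)

    topology𝓜 : Topology (lsuc a ⊔ o) 𝓜
    topology𝓜 = coinduced 𝓝⟶𝓜 topology𝓝

    topology𝓡 : Topology (lsuc a ⊔ o) 𝓡
    topology𝓡 = coinduced 𝓜⟶𝓡 topology𝓜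

module Signatures (H : Hyperfield a) (inv : Involution H) {n : ℕ} (M : Matroid n) (• : Strength) where
  open Hyperfield H
  open Involution inv

  orthogonalityTerm : (C D : Subset n) → (Element C → H*) → (Element D → H*) →
                      Element (C ∩ D) → Carrier
  orthogonalityTerm C D γC δD x = ↑ γC (Refinement.refine (p∩q⊆p C D) x) ⊙
                                  τ (↑ δD (Refinement.refine (p∩q⊆q C D) x))

  record OrthogonalPair : Set a where
    field
      γ          : (C : Circuit M) → Element (value C) → H*
      δ          : (D : Cocircuit M) → Element (value D) → H*
      orthogonal : ∀ C D → Required • ∣ value C ∩ value D ∣ →
                   0# ∈ ⊞Σ (List.map (orthogonalityTerm (value C) (value D) (γ C) (δ D))
                                     (elements (value C ∩ value D)))

  open OrthogonalPair using (γ; δ)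

  _~_ : Rel OrthogonalPair a
  p ~ q = ∃₂ λ (b : Circuit M → H*) (l : Cocircuit M → H*) →
    (∀ C x → ↑ γ p C x ≡ ↑ b C ⊙ ↑ γ q C x) ×
    (∀ D y → ↑ δ p D y ≡ ↑ l D ⊙ ↑ δ q D y)

  _≈_ : Rel OrthogonalPair a
  p ≈ q = ∃ λ (h : Fin n → H*) →
    (∀ C x → ↑ γ p C x ≡ ↑ h (value x) ⊙ ↑ γ q C x) ×
    (∀ D y → ↑ δ p D y ≡ τ (↑ (h (value y) ⁻¹)) ⊙ ↑ δ q D y)

  _≅_ : Rel OrthogonalPair a
  _≅_ = Linked _~_ _≈_

  scale : (Circuit M → H*) → (Cocircuit M → H*) → OrthogonalPair → OrthogonalPair
  scale b l p = record
    { γ          = λ C x → b C ⊙* γ p C x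
    ; δ          = λ D y → l D ⊙* δ p D y
    ; orthogonal = λ C D req →
        let xs = elements (value C ∩ value D)
            t  = orthogonalityTerm (value C) (value D) (γ p C) (δ p D)
            k  = ↑ b C ⊙ τ (↑ l D)
        in subst (λ ts → 0# ∈ ⊞Σ ts)
             (trans (sym (map-∘ {g = k ⊙_} {f = t} xs))
                    (map-cong (λ x → trans (⊙-interchange _ _ _ _)
                                           (cong (_ ⊙_) (sym (⊙-homo _ _)))) xs))
             (0∈⊞Σ-scale k (List.map t xs) (OrthogonalPair.orthogonal p C D req))
    }

  private
    τ⁻¹-1 : τ (↑ (1* ⁻¹)) ≡ 1#
    τ⁻¹-1 = trans (cong τ (trans (sym (⊙-identityˡ _)) (cong ↑_ (⁻¹-inverseʳ 1*)))) 1-homo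

    τ⁻¹-⊙ : ∀ x y → τ (↑ ((x ⊙* y) ⁻¹)) ≡ τ (↑ (x ⁻¹)) ⊙ τ (↑ (y ⁻¹))
    τ⁻¹-⊙ x y = trans (cong τ (begin
      ↑ z                                       ≡⟨ ⁻¹-cancelˡ x _ ⟨
      ↑ (x ⁻¹) ⊙ (↑ x ⊙ ↑ z)                    ≡⟨ cong (_ ⊙_) (⁻¹-cancelˡ y _) ⟨
      ↑ (x ⁻¹) ⊙ (↑ (y ⁻¹) ⊙ (↑ y ⊙ (↑ x ⊙ ↑ z)))
        ≡⟨ cong (λ t → ↑ (x ⁻¹) ⊙ (↑ (y ⁻¹) ⊙ t)) (trans (⊙-swap _ _ _) (sym (⊙-assoc _ _ _))) ⟩
      ↑ (x ⁻¹) ⊙ (↑ (y ⁻¹) ⊙ (↑ (x ⊙* y) ⊙ ↑ z))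
        ≡⟨ cong (λ t → ↑ (x ⁻¹) ⊙ (↑ (y ⁻¹) ⊙ t)) (cong ↑_ (⁻¹-inverseʳ (x ⊙* y))) ⟩
      ↑ (x ⁻¹) ⊙ (↑ (y ⁻¹) ⊙ 1#)                ≡⟨ cong (_ ⊙_) (trans (⊙-comm _ _) (⊙-identityˡ _)) ⟩
      ↑ (x ⁻¹) ⊙ ↑ (y ⁻¹)                       ∎)) (⊙-homo _ _)
      where
      open ≡-Reasoning
      z = (x ⊙* y) ⁻¹

    τ⁻¹-solve : ∀ x {y z} → y ≡ τ (↑ (x ⁻¹)) ⊙ z → z ≡ τ (↑ ((x ⁻¹) ⁻¹)) ⊙ y
    τ⁻¹-solve x {y} {z} eq = begin
      z                                               ≡⟨ ⊙-identityˡ z ⟨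
      1# ⊙ z                                          ≡⟨ cong (_⊙ z) 1-homo ⟨
      τ 1# ⊙ z                                        ≡⟨ cong (λ t → τ (↑ t) ⊙ z) (⁻¹-inverseˡ (x ⁻¹)) ⟨
      τ (↑ ((x ⁻¹) ⁻¹) ⊙ ↑ (x ⁻¹)) ⊙ z                ≡⟨ cong (_⊙ z) (⊙-homo _ _) ⟩
      τ (↑ ((x ⁻¹) ⁻¹)) ⊙ τ (↑ (x ⁻¹)) ⊙ z            ≡⟨ ⊙-assoc _ _ _ ⟩
      τ (↑ ((x ⁻¹) ⁻¹)) ⊙ (τ (↑ (x ⁻¹)) ⊙ z)          ≡⟨ cong (_ ⊙_) eq ⟨
      τ (↑ ((x ⁻¹) ⁻¹)) ⊙ y                           ∎
      where open ≡-Reasoning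

  ~-isEquivalence : IsEquivalence _~_
  ~-isEquivalence = record
    { refl  = (λ _ → 1*) , (λ _ → 1*) ,
        (λ _ _ → sym (⊙-identityˡ _)) , (λ _ _ → sym (⊙-identityˡ _))
    ; sym   = λ (b , l , eq , eq′) → (λ C → b C ⁻¹) , (λ D → l D ⁻¹) ,
        (λ C x → ⁻¹-solve (b C) (eq C x)) , (λ D y → ⁻¹-solve (l D) (eq′ D y))
    ; trans = λ (b₁ , l₁ , p₁ , q₁) (b₂ , l₂ , p₂ , q₂) →
        (λ C → b₁ C ⊙* b₂ C) , (λ D → l₁ D ⊙* l₂ D) ,
        (λ C x → trans (p₁ C x) (trans (cong (_ ⊙_) (p₂ C x)) (sym (⊙-assoc _ _ _)))) ,
        (λ D y → trans (q₁ D y) (trans (cong (_ ⊙_) (q₂ D y)) (sym (⊙-assoc _ _ _))))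
    }

  ≈-isEquivalence : IsEquivalence _≈_
  ≈-isEquivalence = record
    { refl  = (λ _ → 1*) , (λ _ _ → sym (⊙-identityˡ _)) ,
        (λ _ _ → sym (trans (cong (_⊙ _) τ⁻¹-1) (⊙-identityˡ _)))
    ; sym   = λ (h , p , q) → (λ x → h x ⁻¹) ,
        (λ C x → ⁻¹-solve (h (value x)) (p C x)) , (λ D y → τ⁻¹-solve (h (value y)) (q D y))
    ; trans = λ (h₁ , p₁ , q₁) (h₂ , p₂ , q₂) → (λ x → h₁ x ⊙* h₂ x) ,
        (λ C x → trans (p₁ C x) (trans (cong (_ ⊙_) (p₂ C x)) (sym (⊙-assoc _ _ _)))) ,
        (λ D y → trans (q₁ D y) (trans (cong (_ ⊙_) (q₂ D y)) (trans (sym (⊙-assoc _ _ _))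
          (cong (_⊙ _) (sym (τ⁻¹-⊙ (h₁ (value y)) (h₂ (value y))))))))
    }

  ≅-isEquivalence : IsEquivalence _≅_
  ≅-isEquivalence = linked-isEquivalence _~_ _≈_ ~-isEquivalence ≈-isEquivalence
    λ {p} (h , eq₁ , eq₂) (b , l , eq₃ , eq₄) →
      let b⁻¹ = λ C → b C ⁻¹
          l⁻¹ = λ D → l D ⁻¹
          s   = scale b⁻¹ l⁻¹ p
      in s ,
         IsEquivalence.sym ~-isEquivalence {s} {p} (b⁻¹ , l⁻¹ , (λ _ _ → refl) , (λ _ _ → refl)) ,
         h ,
         (λ C x → trans (cong (_ ⊙_) (eq₁ C x))
            (trans (⊙-swap _ _ _) (cong (_ ⊙_) (sym (⁻¹-solve (b C) (eq₃ C x)))))) ,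
         (λ D y → trans (cong (_ ⊙_) (eq₂ D y))
            (trans (⊙-swap _ _ _) (cong (_ ⊙_) (sym (⁻¹-solve (l D) (eq₄ D y))))))

  Coordinate : Set
  Coordinate = (Σ[ C ∈ Circuit M ] Element (value C)) ⊎ (Σ[ D ∈ Cocircuit M ] Element (value D))

  coordinates : OrthogonalPair → Coordinate → H*
  coordinates p (inj₁ (C , x)) = γ p C x
  coordinates p (inj₂ (D , y)) = δ p D y

  𝓝 𝓜 𝓡 : Setoid a a
  𝓝 = On.setoid (Coordinate →-setoid H*) coordinates
  𝓜 = record { isEquivalence = ~-isEquivalence }
  𝓡 = record { isEquivalence = ≅-isEquivalence }

  𝓝⟶𝓜 : Func 𝓝 𝓜
  𝓝⟶𝓜 = record
    { to   = id
    ; cong = λ p≗q → (λ _ → 1*) , (λ _ → 1*) ,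
        (λ C x → trans (cong ↑_ (p≗q (inj₁ (C , x)))) (sym (⊙-identityˡ _))) ,
        (λ D y → trans (cong ↑_ (p≗q (inj₂ (D , y)))) (sym (⊙-identityˡ _)))
    }

  𝓜⟶𝓡 : Func 𝓜 𝓡
  𝓜⟶𝓡 = record
    { to   = id
    ; cong = λ {p} {q} p~q → q , q , p~q , IsEquivalence.refl ~-isEquivalence {q} ,
               IsEquivalence.refl ≈-isEquivalence {q}
    }

  module _ (T : TopologicalHyperfield o H) where
    open TopologicalHyperfield T

    topology𝓝 : Topology (lsuc a ⊔ o) 𝓝
    topology𝓝 = induced (record { to = coordinates ; cong = id }) (power Coordinate topology*)

    topology𝓜 : Topology (lsuc a ⊔ o) 𝓜
    topology𝓜 = coinduced 𝓝⟶𝓜 topology𝓝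

    topology𝓡 : Topology (lsuc a ⊔ o) 𝓡
    topology𝓡 = coinduced 𝓜⟶𝓡 topology𝓜

{-# OPTIONS --safe #-}
-- A Grassmann–Plücker function is, up to the signs of orderings, a function Φ
-- on the bases, and its relations are indexed by sets I and J, with one term
-- for each z ∈ I ─ J such that I ⊖ z and J ⊕ z are bases.  Such z form the
-- intersection of a circuit C, determined by I, and a cocircuit D, determined
-- by J, and a pair of signatures matches Φ if γ C is proportional to Φ (I ⊖ z)
-- and τ ∘ δ D to Φ (J ⊕ z), up to signs, for all such I and J.  For matching
-- data the Plücker relations and orthogonality are the same condition.
--
-- Each side determines the other up to scaling.  From Φ, a signature is read
-- off a chosen spanning set of each circuit and cocircuit; two choices joined
-- by one exchange agree by a three-term relation with one vanishing term.
-- From orthogonal signatures, whose values prescribe the ratios of Φ on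
-- adjacent bases, Φ is built by descent towards a fixed basis; the ratios are
-- consistent because they are so on triangles and squares of bases, and each
-- edge is joined to the descent by such triangles and squares.

module Submission where

open import Defs
open import Level using (Level; 0ℓ; _⊔_) renaming (suc to lsuc)
import Algebra.Properties.Group as GroupProperties
import Algebra.Solver.CommutativeMonoid as CommutativeMonoidSolver
open import Algebra.Bundles using (CommutativeMonoid; Group)
open import Algebra.Structures using (IsGroup)
open import Data.Bool.Base using (not; if_then_else_)
import Data.Bool.Properties as Bool
open import Data.Fin.Base using (Fin; zero; suc; toℕ)
open import Data.Fin.Properties using (_≟_; any?; suc-injective)
open import Data.Fin.Subset
  using (Subset; inside; outside; ∣_∣; ⁅_⁆; ∁; _∪_; _∩_; _─_; _-_; _∈_; _∉_; _⊆_)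
  renaming (⊤ to full; ⊥ to empty)
open import Data.Fin.Subset.Properties
open import Data.Irrelevant using ([_])
open import Data.List.Base as List using (List; []; _∷_; _++_; allFin; filter; cartesianProductWith)
import Data.List.Properties as List
open import Data.List.Membership.Propositional using () renaming (_∈_ to _∈ᴸ_; _∉_ to _∉ᴸ_)
open import Data.List.Membership.Propositional.Properties
  using (∈-∃++; ∈-allFin; ∈-filter⁺; ∈-tabulate⁺; ∈-cartesianProductWith⁺)
open import Data.List.Relation.Binary.Permutation.Propositional as Perm using (_↭_; ↭-sym; ↭⇒↭ₛ)
import Data.List.Relation.Binary.Permutation.Propositional.Properties as Perm
import Data.List.Relation.Binary.Permutation.Setoid.Properties as PermSetoid
open import Data.List.Relation.Unary.All as Allᴸ using ([]; _∷_) renaming (All to Allᴸ)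
import Data.List.Relation.Unary.All.Properties as Allᴸ
open import Data.List.Relation.Unary.All.Properties using (++⁺; ++⁻ˡ; ++⁻ʳ)
open import Data.List.Relation.Unary.AllPairs using ([]; _∷_)
open import Data.List.Relation.Unary.Any using (here; there)
open import Data.List.Relation.Unary.Unique.Propositional using () renaming (Unique to Uniqueᴸ)
import Data.List.Relation.Unary.Unique.Propositional.Properties as Uniqueᴸ
open import Data.Maybe.Base as Maybe using (Maybe)
open import Data.Nat.Base as ℕ using (ℕ; zero; suc; _≤_; _<_; z≤n; s≤s)
import Data.Nat.Properties as ℕ
open import Data.Product.Base using (Σ; ∃; ∃₂; _×_; _,_; proj₁; proj₂; uncurry)
open import Data.Refinement as Refinement using (Refinement-syntax; value; _,_)
open import Data.Sign.Base as Sign using (Sign)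
import Data.Sign.Properties as Sign
open import Data.Sum.Base using (_⊎_; inj₁; inj₂; [_,_]′)
open import Data.Unit.Polymorphic.Base using () renaming (⊤ to ⊤ᵖ)
open import Data.Vec.Base as Vec using (Vec; []; _∷_; lookup; removeAt; tabulate; _[_]≔_; here; there)
open import Data.Vec.Properties
  using (≡-dec; []≔-idempotent; []≔-commutes; []≔-lookup; []≔-updates; []≔-minimal; map-[]≔;
         lookup∘tabulate; []=⇒lookup; lookup⇒[]=; lookup∘update′; lookup∘updateAt)
open import Data.Vec.Relation.Unary.All using (All; []; _∷_)
open import Data.Vec.Relation.Unary.All.Properties using (lookup⁺)
open import Data.Vec.Relation.Unary.AllPairs using ([]; _∷_)
open import Data.Vec.Relation.Unary.Unique.Propositional using (Unique)
open import Data.Vec.Relation.Unary.Unique.Propositional.Properties using (lookup-injective)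
open import Function.Base using (_∘_; id; case_of_)
open import Function.Bundles using (Bijection; Func)
open import Relation.Binary.Bundles using (Setoid)
open import Relation.Binary.PropositionalEquality hiding (J)
open import Relation.Binary.Structures using (IsEquivalence)
open import Relation.Nullary using (¬_; Dec; yes; no; does; contradiction)
open import Relation.Nullary.Decidable
  using (_×-dec_; ¬?; decidable-stable; dec-true; dec-false; dec⇒maybe; recompute)
open import Relation.Unary using (Pred; Decidable; _≐_) renaming (_∈_ to _∈ᴾ_)

-- Sums in a hyperfield are sets, so a relation yields an equation only when exactly two of its
-- terms survive; every equation drawn from a relation below is of that kind, and such relations are
-- imposed in the weak case as well. Circuits of `M` are the cocircuits of its dual, and a factor
-- `sgn z full` put into γ makes the two sides dual on the nose, so signatures and matching are
-- treated once, for a matroid `N`. That triangles and squares make the ratios consistent reflects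
-- the homotopy theorem for basis graphs; the induction on the distance to the fixed basis proves
-- the part that is needed. Only squares without an apex need an argument of their own, and there
-- parallel elements leave just two cocircuits. All choices (spanning sets, descents, listings) come
-- from decision procedures on the matroid and never look at values in H. Both maps are therefore
-- fixed expressions in products, inverses and τ, whence their continuity; they are defined on
-- larger spaces of coordinates, because that is where the open sets have to be found.

private
  variable
    a ℓ o : Level
    n k : ℕ

-- Insertion and removal of single elements, and signs counting smaller elements.

module Subsets where

  private
    variable
      S : Subset n
      x y z : Fin n

  infixl 6 _⊕_ _⊖_

  _⊕_ _⊖_ : Subset n → Fin n → Subset n
  S ⊕ x = S [ x ]≔ inside
  S ⊖ x = S [ x ]≔ outside

  ∉⇒lookup : x ∉ S → lookup S x ≡ outside
  ∉⇒lookup {x = x} {S} x∉S with lookup S x in eq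
  ... | outside = refl
  ... | inside  = contradiction (lookup⇒[]= x S eq) x∉S

  x∈S⊕x : ∀ (S : Subset n) x → x ∈ S ⊕ x
  x∈S⊕x S x = []≔-updates S x

  ∈-⊕⁺ : ∀ x → z ∈ S → z ∈ S ⊕ x
  ∈-⊕⁺ {z = z} {S} x z∈S with z ≟ x
  ... | yes refl = x∈S⊕x S x
  ... | no  z≢x  = []≔-minimal S z x z≢x z∈S

  ∈-⊕⁻ : ∀ (S : Subset n) x → z ∈ S ⊕ x → z ≢ x → z ∈ S
  ∈-⊕⁻ {z = z} S x z∈ z≢x =
    lookup⇒[]= z S (trans (sym (lookup∘update′ z≢x S inside)) ([]=⇒lookup z∈))

  ∉-⊕ : z ∉ S → z ≢ x → z ∉ S ⊕ x
  ∉-⊕ z∉S z≢x z∈ = z∉S (∈-⊕⁻ _ _ z∈ z≢x)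

  x∉S⊖x : ∀ (S : Subset n) x → x ∉ S ⊖ x
  x∉S⊖x S x x∈ with () ← trans (sym ([]=⇒lookup x∈)) ([]=⇒lookup ([]≔-updates S x))

  ∈-⊖⁺ : z ∈ S → z ≢ x → z ∈ S ⊖ x
  ∈-⊖⁺ z∈S z≢x = []≔-minimal _ _ _ z≢x z∈S

  ∈-⊖⁻ : ∀ (S : Subset n) x → z ∈ S ⊖ x → z ∈ S
  ∈-⊖⁻ {z = z} S x z∈ with z ≟ x
  ... | yes refl = contradiction z∈ (x∉S⊖x S x)
  ... | no  z≢x  = lookup⇒[]= z S (trans (sym (lookup∘update′ z≢x S outside)) ([]=⇒lookup z∈))

  ∈-⊖-≢ : ∀ (S : Subset n) x → z ∈ S ⊖ x → z ≢ x
  ∈-⊖-≢ S x z∈ refl = x∉S⊖x S x z∈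

  ⊕-⊖ : x ∉ S → S ⊕ x ⊖ x ≡ S
  ⊕-⊖ {x = x} {S} x∉S = trans ([]≔-idempotent S x)
    (trans (cong (S [ x ]≔_) (sym (∉⇒lookup x∉S))) ([]≔-lookup S x))

  ⊖-⊕ : x ∈ S → S ⊖ x ⊕ x ≡ S
  ⊖-⊕ {x = x} {S} x∈S = trans ([]≔-idempotent S x)
    (trans (cong (S [ x ]≔_) (sym ([]=⇒lookup x∈S))) ([]≔-lookup S x))

  ⊕-absorb : x ∈ S → S ⊕ x ≡ S
  ⊕-absorb {x = x} {S} x∈S =
    trans (cong (S [ x ]≔_) (sym ([]=⇒lookup x∈S))) ([]≔-lookup S x)

  ⊕-comm : ∀ (S : Subset n) x y → S ⊕ x ⊕ y ≡ S ⊕ y ⊕ x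
  ⊕-comm S x y with x ≟ y
  ... | yes refl = refl
  ... | no  x≢y  = []≔-commutes S x y x≢y

  ⊕⊖-comm : ∀ (S : Subset n) → x ≢ y → S ⊕ x ⊖ y ≡ S ⊖ y ⊕ x
  ⊕⊖-comm S x≢y = []≔-commutes S _ _ x≢y

  ⊕⊕⊖ : x ∉ S → x ≢ y → S ⊕ x ⊕ y ⊖ x ≡ S ⊕ y
  ⊕⊕⊖ {x = x} {S} {y} x∉S x≢y = trans (cong (_⊖ x) (⊕-comm S x y)) (⊕-⊖ (∉-⊕ x∉S x≢y))

  ∁-⊕ : ∀ (S : Subset n) x → ∁ (S ⊕ x) ≡ ∁ S ⊖ x
  ∁-⊕ S x = map-[]≔ not S x

  ∁-⊖ : ∀ (S : Subset n) x → ∁ (S ⊖ x) ≡ ∁ S ⊕ x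
  ∁-⊖ S x = map-[]≔ not S x

  ∁-involutive : ∀ (S : Subset n) → ∁ (∁ S) ≡ S
  ∁-involutive []            = refl
  ∁-involutive (inside  ∷ S) = cong (inside ∷_) (∁-involutive S)
  ∁-involutive (outside ∷ S) = cong (outside ∷_) (∁-involutive S)

  ∪-⁅⁆ : ∀ (S : Subset n) x → S ∪ ⁅ x ⁆ ≡ S ⊕ x
  ∪-⁅⁆ S x = ⊆-antisym
    (λ z∈ → [ ∈-⊕⁺ x , (λ z∈x → subst (_∈ S ⊕ x) (sym (x∈⁅y⁆⇒x≡y x z∈x)) (x∈S⊕x S x)) ]′ (x∈p∪q⁻ S ⁅ x ⁆ z∈))
    λ {z} z∈ → case z ≟ x of λ where
      (yes refl) → x∈p∪q⁺ (inj₂ (x∈⁅x⁆ x))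
      (no z≢x)   → x∈p∪q⁺ (inj₁ (∈-⊕⁻ S x z∈ z≢x))

  x∈p─q⁻ : ∀ (p q : Subset n) → x ∈ p ─ q → x ∉ q
  x∈p─q⁻ (_ ∷ p) (inside  ∷ q) (there x∈) (there x∈q) = x∈p─q⁻ p q x∈ x∈q
  x∈p─q⁻ (_ ∷ p) (outside ∷ q) (there x∈) (there x∈q) = x∈p─q⁻ p q x∈ x∈q

  -‿⊖ : ∀ (S : Subset n) x → S - x ≡ S ⊖ x
  -‿⊖ S x = ⊆-antisym
    (λ {z} z∈ → ∈-⊖⁺ (p─q⊆p S ⁅ x ⁆ z∈) (x∉⁅y⁆⇒x≢y (x∈p─q⁻ S ⁅ x ⁆ z∈)))
    λ z∈ → x∈p∧x≢y⇒x∈p-y (∈-⊖⁻ S x z∈) (∈-⊖-≢ S x z∈)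

  ∁─∁ : ∀ (p q : Subset n) → ∁ p ─ ∁ q ≡ q ─ p
  ∁─∁ []            []            = refl
  ∁─∁ (inside  ∷ p) (inside  ∷ q) = cong (_ ∷_) (∁─∁ p q)
  ∁─∁ (inside  ∷ p) (outside ∷ q) = cong (_ ∷_) (∁─∁ p q)
  ∁─∁ (outside ∷ p) (inside  ∷ q) = cong (_ ∷_) (∁─∁ p q)
  ∁─∁ (outside ∷ p) (outside ∷ q) = cong (_ ∷_) (∁─∁ p q)

  ∣⊕∣ : ∀ (S : Subset n) → x ∉ S → ∣ S ⊕ x ∣ ≡ suc ∣ S ∣
  ∣⊕∣ {x = zero}  (inside  ∷ S) x∉ = contradiction here x∉
  ∣⊕∣ {x = zero}  (outside ∷ S) x∉ = refl
  ∣⊕∣ {x = suc x} (inside  ∷ S) x∉ = cong suc (∣⊕∣ S (x∉ ∘ there))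
  ∣⊕∣ {x = suc x} (outside ∷ S) x∉ = ∣⊕∣ S (x∉ ∘ there)

  ∣⊖∣ : ∀ (S : Subset n) → x ∈ S → suc ∣ S ⊖ x ∣ ≡ ∣ S ∣
  ∣⊖∣ {x = x} S x∈ = trans (sym (∣⊕∣ (S ⊖ x) (x∉S⊖x S x))) (cong ∣_∣ (⊖-⊕ x∈))

  ⟪_⟫ : ∀ {P : Pred (Fin n) 0ℓ} → Decidable P → Subset n
  ⟪ P? ⟫ = tabulate (does ∘ P?)

  ∈⟪⟫⁺ : ∀ {P : Pred (Fin n) 0ℓ} (P? : Decidable P) → P x → x ∈ ⟪ P? ⟫
  ∈⟪⟫⁺ {x = x} P? px = lookup⇒[]= x _ (trans (lookup∘tabulate _ x) (dec-true (P? x) px))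

  ∈⟪⟫⁻ : ∀ {P : Pred (Fin n) 0ℓ} (P? : Decidable P) → x ∈ ⟪ P? ⟫ → P x
  ∈⟪⟫⁻ {x = x} P? x∈ with P? x in eq
  ... | yes px = px
  ... | no ¬px with () ← trans (sym ([]=⇒lookup x∈)) (trans (lookup∘tabulate _ x) (cong does eq))

  ∈∧∉⇒≢ : x ∈ S → y ∉ S → x ≢ y
  ∈∧∉⇒≢ x∈S y∉S refl = y∉S x∈S

  ⊆-dec : ∀ (S T : Subset n) → S ⊆ T ⊎ ∃ λ x → x ∈ S × x ∉ T
  ⊆-dec S T with any? (λ x → (x ∈? S) ×-dec ¬? (x ∈? T))
  ... | yes x∈   = inj₂ x∈
  ... | no  none = inj₁ λ {x} x∈S → decidable-stable (x ∈? T) λ x∉T → none (x , x∈S , x∉T)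

  -- sgn₁ x z is negative iff z < x, and sgn x S is the product of sgn₁ x z over
  -- the elements z of S.
  sgn₁ : Fin n → Fin n → Sign
  sgn₁ zero    _       = Sign.+
  sgn₁ (suc x) zero    = Sign.-
  sgn₁ (suc x) (suc y) = sgn₁ x y

  sgn : Fin n → Subset n → Sign
  sgn zero    _             = Sign.+
  sgn (suc x) (inside  ∷ S) = Sign.- Sign.* sgn x S
  sgn (suc x) (outside ∷ S) = sgn x S

  sgn₁-flip : ∀ {x y : Fin n} → x ≢ y → sgn₁ x y ≡ Sign.- Sign.* sgn₁ y x
  sgn₁-flip {x = zero}  {zero}  x≢y = contradiction refl x≢y
  sgn₁-flip {x = zero}  {suc y} x≢y = refl
  sgn₁-flip {x = suc x} {zero}  x≢y = refl
  sgn₁-flip {x = suc x} {suc y} x≢y = sgn₁-flip (x≢y ∘ cong suc)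

  sgn-⊕ : ∀ (x : Fin n) (S : Subset n) {z} → z ∉ S → sgn x (S ⊕ z) ≡ sgn₁ x z Sign.* sgn x S
  sgn-⊕ zero    S             z∉ = refl
  sgn-⊕ (suc x) (inside  ∷ S) {zero}  z∉ = contradiction here z∉
  sgn-⊕ (suc x) (outside ∷ S) {zero}  z∉ = refl
  sgn-⊕ (suc x) (inside  ∷ S) {suc z} z∉ = trans (cong Sign.opposite (sgn-⊕ x S (z∉ ∘ there)))
    (lemma (sgn₁ x z) (sgn x S))
    where
    lemma : ∀ a b → Sign.opposite (a Sign.* b) ≡ a Sign.* Sign.opposite b
    lemma Sign.+ b = refl
    lemma Sign.- b = refl
  sgn-⊕ (suc x) (outside ∷ S) {suc z} z∉ = sgn-⊕ x S (z∉ ∘ there)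

  sgn-self-⊕ : ∀ (x : Fin n) (S : Subset n) → sgn x (S ⊕ x) ≡ sgn x S
  sgn-self-⊕ zero    S             = refl
  sgn-self-⊕ (suc x) (inside  ∷ S) = cong Sign.opposite (sgn-self-⊕ x S)
  sgn-self-⊕ (suc x) (outside ∷ S) = sgn-self-⊕ x S

  -- The elements below `x` are divided between `S` and its complement, so the two signs multiply to
  -- that of the whole set; a sign is its own inverse.
  sgn-∁ : ∀ (x : Fin n) (S : Subset n) → sgn x (∁ S) ≡ sgn x full Sign.* sgn x S
  sgn-∁ zero    S             = refl
  sgn-∁ (suc x) (inside  ∷ S) = trans (sgn-∁ x S) (lemma (sgn x full) (sgn x S))
    where
    lemma : ∀ a b → a Sign.* b ≡ Sign.opposite a Sign.* Sign.opposite b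
    lemma Sign.+ b = sym (Sign.opposite-involutive b)
    lemma Sign.- b = refl
  sgn-∁ (suc x) (outside ∷ S) = trans (cong Sign.opposite (sgn-∁ x S)) (lemma (sgn x full) (sgn x S))
    where
    lemma : ∀ a b → Sign.opposite (a Sign.* b) ≡ Sign.opposite a Sign.* b
    lemma Sign.+ b = refl
    lemma Sign.- b = Sign.opposite-involutive b

open Subsets

-- Exchange of bases and the dual matroid.

module Bases (N : Matroid n) where
  open Matroid N public

  exch : ∀ {A B x} → IsBasis A → IsBasis B → x ∈ A → x ∉ B →
         ∃ λ y → y ∈ B × y ∉ A × IsBasis (A ⊖ x ⊕ y)
  exch {A} {B} {x} bA bB x∈A x∉B =
    let y , y∈ , b = exchange bA bB (x∈p∧x∉q⇒x∈p─q x∈A x∉B)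
    in y , p─q⊆p B A y∈ , x∈p─q⁻ B A y∈ ,
       subst IsBasis (trans (∪-⁅⁆ (A - x) y) (cong (_⊕ y) (-‿⊖ A x))) b

  basis-⊆ : ∀ {A B} → IsBasis A → IsBasis B → A ⊆ B → B ⊆ A
  basis-⊆ {A} {B} bA bB A⊆B with ⊆-dec B A
  ... | inj₁ B⊆A = B⊆A
  ... | inj₂ (x , x∈B , x∉A) =
    let _ , y∈A , y∉B , _ = exch bB bA x∈B x∉A in contradiction (A⊆B y∈A) y∉B

  abstract
    -- Each element of `B` outside `X ∪ A` is exchanged for one of `A`. Nothing of `X` is lost, and
    -- the number of elements outside, bounded by `k`, falls.
    augment-within : ∀ k {A B X} → ∣ B ─ (X ∪ A) ∣ ≤ k → IsBasis A → IsBasis B → X ⊆ B →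
               ∃ λ B′ → IsBasis B′ × X ⊆ B′ × B′ ⊆ X ∪ A
    augment-within k {A} {B} {X} le bA bB X⊆B with ⊆-dec B (X ∪ A)
    ... | inj₁ B⊆ = B , bB , X⊆B , B⊆
    ... | inj₂ (z , z∈B , z∉) with k
    ...   | zero  = contradiction (ℕ.≤-trans (card-pos (x∈p∧x∉q⇒x∈p─q z∈B z∉)) le) λ ()
      where
      card-pos : ∀ {S : Subset n} {x} → x ∈ S → 1 ≤ ∣ S ∣
      card-pos {S = S} x∈S = subst (1 ≤_) (∣⊖∣ S x∈S) (s≤s z≤n)
    ...   | suc k =
      let y , y∈A , y∉B , b = exch bB bA z∈B (z∉ ∘ x∈p∪q⁺ ∘ inj₂)
          z∈D = x∈p∧x∉q⇒x∈p─q z∈B z∉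
          smaller : (B ⊖ z ⊕ y) ─ (X ∪ A) ⊆ (B ─ (X ∪ A)) ⊖ z
          smaller {w} w∈ =
            let w∉  = x∈p─q⁻ _ (X ∪ A) w∈
                w∈B = ∈-⊕⁻ (B ⊖ z) y (p─q⊆p _ (X ∪ A) w∈) λ { refl → w∉ (x∈p∪q⁺ (inj₂ y∈A)) }
            in ∈-⊖⁺ (x∈p∧x∉q⇒x∈p─q (∈-⊖⁻ B z w∈B) w∉) (∈-⊖-≢ B z w∈B)
      in augment-within k
           (ℕ.≤-trans (p⊆q⇒∣p∣≤∣q∣ smaller)
             (ℕ.≤-pred (subst (_≤ suc k) (sym (∣⊖∣ _ z∈D)) le)))
           bA b λ x∈X → ∈-⊕⁺ y (∈-⊖⁺ (X⊆B x∈X) λ { refl → z∉ (x∈p∪q⁺ (inj₁ x∈X)) })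

    augment : ∀ {A B X} → IsBasis A → IsBasis B → X ⊆ B →
              ∃ λ B′ → IsBasis B′ × X ⊆ B′ × B′ ⊆ X ∪ A
    augment = augment-within _ ℕ.≤-refl

    -- Extend `(A ∩ B) ⊕ x` to a basis `B′` by elements of `A`. Some `y` of `A` is missing from
    -- `B′`, and an exchange of `y` against `B′` can only bring in `x`, the one element of `B′`
    -- outside `A`.
    coexch : ∀ {A B x} → IsBasis A → IsBasis B → x ∈ B → x ∉ A →
             ∃ λ y → y ∈ A × y ∉ B × IsBasis (A ⊖ y ⊕ x)
    coexch {A} {B} {x} bA bB x∈B x∉A
      with B′ , bB′ , X⊆B′ , B′⊆ ← augment {X = (A ∩ B) ⊕ x} bA bB
             (λ {z} z∈ → case z ≟ x of λ where
               (yes refl) → x∈B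
               (no z≢x)   → p∩q⊆q A B (∈-⊕⁻ (A ∩ B) x z∈ z≢x))
      with ⊆-dec A B′
    ... | inj₁ A⊆B′ = contradiction (basis-⊆ bA bB′ A⊆B′ (X⊆B′ (x∈S⊕x (A ∩ B) x))) x∉A
    ... | inj₂ (y , y∈A , y∉B′) =
      let w , w∈B′ , w∉A , b = exch bA bB′ y∈A y∉B′
          w≡x = decidable-stable (w ≟ x) λ w≢x →
                  [ (λ w∈X → w∉A (p∩q⊆p A B (∈-⊕⁻ (A ∩ B) x w∈X w≢x))) , w∉A ]′
                  (x∈p∪q⁻ _ A (B′⊆ w∈B′))
      in y , y∈A , (λ y∈B → y∉B′ (X⊆B′ (∈-⊕⁺ x (x∈p∩q⁺ (y∈A , y∈B))))) ,
         subst (λ t → IsBasis (A ⊖ y ⊕ t)) w≡x b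

  Completes : Subset n → Fin n → Set
  Completes J z = z ∉ J × IsBasis (J ⊕ z)

  completes? : ∀ J → Decidable (Completes J)
  completes? J z = ¬? (z ∈? J) ×-dec isBasis? (J ⊕ z)

  completion : Subset n → Subset n
  completion J = ⟪ completes? J ⟫

  -- J is a basis of the hyperplane complementary to the cocircuit D.  If N is
  -- the dual of M, then ∁ J is a basis of M together with one more element, and
  -- D is the circuit of M in ∁ J.
  Spans : Subset n → Subset n → Set
  Spans J D = D ≡ completion J × ∃ λ x → x ∈ D

  IsCocircuit : Subset n → Set
  IsCocircuit D = ∃ λ J → Spans J D

dual : Matroid n → Matroid n
dual {n} M = record
  { IsBasis  = DualBasis M
  ; isBasis? = isBasis? ∘ ∁
  ; nonempty = let B , b = nonempty in ∁ B , subst IsBasis (sym (∁-involutive B)) b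
  -- Complementation turns removal into insertion, so the exchange axiom of the dual is the reversed
  -- exchange `coexch` of `M`.
  ; exchange = λ {A} {B} {x} bA bB x∈ →
      let x∉∁A = λ x∈∁A → x∈∁p⇒x∉p x∈∁A (p─q⊆p A B x∈)
          x∈∁B = x∉p⇒x∈∁p (x∈p─q⁻ A B x∈)
          y , y∈∁A , y∉∁B , b = coexch bA bB x∈∁B x∉∁A
      in y , x∈p∧x∉q⇒x∈p─q (x∉∁p⇒x∈p y∉∁B) (x∈∁p⇒x∉p y∈∁A) ,
         subst IsBasis (eq A (∈∧∉⇒≢ y∈∁A x∉∁A)) b
  }
  where
  open Bases M
  eq : ∀ A {x y} → y ≢ x → ∁ A ⊖ y ⊕ x ≡ ∁ ((A - x) ∪ ⁅ y ⁆)
  eq A {x} {y} y≢x = begin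
    ∁ A ⊖ y ⊕ x          ≡⟨ ⊕⊖-comm (∁ A) (y≢x ∘ sym) ⟨
    ∁ A ⊕ x ⊖ y          ≡⟨ cong (_⊖ y) (∁-⊖ A x) ⟨
    ∁ (A ⊖ x) ⊖ y        ≡⟨ ∁-⊕ (A ⊖ x) y ⟨
    ∁ (A ⊖ x ⊕ y)        ≡⟨ cong (λ t → ∁ (t ⊕ y)) (-‿⊖ A x) ⟨
    ∁ ((A - x) ⊕ y)      ≡⟨ cong ∁ (∪-⁅⁆ (A - x) y) ⟨
    ∁ ((A - x) ∪ ⁅ y ⁆)  ∎
    where open ≡-Reasoning

-- Cocircuits and their spanning sets.

module Cocircuits {n : ℕ} (N : Matroid n) where
  open Bases N public

  -- A cocircuit is a minimal set that meets every basis. `Isolates` is the minimality, in a form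
  -- that supplies bases; neither property refers to a spanning set, so they serve to pass from one
  -- spanning set to another.
  Meets Isolates : Subset n → Set
  Meets D    = ∀ {B} → IsBasis B → ∃ λ z → z ∈ D × z ∈ B
  Isolates D = ∀ {z} → z ∈ D → ∃ λ B → IsBasis B × (∀ {w} → w ∈ B → w ∈ D → w ≡ z)

  ∈-spans⁻ : ∀ {J D z} → Spans J D → z ∈ D → Completes J z
  ∈-spans⁻ {J} (refl , _) = ∈⟪⟫⁻ (completes? J)

  ∈-spans⁺ : ∀ {J D z} → Spans J D → Completes J z → z ∈ D
  ∈-spans⁺ {J} (refl , _) = ∈⟪⟫⁺ (completes? J)

  spans-completion : ∀ {J x} → Completes J x → Spans J (completion J)
  spans-completion {J} {x} c = refl , x , ∈⟪⟫⁺ (completes? J) c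

  spans⇒meets : ∀ {J D} → Spans J D → Meets D
  spans⇒meets {J} sp@(_ , x , x∈D) {B} bB with x ∈? B
  ... | yes x∈B = x , x∈D , x∈B
  ... | no  x∉B =
    let x∉J , bJx = ∈-spans⁻ sp x∈D
        y , y∈B , y∉ , b = exch bJx bB (x∈S⊕x J x) x∉B
    in y , ∈-spans⁺ sp (y∉ ∘ ∈-⊕⁺ x , subst (λ t → IsBasis (t ⊕ y)) (⊕-⊖ x∉J) b) , y∈B

  spans⇒isolates : ∀ {J D} → Spans J D → Isolates D
  spans⇒isolates {J} sp {z} z∈D = J ⊕ z , proj₂ (∈-spans⁻ sp z∈D) , λ {w} w∈ w∈D →
    decidable-stable (w ≟ z) λ w≢z → proj₁ (∈-spans⁻ sp w∈D) (∈-⊕⁻ J z w∈ w≢z)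

  -- A basis `J ⊕ z` meets `D`, and can do so only in `z`. Conversely, for `z` in `D`, exchange `x`
  -- in `J ⊕ x` against a basis isolating `z`: the entering element lies in `D` by the first part,
  -- hence is `z`.
  spans-criterion : ∀ {D J x} → Meets D → Isolates D → (∀ {w} → w ∈ J → w ∉ D) →
                    x ∈ D → IsBasis (J ⊕ x) → Spans J D
  spans-criterion {D} {J} {x} meets isolates disjoint x∈D bJx =
    ⊆-antisym (∈⟪⟫⁺ (completes? J) ∘ completes) (incomplete ∘ ∈⟪⟫⁻ (completes? J)) , x , x∈D
    where
    meets-new : ∀ {z} → IsBasis (J ⊕ z) → z ∈ D
    meets-new {z} b =
      let w , w∈D , w∈ = meets b
      in subst (_∈ D) (decidable-stable (w ≟ z) λ w≢z → disjoint (∈-⊕⁻ J z w∈ w≢z) w∈D) w∈D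

    incomplete : ∀ {z} → Completes J z → z ∈ D
    incomplete (_ , b) = meets-new b

    x∉J : x ∉ J
    x∉J x∈J = disjoint x∈J x∈D

    completes : ∀ {z} → z ∈ D → Completes J z
    completes {z} z∈D = (λ z∈J → disjoint z∈J z∈D) , basis
      where
      basis : IsBasis (J ⊕ z)
      basis with x ≟ z
      ... | yes refl = bJx
      ... | no  x≢z with isolates z∈D
      ...   | B , bB , only with exch bJx bB (x∈S⊕x J x) (λ x∈B → x≢z (only x∈B x∈D))
      ...     | y , y∈B , _ , b with subst (λ t → IsBasis (t ⊕ y)) (⊕-⊖ x∉J) b
      ...       | b′ = subst (λ t → IsBasis (J ⊕ t)) (only y∈B (meets-new b′)) b′

  meets-isolates⇒cocircuit : ∀ {D} → Meets D → Isolates D → IsCocircuit D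
  meets-isolates⇒cocircuit {D} meets isolates
    with z , z∈D , _ ← meets (proj₂ nonempty)
    with B , bB , only ← isolates z∈D
    with w , w∈D , w∈B ← meets bB
    with refl ← only w∈B w∈D =
    -- The spanning set is a basis that meets `D` only in `z`, with `z` removed.
    B ⊖ z , spans-criterion meets isolates
      (λ v∈ v∈D → ∈-⊖-≢ B z v∈ (only (∈-⊖⁻ B z v∈) v∈D))
      z∈D (subst IsBasis (sym (⊖-⊕ w∈B)) bB)

  respan : ∀ {D J J₀ x} → Spans J₀ D → (∀ {w} → w ∈ J → w ∉ D) →
           x ∈ D → IsBasis (J ⊕ x) → Spans J D
  respan sp = spans-criterion (spans⇒meets sp) (spans⇒isolates sp)

  -- `𝓑` stands for the bases of the dual of `N`, tied to `N` only through complements: taking `N`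
  -- to be `M` or its dual covers both the cocircuits and the circuits of `M`.
  module _ {𝓑 : Pred (Subset n) 0ℓ}
           (𝓑⇒ : ∀ {B} → 𝓑 B → IsBasis (∁ B)) (⇒𝓑 : ∀ {B} → IsBasis B → 𝓑 (∁ B)) where

    minimalDependent⇒cocircuit : ∀ {D} → MinimalDependent 𝓑 D → IsCocircuit D
    minimalDependent⇒cocircuit {D} (dependent , minimal) = meets-isolates⇒cocircuit meets isolates
      where
      meets : Meets D
      meets {B} b with ⊆-dec D (∁ B)
      ... | inj₁ D⊆ = contradiction (∁ B , ⇒𝓑 b , λ {_} → D⊆) dependent
      ... | inj₂ (z , z∈D , z∉) = z , z∈D , x∉∁p⇒x∈p z∉

      isolates : Isolates D
      isolates {z} z∈D =
        let B , b , D-z⊆ = minimal {D ⊖ z} (∈-⊖⁻ D z , z , z∈D , x∉S⊖x D z)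
        in ∁ B , 𝓑⇒ b , λ {w} w∈ w∈D → decidable-stable (w ≟ z) λ w≢z →
             x∈∁p⇒x∉p w∈ (D-z⊆ (∈-⊖⁺ w∈D w≢z))

    cocircuit⇒minimalDependent : ∀ {D} → IsCocircuit D → MinimalDependent 𝓑 D
    cocircuit⇒minimalDependent {D} (J , sp) =
      (λ (B , b , D⊆B) → let z , z∈D , z∈ = spans⇒meets sp (𝓑⇒ b) in x∈∁p⇒x∉p z∈ (D⊆B z∈D)) ,
      λ {S} (S⊆D , x , x∈D , x∉S) →
        let B , b , only = spans⇒isolates sp x∈D
        in ∁ B , ⇒𝓑 b , λ {w} w∈S → x∉p⇒x∈∁p λ w∈B →
             x∉S (subst (_∈ S) (only w∈B (S⊆D w∈S)) w∈S)

  spans? : ∀ J D → Dec (Spans J D)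
  spans? J D = ≡-dec Bool._≟_ D (completion J) ×-dec nonempty? D

  -- A positive answer carries a spanning set; this is the choice from which signatures are read
  -- off, and it depends on the matroid alone.
  isCocircuit? : Decidable IsCocircuit
  isCocircuit? D = anySubset? (λ J → spans? J D)

-- Spanning sets adapted to a circuit and a cocircuit at once.

module Circuits {n : ℕ} (M : Matroid n) where
  private
    module N = Cocircuits M
    module N* = Cocircuits (dual M)

  -- This matches the weak conditions: ∣ I ─ J ∣ ≤ 3 as soon as ∣ C ∩ D ∣ ≤ 3.
  common-spanning : ∀ {I₀ J₀ C D w} → N*.Spans I₀ C → N.Spans J₀ D → w ∈ C → w ∈ D →
                    ∃₂ λ I J → N*.Spans (∁ I) C × N.Spans J D × I ─ J ⊆ C ∩ D
  common-spanning {I₀} {J₀} {C} {D} {w} spC spD w∈C w∈D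
    with w∉I₀ , b₁ ← N*.∈-spans⁻ spC w∈C
    with w∉J₀ , b₀ ← N.∈-spans⁻ spD w∈D
    with B₁ ← ∁ (I₀ ⊕ w) in B₁≡
    -- `B′` contains `C ─ D` and meets `D` in `w` only, so `B′ ⊖ w` spans `D` and already holds all
    -- of `C` off `D`.
    with B′ , b′ , C─D⊆B′ , B′⊆ ← N.augment {X = C ─ D} b₀ b₁ (λ {z} z∈ →
           subst (z ∈_) B₁≡ (x∉p⇒x∈∁p λ z∈I₀w →
             proj₁ (N*.∈-spans⁻ spC (p─q⊆p C D z∈))
               (∈-⊕⁻ I₀ w z∈I₀w λ { refl → x∈p─q⁻ C D z∈ w∈D })))
    with v , v∈D , v∈B′ ← N.spans⇒meets spD b′
    with refl ← decidable-stable (v ≟ w) (λ v≢w →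
           [ (λ v∈ → x∈p─q⁻ C D v∈ v∈D) ,
             (λ v∈ → proj₁ (N.∈-spans⁻ spD v∈D) (∈-⊕⁻ J₀ w v∈ v≢w)) ]′ (x∈p∪q⁻ (C ─ D) _ (B′⊆ v∈B′)))
    -- `B″` contains `C ⊖ w` and is otherwise part of `B′`: adding `w` encloses `C`, and beyond `C`
    -- there is nothing that `J` lacks.
    with B″ , b″ , C-w⊆B″ , B″⊆ ← N.augment {X = C ⊖ w} b′ b₁ (λ {z} z∈ →
           subst (z ∈_) B₁≡ (x∉p⇒x∈∁p λ z∈I₀w →
             proj₁ (N*.∈-spans⁻ spC (∈-⊖⁻ C w z∈)) (∈-⊕⁻ I₀ w z∈I₀w (∈-⊖-≢ C w z∈))))
    = I , J , spI , spJ , I─J⊆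
    where
    J = B′ ⊖ w
    I = B″ ⊕ w

    J∩D : ∀ {z} → z ∈ J → z ∉ D
    J∩D {z} z∈J z∈D =
      [ (λ z∈ → x∈p─q⁻ C D z∈ z∈D) ,
        (λ z∈ → proj₁ (N.∈-spans⁻ spD z∈D) (∈-⊕⁻ J₀ w z∈ (∈-⊖-≢ B′ w z∈J))) ]′
      (x∈p∪q⁻ (C ─ D) _ (B′⊆ (∈-⊖⁻ B′ w z∈J)))

    spJ : N.Spans J D
    spJ = N.respan spD J∩D w∈D (subst N.IsBasis (sym (⊖-⊕ v∈B′)) b′)

    C⊆I : C ⊆ I
    C⊆I {z} z∈C with z ≟ w
    ... | yes refl = x∈S⊕x B″ w
    ... | no  z≢w  = ∈-⊕⁺ w (C-w⊆B″ (∈-⊖⁺ z∈C z≢w))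

    w∉B″ : w ∉ B″
    w∉B″ w∈B″ =
      let z , z∈C , z∈ = N*.spans⇒meets spC (subst N.IsBasis (sym (∁-involutive B″)) b″)
      in x∈∁p⇒x∉p z∈ (subst (z ∈_) (⊕-absorb w∈B″) (C⊆I z∈C))

    spI : N*.Spans (∁ I) C
    spI = N*.respan spC (λ z∈ z∈C → x∈∁p⇒x∉p z∈ (C⊆I z∈C)) w∈C
      (subst N.IsBasis
        (sym (trans (∁-⊕ (∁ I) w) (trans (cong (_⊖ w) (∁-involutive I)) (⊕-⊖ w∉B″)))) b″)

    I─J⊆ : I ─ J ⊆ C ∩ D
    I─J⊆ {z} z∈ with z ≟ w
    ... | yes refl = x∈p∩q⁺ (w∈C , w∈D)
    ... | no  z≢w  = x∈p∩q⁺ (z∈C , z∈D)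
      where
      z∉J : z ∉ J
      z∉J = x∈p─q⁻ I J z∈
      z∈C : z ∈ C
      z∈C = [ ∈-⊖⁻ C w , (λ z∈B′ → contradiction (∈-⊖⁺ z∈B′ z≢w) z∉J) ]′
              (x∈p∪q⁻ (C ⊖ w) _ (B″⊆ (∈-⊕⁻ B″ w (p─q⊆p I J z∈) z≢w)))
      z∈D : z ∈ D
      z∈D = decidable-stable (z ∈? D) λ z∉D →
        z∉J (∈-⊖⁺ (C─D⊆B′ (x∈p∧x∉q⇒x∈p─q z∈C z∉D)) z≢w)

-- Nonzero values, proportional families and sums containing zero.

module Values (H : Hyperfield a) where
  open Hyperfield H public renaming (_⊙*_ to _∙_; _⁻¹ to infix 8 _⁻¹)

  private
    variable
      D E : Subset n
      f g h : Fin n → H*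
      x y z : Fin n

  ↑-injective : ∀ {p q : H*} → ↑ p ≡ ↑ q → p ≡ q
  ↑-injective {_ , _} {_ , _} refl = refl

  ∙-comm : ∀ p q → p ∙ q ≡ q ∙ p
  ∙-comm p q = ↑-injective (⊙-comm _ _)

  H*-group : Group a a
  H*-group = record { isGroup = ⊙*-isGroup }

  H*-commutativeMonoid : CommutativeMonoid a a
  H*-commutativeMonoid = record
    { isCommutativeMonoid = record { isMonoid = IsGroup.isMonoid ⊙*-isGroup ; comm = ∙-comm } }

  open CommutativeMonoid H*-commutativeMonoid public
    using () renaming (assoc to ∙-assoc; identityˡ to ∙-identityˡ; identityʳ to ∙-identityʳ)
  open GroupProperties H*-group public
    using (∙-cancelˡ; ∙-cancelʳ)
  open CommutativeMonoidSolver H*-commutativeMonoid public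
    using (solve; _⊜_) renaming (_⊕_ to _:∙_)

  -- Two equations are multiplied and a common factor `c` is cancelled. This eliminates intermediate
  -- values without writing quotients.
  combine : ∀ c {p q p′ q′ r t} → p ≡ q → p′ ≡ q′ →
            p ∙ p′ ≡ c ∙ r → q ∙ q′ ≡ c ∙ t → r ≡ t
  combine c refl refl e e′ = ∙-cancelˡ c _ _ (trans (sym e) e′)

  -1* : H*
  -1* = - 1# , λ -1≡0 → 0≢1 (sym (proj₁ (⊞-identityˡ 1#)
    (proj₁ (⊞-comm 1# 0#) (subst (λ t → 0# ∈ᴾ 1# ⊞ t) -1≡0 (-‿inverse 1#)))))

  -‿-1* : ∀ x → - x ≡ ↑ -1* ⊙ x
  -‿-1* x = trans (cong -_ (trans (sym (⊙-identityˡ x)) (⊙-comm 1# x)))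
    (trans (-‿⊙ x 1#) (⊙-comm x _))

  -1*-involutive : -1* ∙ -1* ≡ 1*
  -1*-involutive = ↑-injective (trans (sym (-‿-1* (- 1#)))
    (sym (-‿unique (proj₁ (⊞-comm 1# (- 1#)) (-‿inverse 1#)))))

  σ : Sign → H*
  σ Sign.+ = 1*
  σ Sign.- = -1*

  σ-* : ∀ p q → σ (p Sign.* q) ≡ σ p ∙ σ q
  σ-* Sign.+ q       = sym (∙-identityˡ (σ q))
  σ-* Sign.- Sign.+  = sym (∙-identityʳ -1*)
  σ-* Sign.- Sign.-  = sym -1*-involutive

  σ-square : ∀ p → σ p ∙ σ p ≡ 1*
  σ-square p = trans (sym (σ-* p p)) (cong σ (Sign.s*s≡+ p))

  σ-cancel : ∀ p q → σ p ∙ (σ p ∙ q) ≡ q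
  σ-cancel p q = trans (sym (∙-assoc (σ p) (σ p) q)) (trans (cong (_∙ q) (σ-square p)) (∙-identityˡ q))

  infix 4 _∝[_]_

  -- Cross products avoid the choice of a scalar and treat empty sets like all others; since all
  -- values are invertible the relation is still transitive.
  record _∝[_]_ (f : Fin n → H*) (D : Subset n) (g : Fin n → H*) : Set a where
    constructor proportional
    field
      cross : ∀ {x y} → x ∈ D → y ∈ D → f x ∙ g y ≡ f y ∙ g x

  open _∝[_]_ public

  ∝-sym : f ∝[ D ] g → g ∝[ D ] f
  ∝-sym {f = f} {g = g} f∝g = proportional λ {x} {y} x∈ y∈ →
    trans (∙-comm (g x) (f y)) (trans (sym (cross f∝g x∈ y∈)) (∙-comm (f x) (g y)))

  ∝-trans : f ∝[ D ] g → g ∝[ D ] h → f ∝[ D ] h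
  ∝-trans {f = f} {g = g} {h = h} f∝g g∝h = proportional λ {x} {y} x∈ y∈ →
    combine (g x ∙ g y) (cross f∝g x∈ y∈) (cross g∝h x∈ y∈)
      (solve 4 (λ fx gy gx hy → (fx :∙ gy) :∙ (gx :∙ hy) ⊜ (gx :∙ gy) :∙ (fx :∙ hy)) refl
        (f x) (g y) (g x) (h y))
      (solve 4 (λ fy gx gy hx → (fy :∙ gx) :∙ (gy :∙ hx) ⊜ (gx :∙ gy) :∙ (fy :∙ hx)) refl
        (f y) (g x) (g y) (h x))

  interchange : ∀ p q r t → (p ∙ q) ∙ (r ∙ t) ≡ (p ∙ r) ∙ (q ∙ t)
  interchange = solve 4 (λ p q r t → (p :∙ q) :∙ (r :∙ t) ⊜ (p :∙ r) :∙ (q :∙ t)) refl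

  ∝-∙ : ∀ {f′ g′ : Fin n → H*} → f ∝[ D ] g → f′ ∝[ D ] g′ →
        (λ z → f z ∙ f′ z) ∝[ D ] (λ z → g z ∙ g′ z)
  ∝-∙ {f = f} {g = g} {f′ = f′} {g′ = g′} p q = proportional λ {x} {y} x∈ y∈ →
    trans (interchange (f x) (f′ x) (g y) (g′ y))
      (trans (cong₂ _∙_ (cross p x∈ y∈) (cross q x∈ y∈)) (interchange (f y) (g x) (f′ y) (g′ x)))

  ∝-scaled : ∀ c → (∀ {z} → z ∈ D → f z ≡ c ∙ g z) → f ∝[ D ] g
  ∝-scaled {f = f} {g = g} c eq = proportional λ {x} {y} x∈ y∈ → trans (cong (_∙ g y) (eq x∈))
    (trans (solve 3 (λ c p q → (c :∙ p) :∙ q ⊜ (c :∙ q) :∙ p) refl c (g x) (g y))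
           (cong (_∙ g x) (sym (eq y∈))))

  ∝-refl : f ∝[ D ] f
  ∝-refl {f = f} = ∝-scaled 1* λ {z} _ → sym (∙-identityˡ (f z))

  ∝-⊆ : D ⊆ E → f ∝[ E ] g → f ∝[ D ] g
  ∝-⊆ D⊆E f∝g = proportional λ x∈ y∈ → cross f∝g (D⊆E x∈) (D⊆E y∈)

  ∝-cong : (∀ {z} → z ∈ D → f z ≡ g z) → f ∝[ D ] g
  ∝-cong {f = f} {g = g} eq = ∝-scaled 1* λ {z} z∈ → trans (eq z∈) (sym (∙-identityˡ (g z)))

  ∝⇒scaled : ∀ {x} → x ∈ D → f ∝[ D ] g → ∀ {z} → z ∈ D → g z ≡ (f x ⁻¹ ∙ g x) ∙ f z
  ∝⇒scaled {f = f} {g = g} {x = x} x∈ f∝g {z} z∈ = ∙-cancelˡ (f x) _ _ (begin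
    f x ∙ g z                        ≡⟨ cross f∝g x∈ z∈ ⟩
    f z ∙ g x                        ≡⟨ ∙-identityˡ _ ⟨
    1* ∙ (f z ∙ g x)                 ≡⟨ cong (_∙ (f z ∙ g x)) (⁻¹-inverseʳ (f x)) ⟨
    (f x ∙ f x ⁻¹) ∙ (f z ∙ g x)     ≡⟨ solve 4 (λ p p⁻¹ q r → (p :∙ p⁻¹) :∙ (q :∙ r) ⊜ p :∙ ((p⁻¹ :∙ r) :∙ q))
                                          refl (f x) (f x ⁻¹) (f z) (g x) ⟩
    f x ∙ ((f x ⁻¹ ∙ g x) ∙ f z)     ∎)
    where open ≡-Reasoning

  ⊞Σ-↭ : ∀ {xs ys z} → xs ↭ ys → z ∈ᴾ ⊞Σ xs → z ∈ᴾ ⊞Σ ys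
  ⊞Σ-↭ Perm.refl         z∈ = z∈
  ⊞Σ-↭ (Perm.prep x p)   (_ , w , refl , w∈ , z∈) = x , w , refl , ⊞Σ-↭ p w∈ , z∈
  ⊞Σ-↭ (Perm.swap x y p) (_ , w , refl , (_ , v , refl , v∈ , w∈) , z∈)
    with u , _ , u∈ , refl , z∈′ ← proj₂ (⊞-assoc x y v) (x , w , refl , w∈ , z∈)
    with _ , w′ , refl , w′∈ , z∈″ ←
           proj₁ (⊞-assoc y x v) (u , v , proj₁ (⊞-comm x y) u∈ , refl , z∈′)
    = y , w′ , refl , (x , v , refl , ⊞Σ-↭ p v∈ , w′∈) , z∈″
  ⊞Σ-↭ (Perm.trans p q)  z∈ = ⊞Σ-↭ q (⊞Σ-↭ p z∈)

  0⊞⁻ : ∀ {x z} → z ∈ᴾ 0# ⊞ x → z ≡ x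
  0⊞⁻ z∈ = sym (proj₁ (⊞-identityˡ _) z∈)

  0⊞⁺ : ∀ x → x ∈ᴾ 0# ⊞ x
  0⊞⁺ x = proj₂ (⊞-identityˡ x) refl

  ⊞Σ-zeros : ∀ {xs} → Allᴸ (_≡ 0#) xs → ⊞Σ xs ≐ ⊞Σ []
  ⊞Σ-zeros []             = (λ z → z) , (λ z → z)
  ⊞Σ-zeros (refl ∷ zeros) =
    (λ { (_ , w , refl , w∈ , z∈) → trans (proj₁ (⊞Σ-zeros zeros) w∈) (sym (0⊞⁻ z∈)) }) ,
    λ { refl → 0# , 0# , refl , proj₂ (⊞Σ-zeros zeros) refl , 0⊞⁺ 0# }

  -- Hypersums may be permuted, so each element of `zs` in turn is moved to the front of `ws`; what
  -- then remains of `ws` consists of zeros.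
  ⊞Σ-support : ∀ {I : Set} (F : I → Carrier) {zs ws} → Uniqueᴸ zs → Uniqueᴸ ws →
               (∀ {z} → z ∈ᴸ zs → z ∈ᴸ ws) → (∀ {w} → w ∈ᴸ ws → w ∉ᴸ zs → F w ≡ 0#) →
               ⊞Σ (List.map F ws) ≐ ⊞Σ (List.map F zs)
  ⊞Σ-support F {[]} {ws} [] ws! zs⊆ws off =
    ⊞Σ-zeros (Allᴸ.map⁺ (Allᴸ.tabulate λ w∈ → off w∈ λ ()))
  ⊞Σ-support {I} F {z ∷ zs} {ws} (z∉ ∷ zs!) ws! zs⊆ws off
    with h , t , refl ← ∈-∃++ (zs⊆ws (here refl))
    with ws↭ ← Perm.shift z h t
    with z∉′ ∷ ht! ← PermSetoid.Unique-resp-↭ (setoid I) (↭⇒↭ₛ ws↭) ws!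
    with ih ← ⊞Σ-support F {zs} {h List.++ t} zs! ht!
           (λ {y} y∈ → case Perm.∈-resp-↭ ws↭ (zs⊆ws (there y∈)) of λ where
              (here refl) → contradiction refl (Allᴸ.lookup z∉ y∈)
              (there y∈′) → y∈′)
           (λ {w} w∈ w∉ → off (Perm.∈-resp-↭ (↭-sym ws↭) (there w∈)) λ where
              (here refl) → Allᴸ.lookup z∉′ w∈ refl
              (there w∈′) → w∉ w∈′)
    = (λ p → extend {xs = List.map F (h List.++ t)} {List.map F zs} (proj₁ ih) (⊞Σ-↭ (Perm.map⁺ F ws↭) p)) ,
      (λ p → ⊞Σ-↭ (Perm.map⁺ F (↭-sym ws↭)) (extend {xs = List.map F zs} {List.map F (h List.++ t)} (proj₂ ih) p))
    where
    extend : ∀ {x xs ys p} → (∀ {w} → w ∈ᴾ ⊞Σ xs → w ∈ᴾ ⊞Σ ys) →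
             p ∈ᴾ ⊞Σ (x ∷ xs) → p ∈ᴾ ⊞Σ (x ∷ ys)
    extend sub (x , w , refl , w∈ , p∈) = x , w , refl , sub w∈ , p∈

  restrict : Subset n → (Fin n → H*) → Fin n → Carrier
  restrict S f z = if does (z ∈? S) then ↑ f z else 0#

  restrict-∈ : ∀ {S : Subset n} → z ∈ S → restrict S f z ≡ ↑ f z
  restrict-∈ {z = z} {S = S} z∈ rewrite dec-true (z ∈? S) z∈ = refl

  restrict-∉ : ∀ {S : Subset n} → z ∉ S → restrict S f z ≡ 0#
  restrict-∉ {z = z} {S = S} z∉ rewrite dec-false (z ∈? S) z∉ = refl

  -- Summing over the whole ground set in one fixed order makes sums over different sets comparable;
  -- `zeroSum⁺` and `zeroSum⁻` pass to any other duplicate-free list covering `S`.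
  ZeroSum : Subset n → (Fin n → H*) → Set a
  ZeroSum S f = 0# ∈ᴾ ⊞Σ (List.map (restrict S f) (allFin _))

  module _ {S : Subset n} {f : Fin n → H*} {zs : List (Fin n)} (zs! : Uniqueᴸ zs)
           (S⊆zs : ∀ {z} → z ∈ S → z ∈ᴸ zs) where

    private
      supported : ⊞Σ (List.map (restrict S f) (allFin n)) ≐ ⊞Σ (List.map (restrict S f) zs)
      supported = ⊞Σ-support (restrict S f) zs! (Uniqueᴸ.allFin⁺ n) (λ _ → ∈-allFin _)
        λ _ w∉ → restrict-∉ {f = f} (w∉ ∘ S⊆zs)

    zeroSum⁺ : 0# ∈ᴾ ⊞Σ (List.map (restrict S f) zs) → ZeroSum S f
    zeroSum⁺ = proj₂ supported

    zeroSum⁻ : ZeroSum S f → 0# ∈ᴾ ⊞Σ (List.map (restrict S f) zs)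
    zeroSum⁻ = proj₁ supported

  zeroSum-empty : ∀ {S : Subset n} → (∀ {z} → z ∉ S) → ZeroSum S f
  zeroSum-empty {f = f} {S = S} ∅ = zeroSum⁺ {S = S} {f} {zs = []} [] (λ z∈ → contradiction z∈ ∅) refl

  zeroSum-scale : ∀ {S : Subset n} c → (∀ {z} → z ∈ S → g z ≡ c ∙ f z) → ZeroSum S f → ZeroSum S g
  zeroSum-scale {n = n} {g = g} {f = f} {S = S} c eq sum =
    subst (λ ts → 0# ∈ᴾ ⊞Σ ts)
      (trans (sym (List.map-∘ {g = ↑ c ⊙_} {f = restrict S f} (allFin n)))
             (List.map-cong pointwise (allFin n)))
      (0∈⊞Σ-scale (↑ c) (List.map (restrict S f) (allFin n)) sum)
    where
    pointwise : ∀ z → ↑ c ⊙ restrict S f z ≡ restrict S g z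
    pointwise z with z ∈? S
    ... | yes z∈ = sym (cong ↑_ (eq z∈))
    ... | no  z∉ = zeroʳ (↑ c)

  zeroSum-∝ : ∀ {S : Subset n} → f ∝[ S ] g → ZeroSum S f → ZeroSum S g
  zeroSum-∝ {f = f} {g = g} {S = S} f∝g sum with nonempty? S
  ... | yes (x , x∈) = zeroSum-scale {g = g} {f} (f x ⁻¹ ∙ g x) (∝⇒scaled x∈ f∝g) sum
  ... | no  ∅        = zeroSum-empty {f = g} λ z∈ → ∅ (_ , z∈)

  -- With two terms left, uniqueness of negatives turns membership of zero into an equation. This is
  -- the only way in which equations are extracted from sums.
  zeroSum-pair : ∀ {S : Subset n} → x ∈ S → y ∈ S → x ≢ y →
                 (∀ {z} → z ∈ S → z ≢ x → z ≡ y) → ZeroSum S f → f x ≡ -1* ∙ f y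
  zeroSum-pair {x = x} {y = y} {f = f} {S = S} x∈ y∈ x≢y only sum
    with _ , w , refl , (_ , _ , refl , refl , w∈) , 0∈ ←
      zeroSum⁻ {S = S} {f} {x ∷ y ∷ []} ((x≢y ∷ []) ∷ [] ∷ [])
        (λ {z} z∈ → case z ≟ x of λ where
          (yes refl) → here refl
          (no z≢x)   → there (here (only z∈ z≢x))) sum
    with refl ← 0⊞⁻ (proj₁ (⊞-comm _ 0#) w∈)
    = ↑-injective (begin
        ↑ f x            ≡⟨ restrict-∈ {f = f} {S = S} x∈ ⟨
        restrict S f x   ≡⟨ -‿unique (proj₁ (⊞-comm (restrict S f x) (restrict S f y)) 0∈) ⟩
        - restrict S f y ≡⟨ cong -_ (restrict-∈ {f = f} {S = S} y∈) ⟩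
        - (↑ f y)        ≡⟨ -‿-1* (↑ f y) ⟩
        ↑ (-1* ∙ f y)    ∎)
    where open ≡-Reasoning

-- A function on the bases with prescribed ratios on adjacent bases.

module Potential (H : Hyperfield a) {n : ℕ} (N : Matroid n) where
  open Values H
  open Bases N

  B₀ : Subset n
  B₀ = proj₁ nonempty

  private
    basis₀ : IsBasis B₀
    basis₀ = proj₂ nonempty

  dist : Subset n → ℕ
  dist B = ∣ B ─ B₀ ∣

  dist-∉ : ∀ S {x} → x ∉ S → x ∉ B₀ → dist (S ⊕ x) ≡ suc (dist S)
  dist-∉ S {x} x∉S x∉B₀ = trans (cong ∣_∣ (⊆-antisym to from)) (∣⊕∣ (S ─ B₀) (x∉S ∘ p─q⊆p S B₀))
    where
    to : S ⊕ x ─ B₀ ⊆ (S ─ B₀) ⊕ x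
    to {z} z∈ with z ≟ x
    ... | yes refl = x∈S⊕x (S ─ B₀) x
    ... | no  z≢x  = ∈-⊕⁺ x (x∈p∧x∉q⇒x∈p─q (∈-⊕⁻ S x (p─q⊆p _ B₀ z∈) z≢x) (x∈p─q⁻ _ B₀ z∈))
    from : (S ─ B₀) ⊕ x ⊆ S ⊕ x ─ B₀
    from {z} z∈ with z ≟ x
    ... | yes refl = x∈p∧x∉q⇒x∈p─q (x∈S⊕x S x) x∉B₀
    ... | no  z≢x  = let z∈′ = ∈-⊕⁻ (S ─ B₀) x z∈ z≢x
                     in x∈p∧x∉q⇒x∈p─q (∈-⊕⁺ x (p─q⊆p S B₀ z∈′)) (x∈p─q⁻ S B₀ z∈′)

  dist-∈ : ∀ S {x} → x ∈ B₀ → dist (S ⊕ x) ≡ dist S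
  dist-∈ S {x} x∈B₀ = cong ∣_∣ (⊆-antisym
    (λ z∈ → let z∉B₀ = x∈p─q⁻ _ B₀ z∈
            in x∈p∧x∉q⇒x∈p─q (∈-⊕⁻ S x (p─q⊆p _ B₀ z∈) (∈∧∉⇒≢ x∈B₀ z∉B₀ ∘ sym)) z∉B₀)
    (λ z∈ → x∈p∧x∉q⇒x∈p─q (∈-⊕⁺ x (p─q⊆p S B₀ z∈)) (x∈p─q⁻ S B₀ z∈)))

  Descends : Subset n → Fin n → Fin n → Set
  Descends B x b = x ∈ B × x ∉ B₀ × b ∈ B₀ × b ∉ B × IsBasis (B ⊖ x ⊕ b)

  Descent : Subset n → Set
  Descent B = ∃₂ (Descends B)

  descent? : ∀ B → Dec (Descent B)
  descent? B = any? λ x → any? λ b →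
    (x ∈? B) ×-dec ¬? (x ∈? B₀) ×-dec (b ∈? B₀) ×-dec ¬? (b ∈? B) ×-dec isBasis? (B ⊖ x ⊕ b)

  dist-descent : ∀ {B x b} → Descends B x b → dist B ≡ suc (dist (B ⊖ x ⊕ b))
  dist-descent {B} {x} {b} (x∈B , x∉B₀ , b∈B₀ , b∉B , _) = begin
    dist B                  ≡⟨ cong dist (⊖-⊕ x∈B) ⟨
    dist (B ⊖ x ⊕ x)        ≡⟨ dist-∉ (B ⊖ x) (x∉S⊖x B x) x∉B₀ ⟩
    suc (dist (B ⊖ x))      ≡⟨ cong suc (dist-∈ (B ⊖ x) b∈B₀) ⟨
    suc (dist (B ⊖ x ⊕ b))  ∎
    where open ≡-Reasoning

  module _ (g : Subset n → Fin n → H*) where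

    descend : (Subset n → H*) → ∀ B → Dec (Descent B) → H*
    descend Ψ B (yes (x , b , _)) = g (B ⊖ x) x ∙ g (B ⊖ x) b ⁻¹ ∙ Ψ (B ⊖ x ⊕ b)
    descend Ψ B (no _)            = 1*

    -- The recursion runs on fuel that starts at `dist B`. A descent lowers the distance by exactly
    -- one, so the fuel always equals the distance of the current basis.
    potential′ : ℕ → Subset n → H*
    potential′ zero    B = 1*
    potential′ (suc k) B = descend (potential′ k) B (descent? B)

    potential : Subset n → H*
    potential B = potential′ (dist B) B

  Edge : (Subset n → Fin n → H*) → (Subset n → H*) → Subset n → Fin n → Fin n → Set a
  Edge g Φ S x y = g S x ∙ Φ (S ⊕ y) ≡ g S y ∙ Φ (S ⊕ x)

  -- Adjacent bases `S ⊕ x` and `S ⊕ y` are also `I ⊖ y` and `I ⊖ x` for `I = S ⊕ x ⊕ y`. `circuit`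
  -- makes `g` and `g*` prescribe the same ratio for them. `square` says that the ratios around a
  -- 4-cycle multiply to 1 when the two sets that could be adjacent to all four corners are not
  -- bases. In a triangle the bases share a set `S` or lie in a common `I`, so a single function
  -- gives all three ratios.
  record Coherent (g g* : Subset n → Fin n → H*) : Set a where
    field
      circuit : ∀ {I x y} → x ∈ I → y ∈ I → x ≢ y → IsBasis (I ⊖ x) → IsBasis (I ⊖ y) →
                g (I ⊖ x ⊖ y) x ∙ g* (∁ I) x ≡ g (I ⊖ x ⊖ y) y ∙ g* (∁ I) y
      square  : ∀ {T u v x y} → u ∉ T → v ∉ T → x ∉ T → y ∉ T → u ≢ v → x ≢ y →
                u ≢ x → u ≢ y → v ≢ x → v ≢ y →
                IsBasis (T ⊕ u ⊕ x) → IsBasis (T ⊕ u ⊕ y) →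
                IsBasis (T ⊕ v ⊕ x) → IsBasis (T ⊕ v ⊕ y) →
                ¬ IsBasis (T ⊕ u ⊕ v) → ¬ IsBasis (T ⊕ x ⊕ y) →
                (g (T ⊕ u) x ∙ g (T ⊕ y) u) ∙ (g (T ⊕ v) y ∙ g (T ⊕ x) v) ≡
                (g (T ⊕ u) y ∙ g (T ⊕ y) v) ∙ (g (T ⊕ v) x ∙ g (T ⊕ x) u)

  module _ {g g* : Subset n → Fin n → H*} (coherent : Coherent g g*) where
    open Coherent coherent

    private
      Φ : Subset n → H*
      Φ = potential g

      E : Subset n → Fin n → Fin n → Set a
      E = Edge g Φ

      E* : Subset n → Fin n → Fin n → Set a
      E* I x y = g* (∁ I) x ∙ Φ (I ⊖ y) ≡ g* (∁ I) y ∙ Φ (I ⊖ x)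

      chain : ∀ (f h : Fin n → H*) {x y z} → f x ∙ h y ≡ f y ∙ h x → f y ∙ h z ≡ f z ∙ h y →
              f x ∙ h z ≡ f z ∙ h x
      chain f h {x} {y} {z} p q = combine (f y ∙ h y) p q
        (solve 4 (λ fx hy fy hz → (fx :∙ hy) :∙ (fy :∙ hz) ⊜ (fy :∙ hy) :∙ (fx :∙ hz)) refl
          (f x) (h y) (f y) (h z))
        (solve 4 (λ fy hx fz hy → (fy :∙ hx) :∙ (fz :∙ hy) ⊜ (fy :∙ hy) :∙ (fz :∙ hx)) refl
          (f y) (h x) (f z) (h y))

      E-trans : ∀ {S x y z} → E S x y → E S y z → E S x z
      E-trans {S} = chain (g S) (λ z → Φ (S ⊕ z))

      E*-trans : ∀ {I x y z} → E* I x y → E* I y z → E* I x z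
      E*-trans {I} = chain (g* (∁ I)) (λ z → Φ (I ⊖ z))

      switch : ∀ p q p′ q′ s t → p ∙ p′ ≡ q ∙ q′ → p ∙ s ≡ q ∙ t → p′ ∙ t ≡ q′ ∙ s
      switch p q p′ q′ s t e₁ e₂ = combine (p ∙ q) e₁ (sym e₂)
        (solve 4 (λ p p′ q t → (p :∙ p′) :∙ (q :∙ t) ⊜ (p :∙ q) :∙ (p′ :∙ t)) refl p p′ q t)
        (solve 4 (λ p q′ q s → (q :∙ q′) :∙ (p :∙ s) ⊜ (p :∙ q) :∙ (q′ :∙ s)) refl p q′ q s)

      module _ {I x y} (x∈I : x ∈ I) (y∈I : y ∈ I) (x≢y : x ≢ y)
               (bx : IsBasis (I ⊖ x)) (by : IsBasis (I ⊖ y)) where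

        S⊕x≡ : I ⊖ x ⊖ y ⊕ x ≡ I ⊖ y
        S⊕x≡ = trans (sym (⊕⊖-comm (I ⊖ x) x≢y)) (cong (_⊖ y) (⊖-⊕ x∈I))

        S⊕y≡ : I ⊖ x ⊖ y ⊕ y ≡ I ⊖ x
        S⊕y≡ = ⊖-⊕ (∈-⊖⁺ y∈I (x≢y ∘ sym))

        raise : E (I ⊖ x ⊖ y) x y → E* I x y
        raise e = subst₂ (λ A B → g* (∁ I) x ∙ Φ A ≡ g* (∁ I) y ∙ Φ B) S⊕x≡ S⊕y≡
          (switch (g (I ⊖ x ⊖ y) x) (g (I ⊖ x ⊖ y) y) (g* (∁ I) x) (g* (∁ I) y)
            (Φ (I ⊖ x ⊖ y ⊕ y)) (Φ (I ⊖ x ⊖ y ⊕ x)) (circuit x∈I y∈I x≢y bx by) e)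

        lower : E* I x y → E (I ⊖ x ⊖ y) x y
        lower e = switch (g* (∁ I) x) (g* (∁ I) y) (g (I ⊖ x ⊖ y) x) (g (I ⊖ x ⊖ y) y)
          (Φ (I ⊖ x ⊖ y ⊕ x)) (Φ (I ⊖ x ⊖ y ⊕ y))
          (trans (∙-comm (g* (∁ I) x) (g (I ⊖ x ⊖ y) x))
            (trans (circuit x∈I y∈I x≢y bx by) (∙-comm (g (I ⊖ x ⊖ y) y) (g* (∁ I) y))))
          (subst₂ (λ A B → g* (∁ I) x ∙ Φ A ≡ g* (∁ I) y ∙ Φ B) (sym S⊕x≡) (sym S⊕y≡) e)

      Claim : ℕ → Set a
      Claim k = ∀ {S x y} → Completes S x → Completes S y →
                dist (S ⊕ x) < k → dist (S ⊕ y) < k → E S x y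

      -- The one edge at `B` that holds by construction; every other descent of `B` is compared with
      -- it.
      chosen : ∀ {B} → Descent B → ∃₂ λ x b → Descends B x b × E (B ⊖ x) x b
      chosen {B} p with descent? B in eq
      ... | no ¬p = contradiction p ¬p
      ... | yes (x , b , d) = x , b , d , sym (begin
        g (B ⊖ x) b ∙ Φ (B ⊖ x ⊕ x)    ≡⟨ cong (λ t → g (B ⊖ x) b ∙ Φ t) (⊖-⊕ (proj₁ d)) ⟩
        g (B ⊖ x) b ∙ Φ B              ≡⟨ cong (g (B ⊖ x) b ∙_) unfold ⟩
        g (B ⊖ x) b ∙ (g (B ⊖ x) x ∙ g (B ⊖ x) b ⁻¹ ∙ Φ (B ⊖ x ⊕ b))
          ≡⟨ solve 4 (λ p q q⁻¹ r → q :∙ ((p :∙ q⁻¹) :∙ r) ⊜ (q :∙ q⁻¹) :∙ (p :∙ r)) refl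
               (g (B ⊖ x) x) (g (B ⊖ x) b) (g (B ⊖ x) b ⁻¹) (Φ (B ⊖ x ⊕ b)) ⟩
        (g (B ⊖ x) b ∙ g (B ⊖ x) b ⁻¹) ∙ (g (B ⊖ x) x ∙ Φ (B ⊖ x ⊕ b))
          ≡⟨ cong (_∙ (g (B ⊖ x) x ∙ Φ (B ⊖ x ⊕ b))) (⁻¹-inverseʳ (g (B ⊖ x) b)) ⟩
        1* ∙ (g (B ⊖ x) x ∙ Φ (B ⊖ x ⊕ b))  ≡⟨ ∙-identityˡ _ ⟩
        g (B ⊖ x) x ∙ Φ (B ⊖ x ⊕ b)    ∎)
        where
        open ≡-Reasoning
        unfold : Φ B ≡ g (B ⊖ x) x ∙ g (B ⊖ x) b ⁻¹ ∙ Φ (B ⊖ x ⊕ b)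
        unfold = trans (cong (λ k → potential′ g k B) (dist-descent d))
                       (cong (descend g (potential′ g (dist (B ⊖ x ⊕ b))) B) eq)

      module _ {k B} (claim : Claim k) (bB : IsBasis B) (dist≡k : dist B ≡ k) where

        closer : ∀ {x b} → Descends B x b → dist (B ⊖ x ⊕ b) < k
        closer d = ℕ.≤-reflexive (trans (sym (dist-descent d)) dist≡k)

        -- Two descents that remove the same `x` form a triangle with `B` over `B ⊖ x`; its third
        -- side joins two bases closer to `B₀`, where the claim is known.
        move-in : ∀ {x b b′} → Descends B x b → Descends B x b′ → E (B ⊖ x) x b → E (B ⊖ x) x b′
        move-in d@(_ , _ , _ , b∉ , b₁) d′@(_ , _ , _ , b′∉ , b₂) e =
          E-trans e (claim (b∉ ∘ ∈-⊖⁻ B _ , b₁) (b′∉ ∘ ∈-⊖⁻ B _ , b₂) (closer d) (closer d′))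

        -- Two descents that bring in the same `b` lie in `B ⊕ b`, so this triangle is closed with
        -- `g*`; `raise` and `lower` carry its sides there and back.
        move-out : ∀ {x x′ b} → x ≢ x′ → Descends B x b → Descends B x′ b →
                   E (B ⊖ x) x b → E (B ⊖ x′) x′ b
        move-out {x} {x′} {b} x≢x′ d@(x∈ , x∉B₀ , b∈B₀ , b∉ , b₁) d′@(x′∈ , x′∉B₀ , _ , _ , b₂) e =
          subst (λ S → E S x′ b) (back x′ (≢b x′∈)) (lower x′∈I b∈I (≢b x′∈) b₂′ b₃
            (E*-trans (raise x′∈I x∈I (x≢x′ ∘ sym) b₂′ b₁′ middle)
                      (raise x∈I b∈I (≢b x∈) b₁′ b₃ (subst (λ S → E S x b) (sym (back x (≢b x∈))) e))))
          where
          I : Subset n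
          I = B ⊕ b
          ≢b : ∀ {z} → z ∈ B → z ≢ b
          ≢b z∈ = ∈∧∉⇒≢ z∈ b∉
          x∈I : x ∈ I
          x∈I = ∈-⊕⁺ b x∈
          x′∈I : x′ ∈ I
          x′∈I = ∈-⊕⁺ b x′∈
          b∈I : b ∈ I
          b∈I = x∈S⊕x B b
          swapped : ∀ z → z ≢ b → B ⊕ b ⊖ z ≡ B ⊖ z ⊕ b
          swapped z z≢b = ⊕⊖-comm B (z≢b ∘ sym)
          back : ∀ z → z ≢ b → I ⊖ z ⊖ b ≡ B ⊖ z
          back z z≢b = trans (cong (_⊖ b) (swapped z z≢b)) (⊕-⊖ (b∉ ∘ ∈-⊖⁻ B z))
          b₁′ : IsBasis (I ⊖ x)
          b₁′ = subst IsBasis (sym (swapped x (≢b x∈))) b₁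
          b₂′ : IsBasis (I ⊖ x′)
          b₂′ = subst IsBasis (sym (swapped x′ (≢b x′∈))) b₂
          b₃ : IsBasis (I ⊖ b)
          b₃ = subst IsBasis (sym (⊕-⊖ b∉)) bB
          e₁ : I ⊖ x′ ⊖ x ⊕ x′ ≡ B ⊖ x ⊕ b
          e₁ = trans (S⊕x≡ x′∈I x∈I (x≢x′ ∘ sym) b₂′ b₁′) (swapped x (≢b x∈))
          e₂ : I ⊖ x′ ⊖ x ⊕ x ≡ B ⊖ x′ ⊕ b
          e₂ = trans (S⊕y≡ x′∈I x∈I (x≢x′ ∘ sym) b₂′ b₁′) (swapped x′ (≢b x′∈))
          middle : E (I ⊖ x′ ⊖ x) x′ x
          middle = claim (x∉S⊖x I x′ ∘ ∈-⊖⁻ (I ⊖ x′) x , subst IsBasis (sym e₁) b₁)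
                         (x∉S⊖x (I ⊖ x′) x , subst IsBasis (sym e₂) b₂)
                         (subst (λ S → dist S < k) (sym e₁) (closer d))
                         (subst (λ S → dist S < k) (sym e₂) (closer d′))

      -- Three edges of a 4-cycle with values `p`, `q`, `r`, `t` at its corners, together with the
      -- square condition, give the fourth edge.
      product₃ : ∀ a₁ a₂ a₃ a₄ b₁ b₂ b₃ b₄ p q r t →
                 (a₁ ∙ a₂) ∙ (a₃ ∙ a₄) ≡ (b₁ ∙ b₂) ∙ (b₃ ∙ b₄) →
                 a₁ ∙ q ≡ b₁ ∙ p → a₂ ∙ r ≡ b₂ ∙ q → a₃ ∙ t ≡ b₃ ∙ r → b₄ ∙ t ≡ a₄ ∙ p
      product₃ a₁ a₂ a₃ a₄ b₁ b₂ b₃ b₄ p q r t sq e₁ e₂ e₃ =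
        combine ((a₁ ∙ a₂ ∙ a₃) ∙ ((b₁ ∙ b₂ ∙ b₃) ∙ (q ∙ r))) (cong₂ _∙_ (cong₂ _∙_ e₁ e₂) e₃) (sym sq)
          (solve 10 (λ a₁ a₂ a₃ b₁ b₂ b₃ b₄ q r t →
             (((a₁ :∙ q) :∙ (a₂ :∙ r)) :∙ (a₃ :∙ t)) :∙ ((b₁ :∙ b₂) :∙ (b₃ :∙ b₄)) ⊜
             (((a₁ :∙ a₂) :∙ a₃) :∙ (((b₁ :∙ b₂) :∙ b₃) :∙ (q :∙ r))) :∙ (b₄ :∙ t)) refl
             a₁ a₂ a₃ b₁ b₂ b₃ b₄ q r t)
          (solve 10 (λ a₁ a₂ a₃ a₄ b₁ b₂ b₃ p q r →
             (((b₁ :∙ p) :∙ (b₂ :∙ q)) :∙ (b₃ :∙ r)) :∙ ((a₁ :∙ a₂) :∙ (a₃ :∙ a₄)) ⊜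
             (((a₁ :∙ a₂) :∙ a₃) :∙ (((b₁ :∙ b₂) :∙ b₃) :∙ (q :∙ r))) :∙ (a₄ :∙ p)) refl
             a₁ a₂ a₃ a₄ b₁ b₂ b₃ p q r)

      -- The fourth basis T ⊕ v ⊕ y of the square is closer to B₀ than the others.
      fill-square : ∀ {k T u v x y} → Claim k →
        u ∉ T → v ∉ T → x ∉ T → y ∉ T → u ≢ v → x ≢ y → u ≢ y → v ≢ x → u ≢ x →
        u ∉ B₀ → x ∉ B₀ → v ∈ B₀ → y ∈ B₀ → dist (T ⊕ u ⊕ x) ≡ k →
        IsBasis (T ⊕ u ⊕ x) → IsBasis (T ⊕ u ⊕ y) → IsBasis (T ⊕ v ⊕ x) →
        ¬ IsBasis (T ⊕ u ⊕ v) → ¬ IsBasis (T ⊕ x ⊕ y) →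
        E (T ⊕ u) x y → E (T ⊕ x) u v
      fill-square {k} {T} {u} {v} {x} {y} claim u∉ v∉ x∉ y∉ u≢v x≢y u≢y v≢x u≢x
                  u∉B₀ x∉B₀ v∈B₀ y∈B₀ dist≡k ux uy vx ¬uv ¬xy e = goal
        where
        v≢y : v ≢ y
        v≢y refl = ¬uv uy
        vy : IsBasis (T ⊕ v ⊕ y)
        -- Exchanging `x` in `T ⊕ v ⊕ x` against `T ⊕ u ⊕ y` must bring in `y`, since `u` would give
        -- the nonbasis `T ⊕ u ⊕ v`.
        vy with exch vx uy (x∈S⊕x (T ⊕ v) x) (∉-⊕ (∉-⊕ x∉ (u≢x ∘ sym)) x≢y)
        ... | w , w∈ , w∉ , b with w ≟ y
        ...   | yes refl = subst (λ t → IsBasis (t ⊕ w)) (⊕-⊖ (∉-⊕ x∉ (v≢x ∘ sym))) b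
        ...   | no  w≢y  with w ≟ u
        ...     | yes refl = contradiction (subst IsBasis
                    (trans (cong (_⊕ w) (⊕-⊖ (∉-⊕ x∉ (v≢x ∘ sym)))) (⊕-comm T v w)) b) ¬uv
        ...     | no  w≢u  = contradiction
                    (∈-⊕⁺ x (∈-⊕⁺ v (∈-⊕⁻ T u (∈-⊕⁻ (T ⊕ u) y w∈ w≢y) w≢u))) w∉

        1+dist : suc (dist (T ⊕ x)) ≡ k
        1+dist = trans (cong suc (trans (dist-∉ T x∉ x∉B₀) (sym (dist-∉ T u∉ u∉B₀))))
          (trans (sym (dist-∉ (T ⊕ u) (∉-⊕ x∉ (u≢x ∘ sym)) x∉B₀)) dist≡k)
        xk : dist (T ⊕ x) < k
        xk = ℕ.≤-reflexive 1+dist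
        uk : dist (T ⊕ u) < k
        uk = subst (_< k) (trans (dist-∉ T x∉ x∉B₀) (sym (dist-∉ T u∉ u∉B₀))) xk
        Tk : dist T < k
        Tk = ℕ.<-trans (ℕ.≤-reflexive (sym (dist-∉ T u∉ u∉B₀))) uk
        ∈-dist : ∀ S {z} → z ∈ B₀ → dist S < k → dist (S ⊕ z) < k
        ∈-dist S z∈ = subst (_< k) (sym (dist-∈ S z∈))

        yu : IsBasis (T ⊕ y ⊕ u)
        yu = subst IsBasis (⊕-comm T u y) uy
        yv : IsBasis (T ⊕ y ⊕ v)
        yv = subst IsBasis (⊕-comm T v y) vy
        e₂ : E (T ⊕ y) u v
        e₂ = claim (∉-⊕ u∉ u≢y , yu) (∉-⊕ v∉ v≢y , yv)
               (subst (λ S → dist S < k) (⊕-comm T u y) (∈-dist (T ⊕ u) y∈B₀ uk))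
               (∈-dist (T ⊕ y) v∈B₀ (∈-dist T y∈B₀ Tk))
        e₃ : E (T ⊕ v) y x
        e₃ = claim (∉-⊕ y∉ (v≢y ∘ sym) , vy) (∉-⊕ x∉ (v≢x ∘ sym) , vx)
               (∈-dist (T ⊕ v) y∈B₀ (∈-dist T v∈B₀ Tk))
               (subst (λ S → dist S < k) (⊕-comm T x v) (∈-dist (T ⊕ x) v∈B₀ xk))

        goal : E (T ⊕ x) u v
        goal rewrite ⊕-comm T x v | ⊕-comm T x u =
          product₃
            (g (T ⊕ u) x) (g (T ⊕ y) u) (g (T ⊕ v) y) (g (T ⊕ x) v)
            (g (T ⊕ u) y) (g (T ⊕ y) v) (g (T ⊕ v) x) (g (T ⊕ x) u)
            (Φ (T ⊕ u ⊕ x)) (Φ (T ⊕ u ⊕ y)) (Φ (T ⊕ v ⊕ y)) (Φ (T ⊕ v ⊕ x))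
            (square u∉ v∉ x∉ y∉ u≢v x≢y u≢x u≢y v≢x v≢y ux uy vx vy ¬uv ¬xy)
            e
            (subst₂ (λ A B → g (T ⊕ y) u ∙ Φ A ≡ g (T ⊕ y) v ∙ Φ B) (⊕-comm T y v) (⊕-comm T y u) e₂)
            e₃

      -- From the chosen descent `(x₀ , b₀)` one passes to `(x , b)` by changing one entry at a
      -- time, through whichever of the two mixed pairs yields a basis. If neither does, the two
      -- failures are precisely the two nonbases that a square requires.
      downward : ∀ {k B} → Claim k → IsBasis B → dist B ≡ k →
                 ∀ {x b} → Descends B x b → E (B ⊖ x) x b
      downward {k} {B} claim bB dist≡k {x} {b} d@(x∈ , x∉B₀ , b∈B₀ , b∉ , b₁)
        with x₀ , b₀ , d₀@(x₀∈ , x₀∉B₀ , b₀∈B₀ , b₀∉ , b₂) , e ← chosen (x , b , d)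
        with x₀ ≟ x
      ... | yes refl = move-in claim bB dist≡k d₀ d e
      ... | no  x₀≢x with b₀ ≟ b
      ...   | yes refl = move-out claim bB dist≡k x₀≢x d₀ d e
      ...   | no  b₀≢b with isBasis? (B ⊖ x₀ ⊕ b)
      ...     | yes b₃ = let d′ = x₀∈ , x₀∉B₀ , b∈B₀ , b∉ , b₃
                         in move-out claim bB dist≡k x₀≢x d′ d (move-in claim bB dist≡k d₀ d′ e)
      ...     | no ¬b₃ with isBasis? (B ⊖ x ⊕ b₀)
      ...       | yes b₄ = let d′ = x∈ , x∉B₀ , b₀∈B₀ , b₀∉ , b₄
                           in move-in claim bB dist≡k d′ d (move-out claim bB dist≡k x₀≢x d₀ d′ e)
      ...       | no ¬b₄ = subst (λ S → E S x b) T⊕x₀ (fill-square {T = T} {x} {b} {x₀} {b₀} claim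
                    (x∉S⊖x B x ∘ ∈-⊖⁻ (B ⊖ x) x₀) (b∉ ∘ T⊆B) (x∉S⊖x (B ⊖ x) x₀) (b₀∉ ∘ T⊆B)
                    (∈∧∉⇒≢ x∈ b∉) (∈∧∉⇒≢ x₀∈ b₀∉) (∈∧∉⇒≢ x∈ b₀∉) (∈∧∉⇒≢ x₀∈ b∉ ∘ sym) (x₀≢x ∘ sym)
                    x∉B₀ x₀∉B₀ b∈B₀ b₀∈B₀ (trans (cong dist T⊕x⊕x₀) dist≡k)
                    (subst IsBasis (sym T⊕x⊕x₀) bB)
                    (subst (λ S → IsBasis (S ⊕ b₀)) (sym T⊕x) b₂)
                    (subst IsBasis (trans (cong (_⊕ b) (sym T⊕x₀)) (⊕-comm T x₀ b)) b₁)
                    (subst (λ S → ¬ IsBasis (S ⊕ b)) (sym T⊕x) ¬b₃)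
                    (subst (λ S → ¬ IsBasis (S ⊕ b₀)) (sym T⊕x₀) ¬b₄)
                    (subst (λ S → E S x₀ b₀) (sym T⊕x) e))
        where
        T : Subset n
        T = B ⊖ x ⊖ x₀
        T⊆B : T ⊆ B
        T⊆B = ∈-⊖⁻ B x ∘ ∈-⊖⁻ (B ⊖ x) x₀
        T⊕x₀ : T ⊕ x₀ ≡ B ⊖ x
        T⊕x₀ = ⊖-⊕ (∈-⊖⁺ x₀∈ x₀≢x)
        T⊕x : T ⊕ x ≡ B ⊖ x₀
        T⊕x = trans (sym (⊕⊖-comm (B ⊖ x) (x₀≢x ∘ sym))) (cong (_⊖ x₀) (⊖-⊕ x∈))
        T⊕x⊕x₀ : T ⊕ x ⊕ x₀ ≡ B
        T⊕x⊕x₀ = trans (cong (_⊕ x₀) T⊕x) (⊖-⊕ x₀∈)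

      mixed : ∀ {k} → Claim k → ∀ {S x y} → Completes S x → Completes S y →
              x ∉ B₀ → y ∈ B₀ → dist (S ⊕ x) < suc k → E S x y
      mixed {k} claim {S} {x} {y} (x∉S , bx) (y∉S , by) x∉B₀ y∈B₀ lt
        with ℕ.m≤n⇒m<n∨m≡n (ℕ.≤-pred lt)
      ... | inj₁ lt′ = claim (x∉S , bx) (y∉S , by) lt′
                         (subst (_< k) (sym (dist-∈ S y∈B₀))
                           (ℕ.<-trans (ℕ.≤-reflexive (sym (dist-∉ S x∉S x∉B₀))) lt′))
      ... | inj₂ eq  = subst (λ T → E T x y) (⊕-⊖ x∉S) (downward claim bx eq
                         (x∈S⊕x S x , x∉B₀ , y∈B₀ , ∉-⊕ y∉S (∈∧∉⇒≢ y∈B₀ x∉B₀) ,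
                          subst (λ T → IsBasis (T ⊕ y)) (sym (⊕-⊖ x∉S)) by))

      -- An edge with just one of `x` and `y` in `B₀` is a descent. If both lie outside, some `b` in
      -- `B₀` completes `S`, and the edge is composed of two descents over `S`. If both lie inside,
      -- some `z` outside `B₀` can be removed from `S ⊕ x ⊕ y` to leave a basis, and two descents
      -- are composed inside that set.
      claim-step : ∀ {k} → Claim k → Claim (suc k)
      claim-step {k} claim {S} {x} {y} cx@(x∉S , bx) cy@(y∉S , by) ltx lty
        with x ≟ y | x ∈? B₀ | y ∈? B₀
      ... | yes refl | _ | _ = refl
      ... | no x≢y | no x∉B₀ | yes y∈B₀ = mixed claim cx cy x∉B₀ y∈B₀ ltx
      ... | no x≢y | yes x∈B₀ | no y∉B₀ = sym (mixed claim cy cx y∉B₀ x∈B₀ lty)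
      ... | no x≢y | no x∉B₀ | no y∉B₀
        with b , b∈B₀ , b∉ , bb ← exch bx basis₀ (x∈S⊕x S x) x∉B₀ =
          let cb = b∉ ∘ ∈-⊕⁺ x , subst (λ T → IsBasis (T ⊕ b)) (⊕-⊖ x∉S) bb
          in E-trans (mixed claim cx cb x∉B₀ b∈B₀ ltx) (sym (mixed claim cy cb y∉B₀ b∈B₀ lty))
      ... | no x≢y | yes x∈B₀ | yes y∈B₀
        with z , z∈ , z∉B₀ , bz ← coexch bx basis₀ y∈B₀ (∉-⊕ y∉S (x≢y ∘ sym)) =
          subst (λ T → E T x y)
            (trans (cong (_⊖ y) (⊕⊕⊖ x∉S x≢y)) (⊕-⊖ y∉S))
            (lower x∈I y∈I x≢y bx′ by′
              (E*-trans (sym (raise z∈I x∈I z≢x bz′ bx′ (edge x∈I z≢x x∈B₀ bx′ ltx′)))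
                        (raise z∈I y∈I z≢y bz′ by′ (edge y∈I z≢y y∈B₀ by′ lty′))))
          where
          I : Subset n
          I = S ⊕ x ⊕ y
          z≢x : z ≢ x
          z≢x = ∈∧∉⇒≢ x∈B₀ z∉B₀ ∘ sym
          z≢y : z ≢ y
          z≢y = ∈∧∉⇒≢ y∈B₀ z∉B₀ ∘ sym
          x∈I : x ∈ I
          x∈I = ∈-⊕⁺ y (x∈S⊕x S x)
          y∈I : y ∈ I
          y∈I = x∈S⊕x (S ⊕ x) y
          z∈I : z ∈ I
          z∈I = ∈-⊕⁺ y z∈
          I⊖x : I ⊖ x ≡ S ⊕ y
          I⊖x = ⊕⊕⊖ x∉S x≢y
          I⊖y : I ⊖ y ≡ S ⊕ x
          I⊖y = ⊕-⊖ (∉-⊕ y∉S (x≢y ∘ sym))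
          bx′ : IsBasis (I ⊖ x)
          bx′ = subst IsBasis (sym I⊖x) by
          by′ : IsBasis (I ⊖ y)
          by′ = subst IsBasis (sym I⊖y) bx
          bz′ : IsBasis (I ⊖ z)
          bz′ = subst IsBasis (sym (⊕⊖-comm (S ⊕ x) (z≢y ∘ sym))) bz
          ltx′ : dist (I ⊖ x) < suc k
          ltx′ = subst (λ T → dist T < suc k) (sym I⊖x) lty
          lty′ : dist (I ⊖ y) < suc k
          lty′ = subst (λ T → dist T < suc k) (sym I⊖y) ltx
          edge : ∀ {w} → w ∈ I → z ≢ w → w ∈ B₀ → IsBasis (I ⊖ w) → dist (I ⊖ w) < suc k →
                 E (I ⊖ z ⊖ w) z w
          edge {w} w∈I z≢w w∈B₀ bw lt = mixed claim
            (x∉S⊖x I z ∘ ∈-⊖⁻ (I ⊖ z) w , subst IsBasis (sym e₁) bw)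
            (x∉S⊖x (I ⊖ z) w , subst IsBasis (sym e₂) bz′)
            z∉B₀ w∈B₀ (subst (λ T → dist T < suc k) (sym e₁) lt)
            where
            e₁ : I ⊖ z ⊖ w ⊕ z ≡ I ⊖ w
            e₁ = S⊕x≡ z∈I w∈I z≢w bz′ bw
            e₂ : I ⊖ z ⊖ w ⊕ w ≡ I ⊖ z
            e₂ = S⊕y≡ z∈I w∈I z≢w bz′ bw

      claim-all : ∀ k → Claim k
      claim-all zero    _ _ ()
      claim-all (suc k) = claim-step (claim-all k)

    potential-edge : ∀ {S x y} → Completes S x → Completes S y → Edge g (potential g) S x y
    potential-edge {S} {x} {y} cx cy = claim-all (suc (dist (S ⊕ x) ℕ.⊔ dist (S ⊕ y))) cx cy
      (s≤s (ℕ.m≤m⊔n _ _)) (s≤s (ℕ.m≤n⊔m (dist (S ⊕ x)) _))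

    potential-edge* : ∀ {I x y} → x ∈ I → y ∈ I → IsBasis (I ⊖ x) → IsBasis (I ⊖ y) →
                      g* (∁ I) x ∙ potential g (I ⊖ y) ≡ g* (∁ I) y ∙ potential g (I ⊖ x)
    potential-edge* {I} {x} {y} x∈I y∈I bx by with x ≟ y
    ... | yes refl = refl
    ... | no x≢y = raise x∈I y∈I x≢y bx by (potential-edge
            (x∉S⊖x I x ∘ ∈-⊖⁻ (I ⊖ x) y , subst IsBasis (sym (S⊕x≡ x∈I y∈I x≢y bx by)) by)
            (x∉S⊖x (I ⊖ x) y , subst IsBasis (sym (S⊕y≡ x∈I y∈I x≢y bx by)) bx))

  -- Single exchanges lead from any basis to `B₀`, so equal ratios along edges leave only one scalar
  -- free.
  connected : ∀ {Φ Φ′ : Subset n → H*} →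
    (∀ {S x y} → Completes S x → Completes S y → Φ (S ⊕ x) ∙ Φ′ (S ⊕ y) ≡ Φ (S ⊕ y) ∙ Φ′ (S ⊕ x)) →
    ∀ {B} → IsBasis B → Φ B ∙ Φ′ B₀ ≡ Φ B₀ ∙ Φ′ B
  connected {Φ} {Φ′} edge {B} bB = go (dist B) bB ℕ.≤-refl
    where
    go : ∀ k {B} → IsBasis B → dist B ≤ k → Φ B ∙ Φ′ B₀ ≡ Φ B₀ ∙ Φ′ B
    go k {B} bB le with ⊆-dec B B₀
    ... | inj₁ B⊆B₀ with refl ← ⊆-antisym B⊆B₀ (basis-⊆ bB basis₀ B⊆B₀) = refl
    ... | inj₂ (x , x∈B , x∉B₀)
      with b , b∈B₀ , b∉B , bb ← exch bB basis₀ x∈B x∉B₀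
      with d ← dist-descent (x∈B , x∉B₀ , b∈B₀ , b∉B , bb)
      with k
    ...   | zero  = contradiction (subst (_≤ 0) d le) λ ()
    ...   | suc k = combine (Φ (B ⊖ x ⊕ b) ∙ Φ′ (B ⊖ x ⊕ b))
              (subst (λ A → Φ A ∙ Φ′ (B ⊖ x ⊕ b) ≡ Φ (B ⊖ x ⊕ b) ∙ Φ′ A) (⊖-⊕ x∈B)
                (edge (x∉S⊖x B x , subst IsBasis (sym (⊖-⊕ x∈B)) bB) (b∉B ∘ ∈-⊖⁻ B x , bb)))
              (go k bb (ℕ.≤-pred (subst (_≤ suc k) d le)))
              (rearrange (Φ B) (Φ′ (B ⊖ x ⊕ b)) (Φ (B ⊖ x ⊕ b)) (Φ′ B₀))
              (trans (∙-comm (Φ (B ⊖ x ⊕ b) ∙ Φ′ B) (Φ B₀ ∙ Φ′ (B ⊖ x ⊕ b)))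
                (rearrange (Φ B₀) (Φ′ (B ⊖ x ⊕ b)) (Φ (B ⊖ x ⊕ b)) (Φ′ B)))
      where
      rearrange : ∀ p q′ q r′ → (p ∙ q′) ∙ (q ∙ r′) ≡ (q ∙ q′) ∙ (p ∙ r′)
      rearrange = solve 4 (λ p q′ q r′ → (p :∙ q′) :∙ (q :∙ r′) ⊜ (q :∙ q′) :∙ (p :∙ r′)) refl

-- Signatures read off a function on bases.

Required-≤ : ∀ • {k l} → k ≤ l → Required • l → Required • k
Required-≤ weak   k≤l l≤3 = ℕ.≤-trans k≤l l≤3
Required-≤ strong k≤l _   = _

-- Equations are taken only from conditions of size at most 3, which both strengths impose; hence
-- the two cases share one proof.
Required-3 : ∀ • {k} → k ≤ 3 → Required • k
Required-3 weak   k≤3 = k≤3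
Required-3 strong k≤3 = _

∣⊕∣≤ : ∀ {n} (S : Subset n) x → ∣ S ⊕ x ∣ ≤ suc ∣ S ∣
∣⊕∣≤ S x with x ∈? S
... | yes x∈S = ℕ.≤-trans (ℕ.≤-reflexive (cong ∣_∣ (⊕-absorb x∈S))) (ℕ.n≤1+n _)
... | no  x∉S = ℕ.≤-reflexive (∣⊕∣ S x∉S)

three-elements : ∀ {n} {S : Subset n} x y u →
                 (∀ {z} → z ∈ S → z ≢ x → z ≢ y → z ≡ u) → ∣ S ∣ ≤ 3
three-elements {n} {S} x y u only = ℕ.≤-trans (p⊆q⇒∣p∣≤∣q∣ S⊆)
  (ℕ.≤-trans (∣⊕∣≤ (empty ⊕ u ⊕ y) x) (s≤s (ℕ.≤-trans (∣⊕∣≤ (empty ⊕ u) y)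
    (s≤s (ℕ.≤-trans (∣⊕∣≤ empty u) (s≤s (ℕ.≤-reflexive (∣⊥∣≡0 n))))))))
  where
  S⊆ : S ⊆ empty ⊕ u ⊕ y ⊕ x
  S⊆ {z} z∈ with z ≟ x | z ≟ y
  ... | yes refl | _        = x∈S⊕x _ z
  ... | no _     | yes refl = ∈-⊕⁺ x (x∈S⊕x _ z)
  ... | no z≢x   | no z≢y   =
    subst (λ w → w ∈ empty ⊕ u ⊕ y ⊕ x) (sym (only z∈ z≢x z≢y)) (∈-⊕⁺ x (∈-⊕⁺ y (x∈S⊕x empty u)))

module Matching (H : Hyperfield a) {n : ℕ} (N : Matroid n) where
  open Values H
  open Cocircuits N

  -- Up to a sign depending on `J` alone, the row `x ↦ φ (x ∷ ys)` for a listing `ys` of `J`: the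
  -- sign moves `x` from the front to its sorted place.
  ψ : (Subset n → H*) → Subset n → Fin n → H*
  ψ Φ J x = σ (sgn x J) ∙ Φ (J ⊕ x)

  Matches : (Subset n → Fin n → H*) → (Subset n → H*) → Set a
  Matches η Φ = ∀ {J D} → Spans J D → η D ∝[ D ] ψ Φ J

  InSupport : Subset n → Subset n → Fin n → Set
  InSupport I J z = z ∈ I × IsBasis (I ⊖ z) × Completes J z

  inSupport? : ∀ I J → Decidable (InSupport I J)
  inSupport? I J z = (z ∈? I) ×-dec isBasis? (I ⊖ z) ×-dec completes? J z

  gpSupport : Subset n → Subset n → Subset n
  gpSupport I J = ⟪ inSupport? I J ⟫

  gpTerm : (Subset n → H*) → Subset n → Subset n → Fin n → H*
  gpTerm Φ I J z = (σ (sgn z I) ∙ Φ (I ⊖ z)) ∙ ψ Φ J z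

  -- An element of the support forces `I` to have one element more, and `J` one fewer, than a basis.
  -- For other sizes the support is empty and the relation trivial.
  GPRelations : Strength → (Subset n → H*) → Set a
  GPRelations • Φ = ∀ I J → Required • ∣ I ─ J ∣ → ZeroSum (gpSupport I J) (gpTerm Φ I J)

  ψ-∝⇒cross : ∀ {Φ Φ′ J D} → ψ Φ J ∝[ D ] ψ Φ′ J → ∀ {x y} → x ∈ D → y ∈ D →
              Φ (J ⊕ x) ∙ Φ′ (J ⊕ y) ≡ Φ (J ⊕ y) ∙ Φ′ (J ⊕ x)
  ψ-∝⇒cross {Φ} {Φ′} {J} p {x} {y} x∈ y∈ = ∙-cancelˡ (σ (sgn x J) ∙ σ (sgn y J)) _ _
    (trans (solve 4 (λ a b c d → (a :∙ b) :∙ (c :∙ d) ⊜ (a :∙ c) :∙ (b :∙ d)) refl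
             (σ (sgn x J)) (σ (sgn y J)) (Φ (J ⊕ x)) (Φ′ (J ⊕ y)))
      (trans (cross p x∈ y∈)
        (solve 4 (λ a b c d → (b :∙ c) :∙ (a :∙ d) ⊜ (a :∙ b) :∙ (c :∙ d)) refl
             (σ (sgn x J)) (σ (sgn y J)) (Φ (J ⊕ y)) (Φ′ (J ⊕ x)))))

  matches-unique : ∀ {η Φ Φ′} → Matches η Φ → Matches η Φ′ → ∀ {B} → IsBasis B →
                   Φ B ∙ Φ′ (proj₁ nonempty) ≡ Φ (proj₁ nonempty) ∙ Φ′ B
  matches-unique {η} {Φ} {Φ′} m m′ = Potential.connected H N {Φ} {Φ′} λ {S} cx cy →
    let sp = spans-completion cx
    in ψ-∝⇒cross {Φ} {Φ′} (∝-trans (∝-sym (m sp)) (m′ sp)) (∈-spans⁺ sp cx) (∈-spans⁺ sp cy)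

  matches-unique* : ∀ {η η′ Φ} → Matches η Φ → Matches η′ Φ → ∀ {D} → IsCocircuit D → η D ∝[ D ] η′ D
  matches-unique* m m′ (_ , sp) = ∝-trans (m sp) (∝-sym (m′ sp))

  module _ {• : Strength} {Φ : Subset n → H*} (gp : GPRelations • Φ) where

    private
      -- The relation for J ⊕ x ⊕ y and J ⊖ u ⊕ v has only the terms x and y, since
      -- u lies in the hyperplane spanned by J ⊖ u ⊕ v.
      exchange-∝ : ∀ {D J u v} → u ∈ J → Spans J D → Spans (J ⊖ u ⊕ v) D →
                   ψ Φ J ∝[ D ] ψ Φ (J ⊖ u ⊕ v)
      exchange-∝ {D} {J} {u} {v} u∈J sp sp′ = proportional cross′
        where
        J′ : Subset n
        J′ = J ⊖ u ⊕ v
        cross′ : ∀ {x y} → x ∈ D → y ∈ D → ψ Φ J x ∙ ψ Φ J′ y ≡ ψ Φ J y ∙ ψ Φ J′ x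
        cross′ {x} {y} x∈ y∈ with x ≟ y
        ... | yes refl = refl
        ... | no  x≢y  = goal
          where
          I : Subset n
          I = J ⊕ x ⊕ y
          x∉J : x ∉ J
          x∉J = proj₁ (∈-spans⁻ sp x∈)
          y∉J : y ∉ J
          y∉J = proj₁ (∈-spans⁻ sp y∈)
          I⊖x : I ⊖ x ≡ J ⊕ y
          I⊖x = ⊕⊕⊖ x∉J x≢y
          I⊖y : I ⊖ y ≡ J ⊕ x
          I⊖y = ⊕-⊖ (∉-⊕ y∉J (x≢y ∘ sym))
          z∈J⇒ : ∀ {z} → z ∈ J → z ≢ u → z ∈ J′
          z∈J⇒ z∈J z≢u = ∈-⊕⁺ v (∈-⊖⁺ z∈J z≢u)

          x∈supp : x ∈ gpSupport I J′
          x∈supp = ∈⟪⟫⁺ (inSupport? I J′)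
            (∈-⊕⁺ y (x∈S⊕x J x) , subst IsBasis (sym I⊖x) (proj₂ (∈-spans⁻ sp y∈)) , ∈-spans⁻ sp′ x∈)
          y∈supp : y ∈ gpSupport I J′
          y∈supp = ∈⟪⟫⁺ (inSupport? I J′)
            (x∈S⊕x (J ⊕ x) y , subst IsBasis (sym I⊖y) (proj₂ (∈-spans⁻ sp x∈)) , ∈-spans⁻ sp′ y∈)
          only : ∀ {z} → z ∈ gpSupport I J′ → z ≢ x → z ≡ y
          only {z} z∈ z≢x with z∈I , _ , c@(z∉J′ , _) ← ∈⟪⟫⁻ (inSupport? I J′) z∈ =
            decidable-stable (z ≟ y) λ z≢y →
              let z∈J = ∈-⊕⁻ J x (∈-⊕⁻ (J ⊕ x) y z∈I z≢y) z≢x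
              in proj₁ (∈-spans⁻ sp (∈-spans⁺ sp′ c)) z∈J

          req : Required • ∣ I ─ J′ ∣
          req = Required-3 • (three-elements x y u λ {z} z∈ z≢x z≢y →
            decidable-stable (z ≟ u) λ z≢u → x∈p─q⁻ I J′ z∈
              (z∈J⇒ (∈-⊕⁻ J x (∈-⊕⁻ (J ⊕ x) y (p─q⊆p I J′ z∈) z≢y) z≢x) z≢u))

          -- Just one of `x` and `y` lies below the other, so passing from `J` to `I` changes their
          -- signs by opposite factors. The resulting minus cancels the one in the two-term
          -- relation.
          sgn-x : sgn x I ≡ Sign.- Sign.* (sgn₁ y x Sign.* sgn x J)
          sgn-x = trans (cong (sgn x) (⊕-comm J x y)) (trans (sgn-self-⊕ x (J ⊕ y))
            (trans (sgn-⊕ x J y∉J) (trans (cong (Sign._* sgn x J) (sgn₁-flip x≢y))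
              (Sign.*-assoc Sign.- (sgn₁ y x) (sgn x J)))))
          sgn-y : sgn y I ≡ sgn₁ y x Sign.* sgn y J
          sgn-y = trans (sgn-self-⊕ y (J ⊕ x)) (sgn-⊕ y J x∉J)

          σx σy ε : H*
          σx = σ (sgn x J)
          σy = σ (sgn y J)
          ε  = σ (sgn₁ y x)

          σ-x : σ (sgn x I) ≡ -1* ∙ (ε ∙ σx)
          σ-x = trans (cong σ sgn-x) (trans (σ-* Sign.- (sgn₁ y x Sign.* sgn x J))
            (cong (-1* ∙_) (σ-* (sgn₁ y x) (sgn x J))))
          σ-y : σ (sgn y I) ≡ ε ∙ σy
          σ-y = trans (cong σ sgn-y) (σ-* (sgn₁ y x) (sgn y J))

          relation : ((-1* ∙ (ε ∙ σx)) ∙ Φ (J ⊕ y)) ∙ ψ Φ J′ x ≡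
                     -1* ∙ (((ε ∙ σy) ∙ Φ (J ⊕ x)) ∙ ψ Φ J′ y)
          relation = subst₂ (λ p q → (p ∙ q) ∙ ψ Φ J′ x ≡ -1* ∙ (((ε ∙ σy) ∙ Φ (J ⊕ x)) ∙ ψ Φ J′ y))
            σ-x (cong Φ I⊖x)
            (subst₂ (λ p q → gpTerm Φ I J′ x ≡ -1* ∙ ((p ∙ q) ∙ ψ Φ J′ y)) σ-y (cong Φ I⊖y)
              (zeroSum-pair {f = gpTerm Φ I J′} x∈supp y∈supp x≢y only (gp I J′ req)))

          goal : ψ Φ J x ∙ ψ Φ J′ y ≡ ψ Φ J y ∙ ψ Φ J′ x
          goal = combine (-1* ∙ ε) (sym relation) (refl {x = σx ∙ σy})
            (trans (solve 6 (λ m e p q f k → (m :∙ (((e :∙ q) :∙ f) :∙ k)) :∙ (p :∙ q) ⊜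
                                             q :∙ (q :∙ ((m :∙ e) :∙ ((p :∙ f) :∙ k))))
                     refl -1* ε σx σy (Φ (J ⊕ x)) (ψ Φ J′ y))
                   (σ-cancel (sgn y J) _))
            (trans (solve 6 (λ m e p q f k → (((m :∙ (e :∙ p)) :∙ f) :∙ k) :∙ (p :∙ q) ⊜
                                             p :∙ (p :∙ ((m :∙ e) :∙ ((q :∙ f) :∙ k))))
                     refl -1* ε σx σy (Φ (J ⊕ y)) (ψ Φ J′ x))
                   (σ-cancel (sgn x J) _))

    -- An exchange of `J ⊕ x` towards `J′ ⊕ x` leaves `x` in place, and the entering `v` belongs to
    -- `J′`, hence not to `D`. So the intermediate sets span `D` again, and `exchange-∝` applies to
    -- each step.
    well-defined : ∀ {D J J′} → Spans J D → Spans J′ D → ψ Φ J ∝[ D ] ψ Φ J′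
    well-defined {D} {J} {J′} sp sp′ = go _ sp ℕ.≤-refl
      where
      go : ∀ k {J} → Spans J D → ∣ J ─ J′ ∣ ≤ k → ψ Φ J ∝[ D ] ψ Φ J′
      go k {J} sp@(_ , x , x∈D) le with ⊆-dec J J′
      ... | inj₁ J⊆J′ = subst (λ T → ψ Φ J ∝[ D ] ψ Φ T) (⊆-antisym J⊆J′ J′⊆J) ∝-refl
        where
        x∉J′ : x ∉ J′
        x∉J′ = proj₁ (∈-spans⁻ sp′ x∈D)
        grown : J ⊕ x ⊆ J′ ⊕ x
        grown {z} z∈ with z ≟ x
        ... | yes refl = x∈S⊕x J′ x
        ... | no  z≢x  = ∈-⊕⁺ x (J⊆J′ (∈-⊕⁻ J x z∈ z≢x))
        J′⊆J : J′ ⊆ J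
        J′⊆J z∈ = ∈-⊕⁻ J x
          (basis-⊆ (proj₂ (∈-spans⁻ sp x∈D)) (proj₂ (∈-spans⁻ sp′ x∈D)) grown (∈-⊕⁺ x z∈))
          (∈∧∉⇒≢ z∈ x∉J′)
      ... | inj₂ (u , u∈J , u∉J′) = case exch (proj₂ (∈-spans⁻ sp x∈D)) (proj₂ (∈-spans⁻ sp′ x∈D))
                                           (∈-⊕⁺ x u∈J) (∉-⊕ u∉J′ u≢x) of λ where
          (v , v∈ , v∉ , b) → step k le v (∈-⊕⁻ J′ x v∈ λ { refl → v∉ (x∈S⊕x J x) })
            (respan sp (λ {w} w∈ w∈D → case w ≟ v of λ where
                (yes refl) → v∉J′∩D v∈ v∉ w∈D
                (no w≢v)   → proj₁ (∈-spans⁻ sp w∈D) (∈-⊖⁻ J u (∈-⊕⁻ (J ⊖ u) v w∈ w≢v)))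
              x∈D (subst IsBasis (trans (cong (_⊕ v) (⊕⊖-comm J (u≢x ∘ sym))) (⊕-comm (J ⊖ u) x v)) b))
        where
        u≢x : u ≢ x
        u≢x = ∈∧∉⇒≢ u∈J (proj₁ (∈-spans⁻ sp x∈D))
        v∉J′∩D : ∀ {v} → v ∈ J′ ⊕ x → v ∉ J ⊕ x → v ∉ D
        v∉J′∩D v∈ v∉ v∈D =
          proj₁ (∈-spans⁻ sp′ v∈D) (∈-⊕⁻ J′ x v∈ λ { refl → v∉ (x∈S⊕x J x) })
        step : ∀ k → ∣ J ─ J′ ∣ ≤ k → ∀ v → v ∈ J′ → Spans (J ⊖ u ⊕ v) D → ψ Φ J ∝[ D ] ψ Φ J′
        step zero    le v v∈J′ _   = contradiction
          (ℕ.≤-trans (ℕ.≤-reflexive (∣⊖∣ (J ─ J′) (x∈p∧x∉q⇒x∈p─q u∈J u∉J′))) le) λ ()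
        step (suc k) le v v∈J′ sp″ = ∝-trans (exchange-∝ u∈J sp sp″) (go k sp″
          (ℕ.≤-trans (p⊆q⇒∣p∣≤∣q∣ smaller) (ℕ.≤-pred (ℕ.≤-trans
            (ℕ.≤-reflexive (∣⊖∣ (J ─ J′) (x∈p∧x∉q⇒x∈p─q u∈J u∉J′))) le))))
          where
          smaller : (J ⊖ u ⊕ v) ─ J′ ⊆ (J ─ J′) ⊖ u
          smaller {z} z∈ =
            let z∉J′ = x∈p─q⁻ _ J′ z∈
                z∈J  = ∈-⊕⁻ (J ⊖ u) v (p─q⊆p _ J′ z∈) (∈∧∉⇒≢ v∈J′ z∉J′ ∘ sym)
            in ∈-⊖⁺ (x∈p∧x∉q⇒x∈p─q (∈-⊖⁻ J u z∈J) z∉J′) (∈-⊖-≢ J u z∈J)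

  -- The spanning set is the one found by `isCocircuit?`, whatever `Φ` is, so each entry is a fixed
  -- sign times one value of `Φ`.
  signature : (Subset n → H*) → Subset n → Fin n → H*
  signature Φ D x with isCocircuit? D
  ... | yes (J , _) = ψ Φ J x
  ... | no  _       = 1*

  signature-matches : ∀ {• Φ} → GPRelations • Φ → Matches (signature Φ) Φ
  signature-matches {Φ = Φ} gp {J} {D} sp with isCocircuit? D
  ... | yes (J′ , sp′) = well-defined {Φ = Φ} gp sp′ sp
  ... | no  ¬c         = contradiction (J , sp) ¬c

-- Orthogonality against Plücker relations, and the coherence of orthogonal signatures.

module Orthogonality (H : Hyperfield a) {n : ℕ} (N : Matroid n) where
  open Values H
  open Cocircuits N
  private
    module N* = Cocircuits (dual N)
    module P  = Matching H N
    module P* = Matching H (dual N)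
  open P using (ψ; gpSupport; gpTerm; GPRelations; Matches)

  -- γ* C z is γ C z times the sign of z in the whole ground set, and η is τ ∘ δ.
  -- With these signs, γ* is to the dual matroid and Φ ∘ ∁ what η is to N and Φ.
  orthTerm : (γ* η : Subset n → Fin n → H*) → Subset n → Subset n → Fin n → H*
  orthTerm γ* η C D z = σ (sgn z full) ∙ (γ* C z ∙ η D z)

  Orthogonal : Strength → (γ* η : Subset n → Fin n → H*) → Set a
  Orthogonal • γ* η = ∀ {C D} → N*.IsCocircuit C → IsCocircuit D → Required • ∣ C ∩ D ∣ →
                      ZeroSum (C ∩ D) (orthTerm γ* η C D)

  basis-∁⊕ : ∀ {I z} → IsBasis (∁ (∁ I ⊕ z)) → IsBasis (I ⊖ z)
  basis-∁⊕ {I} {z} = subst IsBasis (trans (∁-⊕ (∁ I) z) (cong (_⊖ z) (∁-involutive I)))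

  basis-⊖ : ∀ {I z} → IsBasis (I ⊖ z) → IsBasis (∁ (∁ I ⊕ z))
  basis-⊖ {I} {z} = subst IsBasis (sym (trans (∁-⊕ (∁ I) z) (cong (_⊖ z) (∁-involutive I))))

  completes*⁺ : ∀ {I z} → z ∈ I → IsBasis (I ⊖ z) → N*.Completes (∁ I) z
  completes*⁺ z∈I b = (λ z∈ → x∈∁p⇒x∉p z∈ z∈I) , basis-⊖ b

  completes*⁻ : ∀ {I z} → N*.Completes (∁ I) z → z ∈ I × IsBasis (I ⊖ z)
  completes*⁻ (z∉ , b) = x∉∁p⇒x∈p z∉ , basis-∁⊕ b

  gpSupport≡∩ : ∀ {I J C D} → N*.Spans (∁ I) C → Spans J D → gpSupport I J ≡ C ∩ D
  gpSupport≡∩ {I} {J} {C} {D} spC spD = ⊆-antisym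
    (λ z∈ → let z∈I , b , c = ∈⟪⟫⁻ (P.inSupport? I J) z∈
            in x∈p∩q⁺ (N*.∈-spans⁺ spC (completes*⁺ z∈I b) , ∈-spans⁺ spD c))
    (λ z∈ → let z∈C , z∈D = x∈p∩q⁻ C D z∈
                z∈I , b = completes*⁻ (N*.∈-spans⁻ spC z∈C)
            in ∈⟪⟫⁺ (P.inSupport? I J) (z∈I , b , ∈-spans⁻ spD z∈D))

  ψ* : (Subset n → H*) → Subset n → Fin n → H*
  ψ* Φ I z = σ (sgn z I) ∙ Φ (I ⊖ z)

  ψ*-∁ : ∀ Φ I z → P*.ψ (Φ ∘ ∁) (∁ I) z ≡ σ (sgn z full) ∙ ψ* Φ I z
  ψ*-∁ Φ I z = trans
    (cong₂ _∙_ (trans (cong σ (sgn-∁ z I)) (σ-* (sgn z full) (sgn z I)))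
               (cong Φ (trans (∁-⊕ (∁ I) z) (cong (_⊖ z) (∁-involutive I)))))
    (∙-assoc (σ (sgn z full)) (σ (sgn z I)) (Φ (I ⊖ z)))

  -- The factor `sgn z full` of `orthTerm` cancels the one by which the dual row at `∁ I` differs
  -- from `ψ*` at `I`.
  orthTerm∝gpTerm : ∀ {γ* η Φ I J C D} → P*.Matches γ* (Φ ∘ ∁) → Matches η Φ →
                    N*.Spans (∁ I) C → Spans J D →
                    orthTerm γ* η C D ∝[ C ∩ D ] gpTerm Φ I J
  orthTerm∝gpTerm {γ*} {η} {Φ} {I} {J} {C} {D} m* m spC spD =
    ∝-trans (∝-cong λ {z} _ → sym (∙-assoc (σ (sgn z full)) (γ* C z) (η D z)))
      (∝-∙ (∝-trans (∝-∙ (∝-refl {f = σ ∘ λ z → sgn z full})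
                          (∝-⊆ (p∩q⊆p C D) (m* spC)))
             (∝-cong λ {z} _ → trans (cong (σ (sgn z full) ∙_) (ψ*-∁ Φ I z))
                                     (σ-cancel (sgn z full) (ψ* Φ I z))))
           (∝-⊆ (p∩q⊆q C D) (m spD)))

  module _ {• : Strength} {γ* η : Subset n → Fin n → H*} {Φ : Subset n → H*}
           (m* : P*.Matches γ* (Φ ∘ ∁)) (m : Matches η Φ) where

    -- An element of the support makes `I` and `J` determine a circuit and a cocircuit. Their
    -- intersection lies in `I ─ J`, so a bound on the latter passes to the former.
    orthogonal⇒relations : Orthogonal • γ* η → GPRelations • Φ
    orthogonal⇒relations orth I J req with nonempty? (gpSupport I J)
    ... | no  ∅         = zeroSum-empty {f = gpTerm Φ I J} λ z∈ → ∅ (_ , z∈)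
    ... | yes (w , w∈)
      with w∈I , b , c ← ∈⟪⟫⁻ (P.inSupport? I J) w∈
      with spC ← N*.spans-completion {∁ I} (completes*⁺ w∈I b) | spD ← spans-completion c
      = subst (λ S → ZeroSum S (gpTerm Φ I J)) (sym (gpSupport≡∩ spC spD))
          (zeroSum-∝ (orthTerm∝gpTerm {γ*} {η} {Φ} m* m spC spD)
            (orth (_ , spC) (_ , spD) (Required-≤ • (p⊆q⇒∣p∣≤∣q∣ ∩⊆) req)))
      where
      ∩⊆ : N*.completion (∁ I) ∩ completion J ⊆ I ─ J
      ∩⊆ z∈ = let z∈C , z∈D = x∈p∩q⁻ (N*.completion (∁ I)) (completion J) z∈
              in x∈p∧x∉q⇒x∈p─q (proj₁ (completes*⁻ (∈⟪⟫⁻ (N*.completes? (∁ I)) z∈C)))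
                               (proj₁ (∈⟪⟫⁻ (completes? J) z∈D))

    -- The bound has to pass the other way here, so arbitrary spanning sets are first replaced by
    -- those of `common-spanning`.
    relations⇒orthogonal : GPRelations • Φ → Orthogonal • γ* η
    relations⇒orthogonal gp {C} {D} (_ , spC₀) (_ , spD₀) req with nonempty? (C ∩ D)
    ... | no  ∅         = zeroSum-empty {f = orthTerm γ* η C D} λ z∈ → ∅ (_ , z∈)
    ... | yes (w , w∈)
      with w∈C , w∈D ← x∈p∩q⁻ C D w∈
      with I , J , spC , spD , I─J⊆ ← Circuits.common-spanning N spC₀ spD₀ w∈C w∈D
      = zeroSum-∝ (∝-sym (orthTerm∝gpTerm {γ*} {η} {Φ} m* m spC spD))
          (subst (λ S → ZeroSum S (gpTerm Φ I J)) (gpSupport≡∩ spC spD)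
            (gp I J (Required-≤ • (p⊆q⇒∣p∣≤∣q∣ I─J⊆) req)))

  -- The dual relation for `I` and `J` is the original one for `∁ J` and `∁ I`: the differences
  -- coincide, and the two signs of `z` in the whole ground set cancel.
  relations-dual : ∀ {• Φ} → GPRelations • Φ → P*.GPRelations • (Φ ∘ ∁)
  relations-dual {•} {Φ} gp I J req =
    zeroSum-∝ terms
      (subst (λ S → ZeroSum S (gpTerm Φ (∁ J) (∁ I))) support
        (gp (∁ J) (∁ I) (subst (Required • ∘ ∣_∣) (sym (∁─∁ J I)) req)))
    where
    support : gpSupport (∁ J) (∁ I) ≡ P*.gpSupport I J
    support = ⊆-antisym
      (λ {z} z∈ → let z∈∁J , b , z∉∁I , b′ = ∈⟪⟫⁻ (P.inSupport? (∁ J) (∁ I)) z∈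
              in ∈⟪⟫⁺ (P*.inSupport? I J) (x∉∁p⇒x∈p z∉∁I , subst IsBasis (sym (∁-⊖ I z)) b′ ,
                   x∈∁p⇒x∉p z∈∁J , subst IsBasis (sym (∁-⊕ J z)) b))
      (λ {z} z∈ → let z∈I , b , z∉J , b′ = ∈⟪⟫⁻ (P*.inSupport? I J) z∈
              in ∈⟪⟫⁺ (P.inSupport? (∁ J) (∁ I)) (x∉p⇒x∈∁p z∉J , subst IsBasis (∁-⊕ J z) b′ ,
                   (λ z∈∁I → x∈∁p⇒x∉p z∈∁I z∈I) , subst IsBasis (∁-⊖ I z) b))
    terms : ∀ {S} → gpTerm Φ (∁ J) (∁ I) ∝[ S ] P*.gpTerm (Φ ∘ ∁) I J
    terms = ∝-cong λ {z} _ → pointwise z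
      where
      pointwise : ∀ z → gpTerm Φ (∁ J) (∁ I) z ≡ P*.gpTerm (Φ ∘ ∁) I J z
      pointwise z
        rewrite ∁-⊖ I z | ∁-⊕ J z | sgn-∁ z I | sgn-∁ z J
              | σ-* (sgn z full) (sgn z I) | σ-* (sgn z full) (sgn z J) =
        trans (solve 5 (λ t i j p q → ((t :∙ j) :∙ p) :∙ ((t :∙ i) :∙ q) ⊜ t :∙ (t :∙ ((i :∙ q) :∙ (j :∙ p))))
                 refl (σ (sgn z full)) (σ (sgn z I)) (σ (sgn z J)) (Φ (∁ J ⊖ z)) (Φ (∁ I ⊕ z)))
              (σ-cancel (sgn z full) _)

  -- The value which η prescribes for `Φ (S ⊕ x)`, up to a factor depending on `S` only; the sign of
  -- `ψ` is moved to this side.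
  signed : (Subset n → Fin n → H*) → Subset n → Fin n → H*
  signed η S x = σ (sgn x S) ∙ η (completion S) x

  module _ {• : Strength} {γ* η : Subset n → Fin n → H*} (orth : Orthogonal • γ* η) where
    private
      signed* : Subset n → Fin n → H*
      signed* S x = σ (sgn x S) ∙ γ* (N*.completion S) x

      module Pot = Potential H N

      -- The two sides differ by the reversal of four pairs, and four changes of sign cancel.
      sgn₁-flips : ∀ {u v x y : Fin n} → u ≢ x → u ≢ y → v ≢ x → v ≢ y →
                (sgn₁ x u Sign.* sgn₁ u y) Sign.* (sgn₁ y v Sign.* sgn₁ v x) ≡
                (sgn₁ y u Sign.* sgn₁ v y) Sign.* (sgn₁ x v Sign.* sgn₁ u x)
      sgn₁-flips {u} {v} {x} {y} u≢x u≢y v≢x v≢y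
        rewrite sgn₁-flip u≢x | sgn₁-flip u≢y | sgn₁-flip v≢x | sgn₁-flip v≢y =
        cases (sgn₁ x u) (sgn₁ y u) (sgn₁ y v) (sgn₁ x v)
        where
        cases : ∀ a b c d → (a Sign.* (Sign.- Sign.* b)) Sign.* (c Sign.* (Sign.- Sign.* d)) ≡
                            (b Sign.* (Sign.- Sign.* c)) Sign.* (d Sign.* (Sign.- Sign.* a))
        cases Sign.+ Sign.+ Sign.+ Sign.+ = refl
        cases Sign.+ Sign.+ Sign.+ Sign.- = refl
        cases Sign.+ Sign.+ Sign.- Sign.+ = refl
        cases Sign.+ Sign.+ Sign.- Sign.- = refl
        cases Sign.+ Sign.- Sign.+ Sign.+ = refl
        cases Sign.+ Sign.- Sign.+ Sign.- = refl
        cases Sign.+ Sign.- Sign.- Sign.+ = refl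
        cases Sign.+ Sign.- Sign.- Sign.- = refl
        cases Sign.- Sign.+ Sign.+ Sign.+ = refl
        cases Sign.- Sign.+ Sign.+ Sign.- = refl
        cases Sign.- Sign.+ Sign.- Sign.+ = refl
        cases Sign.- Sign.+ Sign.- Sign.- = refl
        cases Sign.- Sign.- Sign.+ Sign.+ = refl
        cases Sign.- Sign.- Sign.+ Sign.- = refl
        cases Sign.- Sign.- Sign.- Sign.+ = refl
        cases Sign.- Sign.- Sign.- Sign.- = refl

      signed-⊕ : ∀ T {u D} x → u ∉ T → completion (T ⊕ u) ≡ D →
                 signed η (T ⊕ u) x ≡ σ (sgn₁ x u) ∙ (σ (sgn x T) ∙ η D x)
      signed-⊕ T {u} {D} x u∉ refl = trans
        (cong (_∙ η D x) (trans (cong σ (sgn-⊕ x T u∉)) (σ-* (sgn₁ x u) (sgn x T))))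
        (∙-assoc (σ (sgn₁ x u)) (σ (sgn x T)) (η D x))

      -- As `T ⊕ u ⊕ v` is not a basis, `v` lies in the hyperplane spanned by `T ⊕ u`; then `T ⊕ v`
      -- spans the same hyperplane.
      parallel : ∀ {T u v x} → u ∉ T → u ≢ v → v ∉ T → x ∉ T → u ≢ x →
                 IsBasis (T ⊕ u ⊕ x) → IsBasis (T ⊕ v ⊕ x) → ¬ IsBasis (T ⊕ u ⊕ v) →
                 completion (T ⊕ u) ≡ completion (T ⊕ v)
      parallel {T} {u} {v} {x} u∉ u≢v v∉ x∉ u≢x bux bvx ¬buv = proj₁ (respan sp
          (λ {w} w∈ w∈D → case w ≟ v of λ where
            (yes refl) → ¬buv (proj₂ (∈-spans⁻ sp w∈D))
            (no w≢v)   → proj₁ (∈-spans⁻ sp w∈D) (∈-⊕⁺ u (∈-⊕⁻ T v w∈ w≢v)))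
          (∈-spans⁺ sp cx) bvx)
        where
        cx : Completes (T ⊕ u) x
        cx = ∉-⊕ x∉ (u≢x ∘ sym) , bux
        sp : Spans (T ⊕ u) (completion (T ⊕ u))
        sp = spans-completion cx

      coherent : Pot.Coherent (signed η) signed*
      coherent = record { circuit = circuit ; square = square }
        where
        circuit : ∀ {I x y} → x ∈ I → y ∈ I → x ≢ y → IsBasis (I ⊖ x) → IsBasis (I ⊖ y) →
                  signed η (I ⊖ x ⊖ y) x ∙ signed* (∁ I) x ≡ signed η (I ⊖ x ⊖ y) y ∙ signed* (∁ I) y
        -- `C` and `D` meet in exactly `x` and `y`, so orthogonality is an equation of two terms.
        -- Its minus sign is absorbed by reversing the order of `x` and `y`.
        circuit {I} {x} {y} x∈I y∈I x≢y bx by = begin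
          signed η S x ∙ signed* (∁ I) x
            ≡⟨ normalise x (sgn₁ x y) sgn-x ⟩
          σ (sgn₁ x y) ∙ orthTerm γ* η C D x
            ≡⟨ cong₂ (λ p q → σ p ∙ q) (sgn₁-flip x≢y)
                 (zeroSum-pair {f = orthTerm γ* η C D} x∈ y∈ x≢y only
                   (orth (∁ I , spC) (S , spD) (Required-3 • (three-elements x y y
                     λ z∈ z≢x z≢y → contradiction (only z∈ z≢x) z≢y)))) ⟩
          σ (Sign.- Sign.* sgn₁ y x) ∙ (-1* ∙ orthTerm γ* η C D y)
            ≡⟨ cong (_∙ (-1* ∙ orthTerm γ* η C D y)) (σ-* Sign.- (sgn₁ y x)) ⟩
          (-1* ∙ σ (sgn₁ y x)) ∙ (-1* ∙ orthTerm γ* η C D y)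
            ≡⟨ solve 3 (λ m e t → (m :∙ e) :∙ (m :∙ t) ⊜ m :∙ (m :∙ (e :∙ t))) refl
                 -1* (σ (sgn₁ y x)) (orthTerm γ* η C D y) ⟩
          -1* ∙ (-1* ∙ (σ (sgn₁ y x) ∙ orthTerm γ* η C D y))
            ≡⟨ σ-cancel Sign.- _ ⟩
          σ (sgn₁ y x) ∙ orthTerm γ* η C D y
            ≡⟨ normalise y (sgn₁ y x) sgn-y ⟨
          signed η S y ∙ signed* (∁ I) y ∎
          where
          open ≡-Reasoning
          S C D : Subset n
          S = I ⊖ x ⊖ y
          C = N*.completion (∁ I)
          D = completion S
          S⊕x : S ⊕ x ≡ I ⊖ y
          S⊕x = trans (sym (⊕⊖-comm (I ⊖ x) x≢y)) (cong (_⊖ y) (⊖-⊕ x∈I))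
          S⊕y : S ⊕ y ≡ I ⊖ x
          S⊕y = ⊖-⊕ (∈-⊖⁺ y∈I (x≢y ∘ sym))
          cx : Completes S x
          cx = x∉S⊖x I x ∘ ∈-⊖⁻ (I ⊖ x) y , subst IsBasis (sym S⊕x) by
          cy : Completes S y
          cy = x∉S⊖x (I ⊖ x) y , subst IsBasis (sym S⊕y) bx
          spD : Spans S D
          spD = spans-completion cx
          spC : N*.Spans (∁ I) C
          spC = N*.spans-completion {∁ I} (completes*⁺ x∈I bx)
          x∈ : x ∈ C ∩ D
          x∈ = x∈p∩q⁺ (N*.∈-spans⁺ spC (completes*⁺ x∈I bx) , ∈-spans⁺ spD cx)
          y∈ : y ∈ C ∩ D
          y∈ = x∈p∩q⁺ (N*.∈-spans⁺ spC (completes*⁺ y∈I by) , ∈-spans⁺ spD cy)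
          only : ∀ {z} → z ∈ C ∩ D → z ≢ x → z ≡ y
          only {z} z∈ z≢x =
            let z∈C , z∈D = x∈p∩q⁻ C D z∈
            in decidable-stable (z ≟ y) λ z≢y → proj₁ (∈-spans⁻ spD z∈D)
                 (∈-⊖⁺ (∈-⊖⁺ (proj₁ (completes*⁻ (N*.∈-spans⁻ spC z∈C))) z≢x) z≢y)
          I≡ : I ≡ S ⊕ x ⊕ y
          I≡ = trans (sym (⊖-⊕ y∈I)) (cong (_⊕ y) (sym S⊕x))
          sgn-x : sgn x (∁ I) ≡ sgn x full Sign.* (sgn₁ x y Sign.* sgn x S)
          sgn-x = trans (sgn-∁ x I) (cong (sgn x full Sign.*_)
            (trans (cong (sgn x) I≡) (trans (sgn-⊕ x (S ⊕ x) (∉-⊕ (proj₁ cy) (x≢y ∘ sym)))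
              (cong (sgn₁ x y Sign.*_) (sgn-self-⊕ x S)))))
          sgn-y : sgn y (∁ I) ≡ sgn y full Sign.* (sgn₁ y x Sign.* sgn y S)
          sgn-y = trans (sgn-∁ y I) (cong (sgn y full Sign.*_)
            (trans (cong (sgn y) I≡) (trans (sgn-self-⊕ y (S ⊕ x)) (sgn-⊕ y S (proj₁ cx)))))
          normalise : ∀ w e → sgn w (∁ I) ≡ sgn w full Sign.* (e Sign.* sgn w S) →
                      signed η S w ∙ signed* (∁ I) w ≡ σ e ∙ orthTerm γ* η C D w
          normalise w e eq = begin
            (σ (sgn w S) ∙ η D w) ∙ (σ (sgn w (∁ I)) ∙ γ* C w)
              ≡⟨ cong (λ p → (σ (sgn w S) ∙ η D w) ∙ (p ∙ γ* C w))
                   (trans (cong σ eq) (trans (σ-* (sgn w full) _)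
                     (cong (σ (sgn w full) ∙_) (σ-* e (sgn w S))))) ⟩
            (σ (sgn w S) ∙ η D w) ∙ ((σ (sgn w full) ∙ (σ e ∙ σ (sgn w S))) ∙ γ* C w)
              ≡⟨ solve 5 (λ q h f e k → (q :∙ h) :∙ ((f :∙ (e :∙ q)) :∙ k) ⊜
                                        q :∙ (q :∙ (e :∙ (f :∙ (k :∙ h))))) refl
                   (σ (sgn w S)) (η D w) (σ (sgn w full)) (σ e) (γ* C w) ⟩
            σ (sgn w S) ∙ (σ (sgn w S) ∙ (σ e ∙ orthTerm γ* η C D w))
              ≡⟨ σ-cancel (sgn w S) _ ⟩
            σ e ∙ orthTerm γ* η C D w ∎

        square : ∀ {T u v x y} → u ∉ T → v ∉ T → x ∉ T → y ∉ T → u ≢ v → x ≢ y →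
                 u ≢ x → u ≢ y → v ≢ x → v ≢ y →
                 IsBasis (T ⊕ u ⊕ x) → IsBasis (T ⊕ u ⊕ y) →
                 IsBasis (T ⊕ v ⊕ x) → IsBasis (T ⊕ v ⊕ y) →
                 ¬ IsBasis (T ⊕ u ⊕ v) → ¬ IsBasis (T ⊕ x ⊕ y) →
                 (signed η (T ⊕ u) x ∙ signed η (T ⊕ y) u) ∙ (signed η (T ⊕ v) y ∙ signed η (T ⊕ x) v) ≡
                 (signed η (T ⊕ u) y ∙ signed η (T ⊕ y) v) ∙ (signed η (T ⊕ v) x ∙ signed η (T ⊕ x) u)
        -- Over `T`, `u` is parallel to `v` and `x` to `y`. So only two cocircuits occur, and both
        -- sides are products of the same four entries of η.
        square {T} {u} {v} {x} {y} u∉ v∉ x∉ y∉ u≢v x≢y u≢x u≢y v≢x v≢y ux uy vx vy ¬uv ¬xy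
          = begin
            (signed η (T ⊕ u) x ∙ signed η (T ⊕ y) u) ∙ (signed η (T ⊕ v) y ∙ signed η (T ⊕ x) v)
              ≡⟨ cong₂ _∙_ (cong₂ _∙_ (signed-⊕ T x u∉ u∥v) (signed-⊕ T u y∉ refl))
                           (cong₂ _∙_ (signed-⊕ T y v∉ refl) (signed-⊕ T v x∉ x∥y)) ⟩
            ((σ (sgn₁ x u) ∙ p) ∙ (σ (sgn₁ u y) ∙ q)) ∙ ((σ (sgn₁ y v) ∙ r) ∙ (σ (sgn₁ v x) ∙ t))
              ≡⟨ solve 8 (λ a b c d p q r t →
                   ((a :∙ p) :∙ (b :∙ q)) :∙ ((c :∙ r) :∙ (d :∙ t)) ⊜
                   ((a :∙ b) :∙ (c :∙ d)) :∙ ((p :∙ q) :∙ (r :∙ t))) refl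
                   (σ (sgn₁ x u)) (σ (sgn₁ u y)) (σ (sgn₁ y v)) (σ (sgn₁ v x)) p q r t ⟩
            ((σ (sgn₁ x u) ∙ σ (sgn₁ u y)) ∙ (σ (sgn₁ y v) ∙ σ (sgn₁ v x))) ∙ ((p ∙ q) ∙ (r ∙ t))
              ≡⟨ cong (_∙ ((p ∙ q) ∙ (r ∙ t))) (trans (sym (σ-*₄ (sgn₁ x u) (sgn₁ u y) (sgn₁ y v) (sgn₁ v x)))
                   (trans (cong σ (sgn₁-flips u≢x u≢y v≢x v≢y)) (σ-*₄ (sgn₁ y u) (sgn₁ v y) (sgn₁ x v) (sgn₁ u x)))) ⟩
            ((σ (sgn₁ y u) ∙ σ (sgn₁ v y)) ∙ (σ (sgn₁ x v) ∙ σ (sgn₁ u x))) ∙ ((p ∙ q) ∙ (r ∙ t))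
              ≡⟨ solve 8 (λ a b c d p q r t →
                   ((a :∙ b) :∙ (c :∙ d)) :∙ ((p :∙ q) :∙ (r :∙ t)) ⊜
                   ((a :∙ r) :∙ (b :∙ t)) :∙ ((c :∙ p) :∙ (d :∙ q))) refl
                   (σ (sgn₁ y u)) (σ (sgn₁ v y)) (σ (sgn₁ x v)) (σ (sgn₁ u x)) p q r t ⟩
            ((σ (sgn₁ y u) ∙ r) ∙ (σ (sgn₁ v y) ∙ t)) ∙ ((σ (sgn₁ x v) ∙ p) ∙ (σ (sgn₁ u x) ∙ q))
              ≡⟨ cong₂ _∙_ (cong₂ _∙_ (signed-⊕ T y u∉ u∥v) (signed-⊕ T v y∉ refl))
                           (cong₂ _∙_ (signed-⊕ T x v∉ refl) (signed-⊕ T u x∉ x∥y)) ⟨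
            (signed η (T ⊕ u) y ∙ signed η (T ⊕ y) v) ∙ (signed η (T ⊕ v) x ∙ signed η (T ⊕ x) u) ∎
          where
          u∥v : completion (T ⊕ u) ≡ completion (T ⊕ v)
          u∥v = parallel u∉ u≢v v∉ x∉ u≢x ux vx ¬uv
          x∥y : completion (T ⊕ x) ≡ completion (T ⊕ y)
          x∥y = parallel x∉ x≢y y∉ u∉ (u≢x ∘ sym) (subst IsBasis (⊕-comm T u x) ux)
                  (subst IsBasis (⊕-comm T u y) uy) ¬xy
          open ≡-Reasoning
          p q r t : H*
          p = σ (sgn x T) ∙ η (completion (T ⊕ v)) x
          q = σ (sgn u T) ∙ η (completion (T ⊕ y)) u
          r = σ (sgn y T) ∙ η (completion (T ⊕ v)) y
          t = σ (sgn v T) ∙ η (completion (T ⊕ y)) v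
          σ-*₄ : ∀ a b c d → σ ((a Sign.* b) Sign.* (c Sign.* d)) ≡ (σ a ∙ σ b) ∙ (σ c ∙ σ d)
          σ-*₄ a b c d = trans (σ-* (a Sign.* b) (c Sign.* d)) (cong₂ _∙_ (σ-* a b) (σ-* c d))

    private
      Φ : Subset n → H*
      Φ = Pot.potential (signed η)

      unsign : ∀ p q {a b c d} → (σ p ∙ a) ∙ c ≡ (σ q ∙ b) ∙ d → a ∙ (σ q ∙ c) ≡ b ∙ (σ p ∙ d)
      unsign p q {a} {b} {c} {d} e = begin
        a ∙ (σ q ∙ c)                     ≡⟨ σ-cancel p _ ⟨
        σ p ∙ (σ p ∙ (a ∙ (σ q ∙ c)))     ≡⟨ solve 4 (λ p q a c → p :∙ (p :∙ (a :∙ (q :∙ c))) ⊜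
                                               (p :∙ q) :∙ ((p :∙ a) :∙ c)) refl (σ p) (σ q) a c ⟩
        (σ p ∙ σ q) ∙ ((σ p ∙ a) ∙ c)     ≡⟨ cong ((σ p ∙ σ q) ∙_) e ⟩
        (σ p ∙ σ q) ∙ ((σ q ∙ b) ∙ d)     ≡⟨ solve 4 (λ p q b d → (p :∙ q) :∙ ((q :∙ b) :∙ d) ⊜
                                               q :∙ (q :∙ (b :∙ (p :∙ d)))) refl (σ p) (σ q) b d ⟩
        σ q ∙ (σ q ∙ (b ∙ (σ p ∙ d)))     ≡⟨ σ-cancel q _ ⟩
        b ∙ (σ p ∙ d)                     ∎
        where open ≡-Reasoning

    potential-matches : Matches η (Pot.potential (signed η))
    potential-matches {J} sp@(refl , _) = proportional λ {x} {y} x∈ y∈ →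
      unsign (sgn x J) (sgn y J) {η (completion J) x} {η (completion J) y} {Φ (J ⊕ y)} {Φ (J ⊕ x)}
        (Pot.potential-edge coherent (∈-spans⁻ sp x∈) (∈-spans⁻ sp y∈))

    potential-matches* : P*.Matches γ* (Pot.potential (signed η) ∘ ∁)
    potential-matches* {J} sp@(refl , _) = proportional λ {x} {y} x∈ y∈ →
      let x∉J , bx = N*.∈-spans⁻ sp x∈
          y∉J , by = N*.∈-spans⁻ sp y∈
          e = Pot.potential-edge* coherent {∁ J} {x} {y} (x∉p⇒x∈∁p x∉J) (x∉p⇒x∈∁p y∉J)
                (subst IsBasis (∁-⊕ J x) bx) (subst IsBasis (∁-⊕ J y) by)
      in unsign (sgn x J) (sgn y J) {γ* (N*.completion J) x} {γ* (N*.completion J) y}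
           {Φ (∁ (J ⊕ y))} {Φ (∁ (J ⊕ x))}
           (subst₂ (λ A B → signed* J x ∙ Φ A ≡ signed* J y ∙ Φ B) (sym (∁-⊕ J y)) (sym (∁-⊕ J x))
             (subst (λ T → signed* T x ∙ Φ (∁ J ⊖ y) ≡ signed* T y ∙ Φ (∁ J ⊖ x)) (∁-involutive J) e))

-- Listings of subsets and their signs.

entries-∷ : ∀ x (xs : Vec (Fin n) k) → entries (x ∷ xs) ≡ entries xs ⊕ x
entries-∷ x xs = trans (∪-comm ⁅ x ⁆ (entries xs)) (∪-⁅⁆ (entries xs) x)

lookup∈entries : ∀ (xs : Vec (Fin n) k) i → lookup xs i ∈ entries xs
lookup∈entries (x ∷ xs) zero    = subst (x ∈_) (sym (entries-∷ x xs)) (x∈S⊕x (entries xs) x)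
lookup∈entries (x ∷ xs) (suc i) =
  subst (lookup xs i ∈_) (sym (entries-∷ x xs)) (∈-⊕⁺ x (lookup∈entries xs i))

∈entries⁻ : ∀ (xs : Vec (Fin n) k) {z} → z ∈ entries xs → ∃ λ i → lookup xs i ≡ z
∈entries⁻ []       z∈ = contradiction z∈ ∉⊥
∈entries⁻ (x ∷ xs) {z} z∈ with z ≟ x
... | yes refl = zero , refl
... | no  z≢x  = let i , eq = ∈entries⁻ xs (∈-⊕⁻ (entries xs) x (subst (z ∈_) (entries-∷ x xs) z∈) z≢x)
                 in suc i , eq

∉entries⁺ : ∀ {x} {xs : Vec (Fin n) k} → All (x ≢_) xs → x ∉ entries xs
∉entries⁺ {xs = xs} x≢ x∈ = let i , eq = ∈entries⁻ xs x∈ in lookup⁺ x≢ i (sym eq)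

∉entries⁻ : ∀ {x} (xs : Vec (Fin n) k) → x ∉ entries xs → All (x ≢_) xs
∉entries⁻ []       _  = []
∉entries⁻ (y ∷ xs) x∉ =
  (λ { refl → x∉ (lookup∈entries (y ∷ xs) zero) }) ∷
  ∉entries⁻ xs (x∉ ∘ subst (_ ∈_) (sym (entries-∷ y xs)) ∘ ∈-⊕⁺ y)

∣entries∣ : ∀ {xs : Vec (Fin n) k} → Unique xs → ∣ entries xs ∣ ≡ k
∣entries∣ {n} []     = ∣⊥∣≡0 n
∣entries∣ {xs = x ∷ xs} (x≢ ∷ xs!) = trans (cong ∣_∣ (entries-∷ x xs))
  (trans (∣⊕∣ (entries xs) (∉entries⁺ x≢)) (cong suc (∣entries∣ xs!)))

∣entries∣≤ : ∀ (xs : Vec (Fin n) k) → ∣ entries xs ∣ ≤ k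
∣entries∣≤ {n} []   = ℕ.≤-reflexive (∣⊥∣≡0 n)
∣entries∣≤ (x ∷ xs) = ℕ.≤-trans (ℕ.≤-reflexive (cong ∣_∣ (entries-∷ x xs)))
  (ℕ.≤-trans (∣⊕∣≤ (entries xs) x) (s≤s (∣entries∣≤ xs)))

∣entries∣⇒unique : ∀ {xs : Vec (Fin n) k} → ∣ entries xs ∣ ≡ k → Unique xs
∣entries∣⇒unique {xs = []}             _  = []
∣entries∣⇒unique {k = suc k} {xs = x ∷ xs} eq with x ∈? entries xs
... | yes x∈ = contradiction (∣entries∣≤ xs)
                 (ℕ.<⇒≱ (ℕ.≤-reflexive (sym (trans (cong ∣_∣ (sym (trans (entries-∷ x xs) (⊕-absorb x∈)))) eq))))
... | no  x∉ = ∉entries⁻ xs x∉ ∷ ∣entries∣⇒unique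
                 (ℕ.suc-injective (trans (sym (∣⊕∣ (entries xs) x∉)) (trans (cong ∣_∣ (sym (entries-∷ x xs))) eq)))

entries-removeAt-⊕ : ∀ (xs : Vec (Fin n) (suc k)) i → entries xs ≡ entries (removeAt xs i) ⊕ lookup xs i
entries-removeAt-⊕ (x ∷ xs)         zero    = entries-∷ x xs
entries-removeAt-⊕ (x ∷ xs@(_ ∷ _)) (suc i) = begin
  entries (x ∷ xs)                                  ≡⟨ entries-∷ x xs ⟩
  entries xs ⊕ x                                    ≡⟨ cong (_⊕ x) (entries-removeAt-⊕ xs i) ⟩
  entries (removeAt xs i) ⊕ lookup xs i ⊕ x         ≡⟨ ⊕-comm (entries (removeAt xs i)) _ x ⟩
  entries (removeAt xs i) ⊕ x ⊕ lookup xs i         ≡⟨ cong (_⊕ lookup xs i) (entries-∷ x (removeAt xs i)) ⟨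
  entries (x ∷ removeAt xs i) ⊕ lookup xs i         ∎
  where open ≡-Reasoning

lookup∉removeAt : ∀ {xs : Vec (Fin n) (suc k)} → Unique xs → ∀ i → lookup xs i ∉ entries (removeAt xs i)
lookup∉removeAt {k = k} {xs} xs! i x∈ = contradiction (∣entries∣≤ (removeAt xs i))
  (ℕ.<⇒≱ (ℕ.≤-reflexive (sym (trans
    (cong ∣_∣ (trans (sym (⊕-absorb x∈)) (sym (entries-removeAt-⊕ xs i)))) (∣entries∣ xs!)))))

entries-removeAt : ∀ {xs : Vec (Fin n) (suc k)} → Unique xs → ∀ i →
                   entries (removeAt xs i) ≡ entries xs ⊖ lookup xs i
entries-removeAt {xs = xs} xs! i =
  trans (sym (⊕-⊖ (lookup∉removeAt xs! i))) (cong (_⊖ lookup xs i) (sym (entries-removeAt-⊕ xs i)))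

removeAt-≔ : ∀ (xs : Vec (Fin n) (suc k)) i {x} → removeAt (xs [ i ]≔ x) i ≡ removeAt xs i
removeAt-≔ (y ∷ xs)         zero    = refl
removeAt-≔ (y ∷ z ∷ xs)     (suc zero)    = refl
removeAt-≔ (y ∷ z ∷ xs)     (suc (suc i)) = cong (y ∷_) (removeAt-≔ (z ∷ xs) (suc i))

entries-≔ : ∀ (xs : Vec (Fin n) (suc k)) i x → entries (xs [ i ]≔ x) ≡ entries (removeAt xs i) ⊕ x
entries-≔ xs i x = trans (entries-removeAt-⊕ (xs [ i ]≔ x) i)
  (cong₂ (λ ys y → entries ys ⊕ y) (removeAt-≔ xs i) (lookup∘updateAt i xs))

unique-head : ∀ {x} {xs : Vec (Fin n) k} → Unique (x ∷ xs) → x ∉ entries xs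
unique-head (x≢ ∷ _) = ∉entries⁺ x≢

unique-tail : ∀ {x} {xs : Vec (Fin n) k} → Unique (x ∷ xs) → Unique xs
unique-tail (_ ∷ xs!) = xs!

open CommutativeMonoidSolver Sign.*-commutativeMonoid
  using () renaming (solve to solveˢ; _⊜_ to _⊜ˢ_; _⊕_ to _:*_)

-- For distinct entries, the sign of the permutation that sorts the listing, by inversions: an entry
-- counts the later entries below it.
sgnᵛ : Vec (Fin n) k → Sign
sgnᵛ []       = Sign.+
sgnᵛ (x ∷ xs) = sgn x (entries xs) Sign.* sgnᵛ xs

parity : ℕ → Sign
parity zero    = Sign.+
parity (suc k) = Sign.- Sign.* parity k

-- Moving the entry at `i` to the front costs `toℕ i` transpositions, and there it has one inversion
-- with each smaller entry. This turns the alternating signs of a Plücker relation into the signs of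
-- `gpTerm`.
sgnᵛ-removeAt : ∀ {xs : Vec (Fin n) (suc k)} → Unique xs → ∀ i →
                parity (toℕ i) Sign.* sgnᵛ (removeAt xs i) ≡
                sgnᵛ xs Sign.* sgn (lookup xs i) (entries xs)
sgnᵛ-removeAt {xs = x ∷ xs} (x≢ ∷ xs!) zero = sym (begin
  (f Sign.* l) Sign.* sgn x (entries (x ∷ xs))  ≡⟨ cong (λ t → (f Sign.* l) Sign.* sgn x t) (entries-∷ x xs) ⟩
  (f Sign.* l) Sign.* sgn x (entries xs ⊕ x)    ≡⟨ cong ((f Sign.* l) Sign.*_) (sgn-self-⊕ x (entries xs)) ⟩
  (f Sign.* l) Sign.* f                         ≡⟨ solveˢ 2 (λ f l → (f :* l) :* f ⊜ˢ (f :* f) :* l) refl f l ⟩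
  (f Sign.* f) Sign.* l                         ≡⟨ cong (Sign._* l) (Sign.s*s≡+ f) ⟩
  l                                             ∎)
  where
  open ≡-Reasoning
  f l : Sign
  f = sgn x (entries xs)
  l = sgnᵛ xs
sgnᵛ-removeAt {xs = x ∷ xs@(_ ∷ _)} (x≢ ∷ xs!) (suc i) = begin
  (Sign.- Sign.* p) Sign.* (f Sign.* r)
    ≡⟨ solveˢ 4 (λ m p f r → (m :* p) :* (f :* r) ⊜ˢ (m :* f) :* (p :* r)) refl Sign.- p f r ⟩
  (Sign.- Sign.* f) Sign.* (p Sign.* r)
    ≡⟨ cong ((Sign.- Sign.* f) Sign.*_) (sgnᵛ-removeAt xs! i) ⟩
  (Sign.- Sign.* f) Sign.* (l Sign.* m)
    ≡⟨ cong (Sign._* ((Sign.- Sign.* f) Sign.* (l Sign.* m))) (Sign.s*s≡+ e) ⟨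
  (e Sign.* e) Sign.* ((Sign.- Sign.* f) Sign.* (l Sign.* m))
    ≡⟨ solveˢ 5 (λ e n f l m → (e :* e) :* ((n :* f) :* (l :* m)) ⊜ˢ
                              (((n :* e) :* f) :* l) :* (e :* m)) refl e Sign.- f l m ⟩
  (((Sign.- Sign.* e) Sign.* f) Sign.* l) Sign.* (e Sign.* m)
    ≡⟨ cong₂ (λ u v → (u Sign.* l) Sign.* v) sgn-x sgn-y ⟨
  (sgn x (entries xs) Sign.* l) Sign.* sgn y (entries (x ∷ xs)) ∎
  where
  open ≡-Reasoning
  y : Fin _
  y = lookup xs i
  R : Subset _
  R = entries (removeAt xs i)
  x∉ : x ∉ entries xs
  x∉ = ∉entries⁺ x≢
  p f r l m e : Sign
  p = parity (toℕ i)
  f = sgn x R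
  r = sgnᵛ (removeAt xs i)
  l = sgnᵛ xs
  m = sgn y (entries xs)
  e = sgn₁ y x
  sgn-x : sgn x (entries xs) ≡ (Sign.- Sign.* e) Sign.* f
  sgn-x = trans (cong (sgn x) (entries-removeAt-⊕ xs i)) (trans (sgn-⊕ x R (lookup∉removeAt xs! i))
    (cong (Sign._* f) (sgn₁-flip (∈∧∉⇒≢ (lookup∈entries xs i) x∉ ∘ sym))))
  sgn-y : sgn y (entries (x ∷ xs)) ≡ e Sign.* m
  sgn-y = trans (cong (sgn y) (entries-∷ x xs)) (sgn-⊕ y (entries xs) x∉)

entries-swap₀ : ∀ x (xs : Vec (Fin n) (suc k)) j → entries (lookup xs j ∷ xs [ j ]≔ x) ≡ entries (x ∷ xs)
entries-swap₀ x xs j = begin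
  entries (y ∷ xs [ j ]≔ x)            ≡⟨ entries-∷ y (xs [ j ]≔ x) ⟩
  entries (xs [ j ]≔ x) ⊕ y            ≡⟨ cong (_⊕ y) (entries-≔ xs j x) ⟩
  entries (removeAt xs j) ⊕ x ⊕ y      ≡⟨ ⊕-comm (entries (removeAt xs j)) x y ⟩
  entries (removeAt xs j) ⊕ y ⊕ x      ≡⟨ cong (_⊕ x) (entries-removeAt-⊕ xs j) ⟨
  entries xs ⊕ x                       ≡⟨ entries-∷ x xs ⟨
  entries (x ∷ xs)                     ∎
  where
  open ≡-Reasoning
  y = lookup xs j

module _ {x} {xs : Vec (Fin n) (suc k)} (xxs! : Unique (x ∷ xs)) (j : Fin (suc k)) where
  private
    y : Fin n
    y = lookup xs j
    R : Subset n
    R = entries (removeAt xs j)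
    xs! : Unique xs
    xs! = unique-tail xxs!
    x∉ : x ∉ entries xs
    x∉ = unique-head xxs!
    y∉R : y ∉ R
    y∉R = lookup∉removeAt xs! j
    x∉R : x ∉ R
    x∉R = x∉ ∘ subst (x ∈_) (sym (entries-removeAt-⊕ xs j)) ∘ ∈-⊕⁺ y
    x≢y : x ≢ y
    x≢y = ∈∧∉⇒≢ (lookup∈entries xs j) x∉ ∘ sym

  unique-swap₀ : Unique (lookup xs j ∷ xs [ j ]≔ x)
  unique-swap₀ = ∣entries∣⇒unique (trans (cong ∣_∣ (entries-swap₀ x xs j)) (∣entries∣ xxs!))

  sgnᵛ-swap₀ : sgnᵛ (lookup xs j ∷ xs [ j ]≔ x) ≡ Sign.- Sign.* sgnᵛ (x ∷ xs)
  sgnᵛ-swap₀ = begin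
    sgn y (entries ys) Sign.* q
      ≡⟨ cong (Sign._* q) (trans (cong (sgn y) (entries-≔ xs j x)) (sgn-⊕ y R x∉R)) ⟩
    (e Sign.* p) Sign.* q
      ≡⟨ cong (Sign._* ((e Sign.* p) Sign.* q)) (Sign.s*s≡+ c) ⟨
    (c Sign.* c) Sign.* ((e Sign.* p) Sign.* q)
      ≡⟨ solveˢ 4 (λ c e p q → (c :* c) :* ((e :* p) :* q) ⊜ˢ (e :* (c :* p)) :* (q :* c)) refl c e p q ⟩
    (e Sign.* (c Sign.* p)) Sign.* (q Sign.* c)
      ≡⟨ cong ((e Sign.* (c Sign.* p)) Sign.*_) same ⟨
    (e Sign.* (c Sign.* p)) Sign.* (b Sign.* p)
      ≡⟨ solveˢ 4 (λ c e p b → (e :* (c :* p)) :* (b :* p) ⊜ˢ (p :* p) :* ((e :* c) :* b)) refl c e p b ⟩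
    (p Sign.* p) Sign.* ((e Sign.* c) Sign.* b)
      ≡⟨ cong (Sign._* ((e Sign.* c) Sign.* b)) (Sign.s*s≡+ p) ⟩
    (e Sign.* c) Sign.* b
      ≡⟨ cong (λ t → (t Sign.* c) Sign.* b) (sgn₁-flip (x≢y ∘ sym)) ⟩
    ((Sign.- Sign.* sgn₁ x y) Sign.* c) Sign.* b
      ≡⟨ solveˢ 4 (λ m e c b → ((m :* e) :* c) :* b ⊜ˢ m :* ((e :* c) :* b)) refl Sign.- (sgn₁ x y) c b ⟩
    Sign.- Sign.* ((sgn₁ x y Sign.* c) Sign.* b)
      ≡⟨ cong (λ t → Sign.- Sign.* (t Sign.* b))
           (trans (cong (sgn x) (entries-removeAt-⊕ xs j)) (sgn-⊕ x R y∉R)) ⟨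
    Sign.- Sign.* (sgn x (entries xs) Sign.* b) ∎
    where
    open ≡-Reasoning
    ys : Vec (Fin n) (suc k)
    ys = xs [ j ]≔ x
    e p q c b : Sign
    e = sgn₁ y x
    p = sgn y R
    c = sgn x R
    q = sgnᵛ ys
    b = sgnᵛ xs
    -- The tails before and after the swap agree once place `j` is removed. Comparing their signs
    -- through what is left avoids counting the entries in between.
    same : b Sign.* p ≡ q Sign.* c
    same = trans (cong (b Sign.*_) (sym (trans (cong (sgn y) (entries-removeAt-⊕ xs j)) (sgn-self-⊕ y R))))
      (trans (sym (sgnᵛ-removeAt xs! j))
        (trans (cong (λ t → parity (toℕ j) Sign.* sgnᵛ t) (sym (removeAt-≔ xs j)))
          (trans (sgnᵛ-removeAt (unique-tail unique-swap₀) j)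
            (cong (q Sign.*_) (trans (cong₂ sgn (lookup∘updateAt j xs) (entries-≔ xs j x))
              (sgn-self-⊕ x R))))))

transpose : Vec (Fin n) k → Fin k → Fin k → Vec (Fin n) k
transpose xs i j = xs [ i ]≔ lookup xs j [ j ]≔ lookup xs i

entries-transpose : ∀ (xs : Vec (Fin n) k) {i j} → i ≢ j → entries (transpose xs i j) ≡ entries xs
entries-transpose (x ∷ xs)         {zero}  {zero}  i≢j = contradiction refl i≢j
entries-transpose (x ∷ xs@(_ ∷ _)) {zero}  {suc j} i≢j = entries-swap₀ x xs j
entries-transpose (x ∷ xs@(_ ∷ _)) {suc i} {zero}  i≢j = entries-swap₀ x xs i
entries-transpose (x ∷ xs)         {suc i} {suc j} i≢j = cong (⁅ x ⁆ ∪_) (entries-transpose xs (i≢j ∘ cong suc))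

sgnᵛ-transpose : ∀ {xs : Vec (Fin n) k} → Unique xs → ∀ {i j} → i ≢ j →
                 sgnᵛ (transpose xs i j) ≡ Sign.- Sign.* sgnᵛ xs
sgnᵛ-transpose {xs = x ∷ xs}         xs! {zero}  {zero}  i≢j = contradiction refl i≢j
sgnᵛ-transpose {xs = x ∷ xs@(_ ∷ _)} xs! {zero}  {suc j} i≢j = sgnᵛ-swap₀ xs! j
sgnᵛ-transpose {xs = x ∷ xs@(_ ∷ _)} xs! {suc i} {zero}  i≢j = sgnᵛ-swap₀ xs! i
sgnᵛ-transpose {xs = x ∷ xs}         (_ ∷ xs!) {suc i} {suc j} i≢j = trans
  (cong₂ (λ S p → sgn x S Sign.* p) (entries-transpose xs (i≢j ∘ cong suc))
                                    (sgnᵛ-transpose xs! (i≢j ∘ cong suc)))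
  (solveˢ 3 (λ f m p → f :* (m :* p) ⊜ˢ m :* (f :* p)) refl (sgn x (entries xs)) Sign.- (sgnᵛ xs))

sorted : (S : Subset n) → Vec (Fin n) ∣ S ∣
sorted []            = []
sorted (inside  ∷ S) = zero ∷ Vec.map suc (sorted S)
sorted (outside ∷ S) = Vec.map suc (sorted S)

entries-map-suc : ∀ (xs : Vec (Fin n) k) → entries (Vec.map suc xs) ≡ outside ∷ entries xs
entries-map-suc []       = refl
entries-map-suc (x ∷ xs) = cong (⁅ suc x ⁆ ∪_) (entries-map-suc xs)

entries-sorted : ∀ (S : Subset n) → entries (sorted S) ≡ S
entries-sorted []            = refl
entries-sorted (inside  ∷ S) = trans (cong (⁅ zero ⁆ ∪_) (entries-map-suc (sorted S)))
  (cong (inside ∷_) (trans (∪-identityˡ (entries (sorted S))) (entries-sorted S)))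
entries-sorted (outside ∷ S) = trans (entries-map-suc (sorted S)) (cong (outside ∷_) (entries-sorted S))

listing : (S : Subset n) → ∣ S ∣ ≡ k → Vec (Fin n) k
listing S refl = sorted S

entries-listing : ∀ (S : Subset n) (eq : ∣ S ∣ ≡ k) → entries (listing S eq) ≡ S
entries-listing S refl = entries-sorted S

unique-listing : ∀ (S : Subset n) (eq : ∣ S ∣ ≡ k) → Unique (listing S eq)
unique-listing S eq = ∣entries∣⇒unique (trans (cong ∣_∣ (entries-listing S eq)) eq)

-- Alternating functions as functions on bases.

module Alternation (H : Hyperfield a) {n : ℕ} where
  open Values H

  -‿involutive : ∀ x → - (- x) ≡ x
  -‿involutive x = sym (-‿unique (proj₁ (⊞-comm x (- x)) (-‿inverse x)))

  -‿0# : - 0# ≡ 0#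
  -‿0# = trans (-‿-1* 0#) (zeroʳ (↑ -1*))

  σ-⊙ : ∀ p q x → ↑ σ (p Sign.* q) ⊙ x ≡ ↑ σ p ⊙ (↑ σ q ⊙ x)
  σ-⊙ p q x = trans (cong (λ t → ↑ t ⊙ x) (σ-* p q)) (⊙-assoc _ _ x)

  [-1]^≡σ : ∀ k → [-1]^ k ≡ ↑ σ (parity k)
  [-1]^≡σ zero    = refl
  [-1]^≡σ (suc k) = trans (cong (↑ -1* ⊙_) ([-1]^≡σ k)) (cong ↑_ (sym (σ-* Sign.- (parity k))))

  Swapping : (Vec (Fin n) k → Carrier) → Set a
  Swapping φ = ∀ xs {i j} → i ≢ j → φ (transpose xs i j) ≡ - φ xs

  -- The product of a value and the sign of its listing depends on the listed set alone. One
  -- transposition brings the head of `ys` to the front of `xs`; then the tails are compared with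
  -- this head fixed.
  alternating-listing : ∀ {φ : Vec (Fin n) k → Carrier} → Swapping φ →
    ∀ {xs ys} → Unique xs → Unique ys → entries xs ≡ entries ys →
    φ xs ≡ ↑ σ (sgnᵛ xs) ⊙ (↑ σ (sgnᵛ ys) ⊙ φ ys)
  alternating-listing {φ = φ} swapping {[]} {[]} _ _ _ = sym (trans (⊙-identityˡ _) (⊙-identityˡ _))
  alternating-listing {k = suc k} {φ} swapping {x ∷ xs} {y ∷ ys} xs! ys! eq = by-head (x ≟ y)
    where
    same-head : ∀ {xs} → Unique (y ∷ xs) → entries (y ∷ xs) ≡ entries (y ∷ ys) →
                φ (y ∷ xs) ≡ ↑ σ (sgnᵛ (y ∷ xs)) ⊙ (↑ σ (sgnᵛ (y ∷ ys)) ⊙ φ (y ∷ ys))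
    same-head {xs} xs! eq = begin
      φ (y ∷ xs)
        ≡⟨ alternating-listing {φ = λ zs → φ (y ∷ zs)}
             (λ zs i≢j → swapping (y ∷ zs) (i≢j ∘ suc-injective))
             (unique-tail xs!) (unique-tail ys!) tails ⟩
      ↑ σ (sgnᵛ xs) ⊙ (↑ σ (sgnᵛ ys) ⊙ φ (y ∷ ys))
        ≡⟨ ⊙-identityˡ _ ⟨
      ↑ 1* ⊙ (↑ σ (sgnᵛ xs) ⊙ (↑ σ (sgnᵛ ys) ⊙ φ (y ∷ ys)))
        ≡⟨ cong (λ t → ↑ t ⊙ (↑ σ (sgnᵛ xs) ⊙ (↑ σ (sgnᵛ ys) ⊙ φ (y ∷ ys)))) (σ-square f) ⟨
      (↑ σ f ⊙ ↑ σ f) ⊙ (↑ σ (sgnᵛ xs) ⊙ (↑ σ (sgnᵛ ys) ⊙ φ (y ∷ ys)))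
        ≡⟨ trans (cong ((↑ σ f ⊙ ↑ σ f) ⊙_) (sym (⊙-assoc _ _ _))) (trans (sym (⊙-assoc _ _ _))
             (trans (cong (_⊙ φ (y ∷ ys)) (⊙-interchange _ _ _ _)) (⊙-assoc _ _ _))) ⟩
      (↑ σ f ⊙ ↑ σ (sgnᵛ xs)) ⊙ ((↑ σ f ⊙ ↑ σ (sgnᵛ ys)) ⊙ φ (y ∷ ys))
        ≡⟨ cong₂ (λ p q → ↑ p ⊙ (↑ q ⊙ φ (y ∷ ys))) (sym (σ-* f (sgnᵛ xs))) (sym (σ-* f (sgnᵛ ys))) ⟩
      ↑ σ (f Sign.* sgnᵛ xs) ⊙ (↑ σ (f Sign.* sgnᵛ ys) ⊙ φ (y ∷ ys))
        ≡⟨ cong (λ S → ↑ σ (sgn y S Sign.* sgnᵛ xs) ⊙ (↑ σ (f Sign.* sgnᵛ ys) ⊙ φ (y ∷ ys))) tails ⟨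
      ↑ σ (sgnᵛ (y ∷ xs)) ⊙ (↑ σ (sgnᵛ (y ∷ ys)) ⊙ φ (y ∷ ys)) ∎
      where
      open ≡-Reasoning
      f : Sign
      f = sgn y (entries ys)
      tails : entries xs ≡ entries ys
      tails = trans (sym (⊕-⊖ (unique-head xs!))) (trans (cong (_⊖ y)
        (trans (sym (entries-∷ y xs)) (trans eq (entries-∷ y ys)))) (⊕-⊖ (unique-head ys!)))

    by-head : Dec (x ≡ y) → φ (x ∷ xs) ≡ ↑ σ (sgnᵛ (x ∷ xs)) ⊙ (↑ σ (sgnᵛ (y ∷ ys)) ⊙ φ (y ∷ ys))
    by-head (yes refl) = same-head xs! eq
    by-head (no x≢y) with j , eqⱼ ← ∈entries⁻ xs (∈-⊕⁻ (entries xs) x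
        (subst (y ∈_) (trans (sym eq) (entries-∷ x xs)) (lookup∈entries (y ∷ ys) zero)) (x≢y ∘ sym))
      = swapped j eqⱼ
      where
      swapped : ∀ j → lookup xs j ≡ y →
                φ (x ∷ xs) ≡ ↑ σ (sgnᵛ (x ∷ xs)) ⊙ (↑ σ (sgnᵛ (y ∷ ys)) ⊙ φ (y ∷ ys))
      swapped j eqⱼ = begin
        φ (x ∷ xs)                ≡⟨ -‿involutive _ ⟨
        - (- φ (x ∷ xs))          ≡⟨ cong -_ (swapping (x ∷ xs) {zero} {suc j} λ ()) ⟨
        - φ (lookup xs j ∷ zs)    ≡⟨ cong (λ t → - φ (t ∷ zs)) eqⱼ ⟩
        - φ (y ∷ zs)              ≡⟨ cong -_ (same-head (subst (λ t → Unique (t ∷ zs)) eqⱼ unique-zs)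
                                       (trans (cong (λ t → entries (t ∷ zs)) (sym eqⱼ)) (trans entries-zs eq))) ⟩
        - (↑ σ (sgnᵛ (y ∷ zs)) ⊙ r)
          ≡⟨ -‿-1* _ ⟩
        ↑ -1* ⊙ (↑ σ (sgnᵛ (y ∷ zs)) ⊙ r)
          ≡⟨ σ-⊙ Sign.- (sgnᵛ (y ∷ zs)) r ⟨
        ↑ σ (Sign.- Sign.* sgnᵛ (y ∷ zs)) ⊙ r
          ≡⟨ cong (λ t → ↑ σ t ⊙ r) (trans (cong (λ t → Sign.- Sign.* sgnᵛ (t ∷ zs)) (sym eqⱼ))
               (trans (cong (Sign.- Sign.*_) sgn-zs) (Sign.opposite-involutive _))) ⟩
        ↑ σ (sgnᵛ (x ∷ xs)) ⊙ r   ∎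
        where
        open ≡-Reasoning
        zs : Vec (Fin n) k
        zs = xs [ j ]≔ x
        r : Carrier
        r = ↑ σ (sgnᵛ (y ∷ ys)) ⊙ φ (y ∷ ys)
        entries-zs : entries (lookup xs j ∷ zs) ≡ entries (x ∷ xs)
        entries-zs = entries-transpose (x ∷ xs) {zero} {suc j} λ ()
        unique-zs : Unique (lookup xs j ∷ zs)
        unique-zs = ∣entries∣⇒unique (trans (cong ∣_∣ entries-zs) (∣entries∣ xs!))
        sgn-zs : sgnᵛ (lookup xs j ∷ zs) ≡ Sign.- Sign.* sgnᵛ (x ∷ xs)
        sgn-zs = sgnᵛ-transpose xs! {zero} {suc j} λ ()

module BasisFunctions (H : Hyperfield a) {n d : ℕ} (M : Matroid n) (rank : HasRank M d) (• : Strength) where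
  open Values H
  open Cocircuits M
  open Matching H M
  open Alternation H {n}
  private module GP = GrassmannPlücker H M d •
  open GP using (GPFunction; PlückerRelations)

  Represents : (Vec (Fin n) d → Carrier) → (Subset n → H*) → Set a
  Represents φ Φ = (∀ xs → IsBasis (entries xs) → φ xs ≡ ↑ (σ (sgnᵛ xs) ∙ Φ (entries xs))) ×
                   (∀ xs → ¬ IsBasis (entries xs) → φ xs ≡ 0#)

  basis⇒unique : ∀ {xs : Vec (Fin n) d} → IsBasis (entries xs) → Unique xs
  basis⇒unique b = ∣entries∣⇒unique (rank b)

  module _ (φ : Vec (Fin n) d → Carrier) (φ≢0 : ∀ xs → IsBasis (entries xs) → φ xs ≢ 0#) where

    -- Available for any function that is nonzero on the bases, whether or not it satisfies Plücker
    -- relations; continuity will be tested on all such functions.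
    onBases : Subset n → H*
    onBases B with isBasis? B
    ... | yes b = let xs = listing B (rank b)
                  in σ (sgnᵛ xs) ∙ (φ xs , φ≢0 xs (subst IsBasis (sym (entries-listing B (rank b))) b))
    ... | no  _ = 1*

  gp-represents : ∀ (f : GPFunction) → Represents (GPFunction.φ f) (onBases (GPFunction.φ f) (GPFunction.basis⇒≢0 f))
  gp-represents f = onBasis , GPFunction.nonbasis⇒≡0 f
    where
    open GPFunction f
    onBasis : ∀ xs → IsBasis (entries xs) → φ xs ≡ ↑ (σ (sgnᵛ xs) ∙ onBases φ basis⇒≢0 (entries xs))
    onBasis xs b with isBasis? (entries xs)
    ... | yes b′ = alternating-listing swapping (basis⇒unique b)
                     (unique-listing (entries xs) (rank b′)) (sym (entries-listing (entries xs) (rank b′)))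
    ... | no  ¬b = contradiction b ¬b

  module _ (Φ : Subset n → H*) where

    ordered : Vec (Fin n) d → Carrier
    ordered xs = if does (isBasis? (entries xs)) then ↑ (σ (sgnᵛ xs) ∙ Φ (entries xs)) else 0#

    ordered-represents : Represents ordered Φ
    ordered-represents = onBasis , offBasis
      where
      onBasis : ∀ xs → IsBasis (entries xs) → ordered xs ≡ ↑ (σ (sgnᵛ xs) ∙ Φ (entries xs))
      onBasis xs b rewrite dec-true (isBasis? (entries xs)) b = refl
      offBasis : ∀ xs → ¬ IsBasis (entries xs) → ordered xs ≡ 0#
      offBasis xs ¬b rewrite dec-false (isBasis? (entries xs)) ¬b = refl

  module _ {φ : Vec (Fin n) d → Carrier} {Φ : Subset n → H*} (rep : Represents φ Φ) where

    represents⇒alternating : GP.Alternating φ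
    represents⇒alternating = record
      { vanishing = λ xs i≢j eq → proj₂ rep xs λ b → i≢j (lookup-injective (basis⇒unique {xs} b) _ _ eq)
      ; swapping  = swapping
      }
      where
      swapping : Swapping φ
      swapping xs {i} {j} i≢j with isBasis? (entries xs)
      ... | yes b = begin
        φ (transpose xs i j)
          ≡⟨ proj₁ rep _ (subst IsBasis (sym entries≡) b) ⟩
        ↑ (σ (sgnᵛ (transpose xs i j)) ∙ Φ (entries (transpose xs i j)))
          ≡⟨ cong₂ (λ p S → ↑ (σ p ∙ Φ S)) (sgnᵛ-transpose (basis⇒unique {xs} b) i≢j) entries≡ ⟩
        ↑ (σ (Sign.- Sign.* sgnᵛ xs) ∙ Φ (entries xs))
          ≡⟨ σ-⊙ Sign.- (sgnᵛ xs) _ ⟩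
        ↑ -1* ⊙ ↑ (σ (sgnᵛ xs) ∙ Φ (entries xs))
          ≡⟨ -‿-1* _ ⟨
        - ↑ (σ (sgnᵛ xs) ∙ Φ (entries xs))
          ≡⟨ cong -_ (proj₁ rep xs b) ⟨
        - φ xs ∎
        where
        open ≡-Reasoning
        entries≡ : entries (transpose xs i j) ≡ entries xs
        entries≡ = entries-transpose xs i≢j
      ... | no ¬b = trans (proj₂ rep _ (¬b ∘ subst IsBasis (entries-transpose xs i≢j)))
                      (sym (trans (cong -_ (proj₂ rep xs ¬b)) -‿0#))

    represents⇒nonzero : ∀ xs → IsBasis (entries xs) → φ xs ≢ 0#
    represents⇒nonzero xs b eq = proj₂ (σ (sgnᵛ xs) ∙ Φ (entries xs)) (trans (sym (proj₁ rep xs b)) eq)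

  module _ {e} {φ : Vec (Fin n) (suc e) → Carrier} {Φ : Subset n → H*}
           (onBasis  : ∀ xs → IsBasis (entries xs) → φ xs ≡ ↑ (σ (sgnᵛ xs) ∙ Φ (entries xs)))
           (offBasis : ∀ xs → ¬ IsBasis (entries xs) → φ xs ≡ 0#)
           (rank′ : HasRank M (suc e))
           {xs : Vec (Fin n) (suc (suc e))} {ys : Vec (Fin n) e} (xs! : Unique xs) (ys! : Unique ys) where

    private
      I J : Subset n
      I = entries xs
      J = entries ys
      c : H*
      -- The signs common to all terms: `-1*` because the exponents begin at 1, and the signs of the
      -- two listings.
      c = (-1* ∙ σ (sgnᵛ xs)) ∙ σ (sgnᵛ ys)

    plückerTerm≡ : ∀ k → GP.plückerTerm φ xs ys k ≡ ↑ c ⊙ restrict (gpSupport I J) (gpTerm Φ I J) (lookup xs k)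
    plückerTerm≡ k = by-support (z ∈? gpSupport I J)
      where
      z : Fin n
      z = lookup xs k
      R : Vec (Fin n) (suc e)
      R = removeAt xs k
      by-support : Dec (z ∈ gpSupport I J) →
                   GP.plückerTerm φ xs ys k ≡ ↑ c ⊙ restrict (gpSupport I J) (gpTerm Φ I J) z
      by-support (yes z∈) = begin
        ([-1]^ suc (toℕ k)) ⊙ φ R ⊙ φ (z ∷ ys)
          ≡⟨ cong₂ _⊙_ (cong₂ _⊙_ ([-1]^≡σ (suc (toℕ k)))
               (trans (onBasis R (subst IsBasis (sym (entries-removeAt xs! k)) bI))
                      (cong (λ S → ↑ (σ (sgnᵛ R) ∙ Φ S)) (entries-removeAt xs! k))))
               (trans (onBasis (z ∷ ys) (subst IsBasis (sym (entries-∷ z ys)) bJ))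
                      (cong (λ S → ↑ (σ (sgnᵛ (z ∷ ys)) ∙ Φ S)) (entries-∷ z ys))) ⟩
        ↑ ((σ (parity (suc (toℕ k))) ∙ (σ (sgnᵛ R) ∙ Φ (I ⊖ z))) ∙ (σ (sgn z J Sign.* sgnᵛ ys) ∙ Φ (J ⊕ z)))
          ≡⟨ cong ↑_ combined ⟩
        ↑ (c ∙ gpTerm Φ I J z)
          ≡⟨ cong (↑ c ⊙_) (restrict-∈ {f = gpTerm Φ I J} z∈) ⟨
        ↑ c ⊙ restrict (gpSupport I J) (gpTerm Φ I J) z ∎
        where
        open ≡-Reasoning
        member : InSupport I J z
        member = ∈⟪⟫⁻ (inSupport? I J) z∈
        bI : IsBasis (I ⊖ z)
        bI = proj₁ (proj₂ member)
        bJ : IsBasis (J ⊕ z)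
        bJ = proj₂ (proj₂ (proj₂ member))
        combined : (σ (parity (suc (toℕ k))) ∙ (σ (sgnᵛ R) ∙ Φ (I ⊖ z))) ∙ (σ (sgn z J Sign.* sgnᵛ ys) ∙ Φ (J ⊕ z)) ≡
                   c ∙ gpTerm Φ I J z
        combined = begin
          (σ (Sign.- Sign.* parity (toℕ k)) ∙ (σ (sgnᵛ R) ∙ Φ (I ⊖ z))) ∙ (σ (sgn z J Sign.* sgnᵛ ys) ∙ Φ (J ⊕ z))
            ≡⟨ cong₂ (λ p q → (p ∙ (σ (sgnᵛ R) ∙ Φ (I ⊖ z))) ∙ (q ∙ Φ (J ⊕ z)))
                 (σ-* Sign.- (parity (toℕ k))) (σ-* (sgn z J) (sgnᵛ ys)) ⟩
          ((-1* ∙ σ (parity (toℕ k))) ∙ (σ (sgnᵛ R) ∙ Φ (I ⊖ z))) ∙ ((σ (sgn z J) ∙ σ (sgnᵛ ys)) ∙ Φ (J ⊕ z))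
            ≡⟨ solve 7 (λ m p r f j l h → ((m :∙ p) :∙ (r :∙ f)) :∙ ((j :∙ l) :∙ h) ⊜
                                          (p :∙ r) :∙ ((m :∙ l) :∙ (f :∙ (j :∙ h)))) refl
                 -1* (σ (parity (toℕ k))) (σ (sgnᵛ R)) (Φ (I ⊖ z)) (σ (sgn z J)) (σ (sgnᵛ ys)) (Φ (J ⊕ z)) ⟩
          (σ (parity (toℕ k)) ∙ σ (sgnᵛ R)) ∙ ((-1* ∙ σ (sgnᵛ ys)) ∙ (Φ (I ⊖ z) ∙ (σ (sgn z J) ∙ Φ (J ⊕ z))))
            ≡⟨ cong (_∙ ((-1* ∙ σ (sgnᵛ ys)) ∙ (Φ (I ⊖ z) ∙ (σ (sgn z J) ∙ Φ (J ⊕ z)))))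
                 (trans (sym (σ-* (parity (toℕ k)) (sgnᵛ R)))
                   (trans (cong σ (sgnᵛ-removeAt xs! k)) (σ-* (sgnᵛ xs) (sgn z I)))) ⟩
          (σ (sgnᵛ xs) ∙ σ (sgn z I)) ∙ ((-1* ∙ σ (sgnᵛ ys)) ∙ (Φ (I ⊖ z) ∙ (σ (sgn z J) ∙ Φ (J ⊕ z))))
            ≡⟨ solve 7 (λ m p r f j l h → (p :∙ r) :∙ ((m :∙ l) :∙ (f :∙ (j :∙ h))) ⊜
                                          ((m :∙ p) :∙ l) :∙ ((r :∙ f) :∙ (j :∙ h))) refl
                 -1* (σ (sgnᵛ xs)) (σ (sgn z I)) (Φ (I ⊖ z)) (σ (sgn z J)) (σ (sgnᵛ ys)) (Φ (J ⊕ z)) ⟩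
          c ∙ gpTerm Φ I J z ∎
      by-support (no z∉) = trans zero-term (sym (trans
        (cong (↑ c ⊙_) (restrict-∉ {f = gpTerm Φ I J} z∉)) (zeroʳ (↑ c))))
        where
        zero-term : GP.plückerTerm φ xs ys k ≡ 0#
        zero-term with isBasis? (entries R) | isBasis? (entries (z ∷ ys))
        ... | no ¬b | _     = trans (cong (λ t → ([-1]^ suc (toℕ k)) ⊙ t ⊙ φ (z ∷ ys)) (offBasis R ¬b))
                                (trans (cong (_⊙ φ (z ∷ ys)) (zeroʳ _)) (zeroˡ _))
        ... | yes _ | no ¬b = trans (cong (λ t → ([-1]^ suc (toℕ k)) ⊙ φ R ⊙ t) (offBasis (z ∷ ys) ¬b)) (zeroʳ _)
        ... | yes b | yes b′ = contradiction (∈⟪⟫⁺ (inSupport? I J)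
              (lookup∈entries xs k , subst IsBasis (entries-removeAt xs! k) b , z∉J ,
               subst IsBasis (entries-∷ z ys) b′)) z∉
          where
          z∉J : z ∉ J
          z∉J z∈J = ℕ.1+n≢n (trans (sym (rank′ b′))
            (trans (cong ∣_∣ (trans (entries-∷ z ys) (⊕-absorb z∈J))) (∣entries∣ ys!)))

    private
      F : Fin n → Carrier
      F = restrict (gpSupport I J) (gpTerm Φ I J)
      zs : List (Fin n)
      zs = List.tabulate (lookup xs)

      terms≡ : List.tabulate (GP.plückerTerm φ xs ys) ≡ List.map (↑ c ⊙_) (List.map F zs)
      terms≡ = trans (List.tabulate-cong plückerTerm≡) (trans (sym (List.map-tabulate (lookup xs) (λ z → ↑ c ⊙ F z)))
        (List.map-∘ zs))

      zs! = Uniqueᴸ.tabulate⁺ (λ {i} {j} → lookup-injective xs! i j)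

      covers : ∀ {z} → z ∈ gpSupport I J → z ∈ᴸ zs
      covers z∈ = let i , eq = ∈entries⁻ xs (proj₁ (∈⟪⟫⁻ (inSupport? I J) z∈))
                  in subst (_∈ᴸ zs) eq (∈-tabulate⁺ {f = lookup xs} i)

    plücker⇒zeroSum : 0# ∈ᴾ ⊞Σ (List.tabulate (GP.plückerTerm φ xs ys)) → ZeroSum (gpSupport I J) (gpTerm Φ I J)
    plücker⇒zeroSum 0∈ = zeroSum⁺ {f = gpTerm Φ I J} zs! covers (subst (λ ts → 0# ∈ᴾ ⊞Σ ts) cancel
        (0∈⊞Σ-scale (↑ (c ⁻¹)) (List.map (↑ c ⊙_) (List.map F zs)) (subst (λ ts → 0# ∈ᴾ ⊞Σ ts) terms≡ 0∈)))
      where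
      cancel : List.map (↑ (c ⁻¹) ⊙_) (List.map (↑ c ⊙_) (List.map F zs)) ≡ List.map F zs
      cancel = trans (sym (List.map-∘ (List.map F zs))) (trans (List.map-cong (⁻¹-cancelˡ c) _) (List.map-id _))

    zeroSum⇒plücker : ZeroSum (gpSupport I J) (gpTerm Φ I J) → 0# ∈ᴾ ⊞Σ (List.tabulate (GP.plückerTerm φ xs ys))
    zeroSum⇒plücker sum = subst (λ ts → 0# ∈ᴾ ⊞Σ ts) (sym terms≡)
      (0∈⊞Σ-scale (↑ c) (List.map F zs) (zeroSum⁻ {f = gpTerm Φ I J} zs! covers sum))

-- In rank 0 no set `J ⊕ z` with `z ∉ J` is a basis, so all supports are empty. In positive rank a
-- nonempty support fixes the sizes of `I` and `J`, and these sets then have listings of the right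
-- lengths.
relations⇔ : ∀ {a n} (H : Hyperfield a) d (M : Matroid n) (rank : HasRank M d) (• : Strength) →
  let open Values H using (H*; Carrier); open BasisFunctions H M rank • using (Represents) in
  ∀ {φ : Vec (Fin n) d → Carrier} {Φ : Subset n → H*} → Represents φ Φ →
  (GrassmannPlücker.PlückerRelations H M d • φ → Matching.GPRelations H M • Φ) ×
  (Matching.GPRelations H M • Φ → GrassmannPlücker.PlückerRelations H M d • φ)
relations⇔ {n = n} H zero M rank • {φ} {Φ} rep = to , λ _ → _
  where
  open Values H
  open Matching H M
  open Bases M
  to : ⊤ᵖ → GPRelations • Φ
  to _ I J _ = zeroSum-empty {f = gpTerm Φ I J} λ {z} z∈ →
    let _ , _ , z∉J , b = ∈⟪⟫⁻ (inSupport? I J) z∈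
    in ℕ.1+n≢0 (trans (sym (∣⊕∣ J z∉J)) (rank b))
relations⇔ {n = n} H (suc e) M rank • {φ} {Φ} (onBasis , offBasis) = to , from
  where
  open Values H
  open Matching H M
  open Bases M
  open BasisFunctions H M rank •
  to : GrassmannPlücker.PlückerRelations H M (suc e) • φ → GPRelations • Φ
  to rel I J req with nonempty? (gpSupport I J)
  ... | no  ∅        = zeroSum-empty {f = gpTerm Φ I J} λ z∈ → ∅ (_ , z∈)
  ... | yes (z , z∈) = subst₂ (λ I J → ZeroSum (gpSupport I J) (gpTerm Φ I J)) xs≡ ys≡
        (plücker⇒zeroSum {Φ = Φ} onBasis offBasis rank xs! ys! (rel xs ys xs! ys!
          (subst₂ (λ I J → Required • ∣ I ─ J ∣) (sym xs≡) (sym ys≡) req)))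
    where
    member : InSupport I J z
    member = ∈⟪⟫⁻ (inSupport? I J) z∈
    ∣I∣ : ∣ I ∣ ≡ suc (suc e)
    ∣I∣ = trans (sym (∣⊖∣ I (proj₁ member))) (cong suc (rank (proj₁ (proj₂ member))))
    ∣J∣ : ∣ J ∣ ≡ e
    ∣J∣ = ℕ.suc-injective (trans (sym (∣⊕∣ J (proj₁ (proj₂ (proj₂ member))))) (rank (proj₂ (proj₂ (proj₂ member)))))
    xs = listing I ∣I∣
    ys = listing J ∣J∣
    xs! = unique-listing I ∣I∣
    ys! = unique-listing J ∣J∣
    xs≡ = entries-listing I ∣I∣
    ys≡ = entries-listing J ∣J∣
  from : GPRelations • Φ → GrassmannPlücker.PlückerRelations H M (suc e) • φ
  from gp xs ys xs! ys! req = zeroSum⇒plücker {Φ = Φ} onBasis offBasis rank xs! ys! (gp (entries xs) (entries ys) req)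

-- Signatures as total functions of a subset and an element.

elements-map : ∀ {n} {B : Set ℓ} {S : Subset n} {t : Element S → B} {F : Fin n → B} →
               (∀ e → t e ≡ F (value e)) →
               List.map t (elements S) ≡ List.map F (filter (_∈? S) (allFin n))
elements-map {n = n} {S = S} {t} {F} t≡F = go (allFin n)
  where
  go : ∀ xs → List.map t (List.mapMaybe (λ x → Maybe.map (λ x∈S → x , [ x∈S ]) (dec⇒maybe (x ∈? S))) xs) ≡
              List.map F (filter (_∈? S) xs)
  go []       = refl
  go (x ∷ xs) with x ∈? S
  ... | yes x∈ = cong₂ _∷_ (t≡F (x , [ x∈ ])) (go xs)
  ... | no  _  = go xs

-- Membership is stored irrelevantly and recovered by deciding it; `isCocircuit` and `isCircuit` do
-- the same for cocircuits and circuits.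
member : ∀ {n} {S : Subset n} (x : Element S) → value x ∈ S
member {S = S} (x , [ x∈S ]) = recompute (x ∈? S) x∈S

module TotalSignatures (H : Hyperfield a) (inv : Involution H) {n : ℕ} (M : Matroid n) (• : Strength) where
  open Values H
  open Involution inv
  open Matroid M
  private
    module N  = Cocircuits M
    module N* = Cocircuits (dual M)
    module T  = Signatures H inv M •
  open Orthogonality H M
  open T using (OrthogonalPair)

  τ* : H* → H*
  τ* (x , x≢0) = τ x , λ τx≡0 → x≢0 (trans (sym (involutive x)) (trans (cong τ τx≡0) 0-homo))

  τ*-involutive : ∀ x → τ* (τ* x) ≡ x
  τ*-involutive x = ↑-injective (involutive (↑ x))

  τ*-∙ : ∀ x y → τ* (x ∙ y) ≡ τ* x ∙ τ* y
  τ*-∙ x y = ↑-injective (⊙-homo (↑ x) (↑ y))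

  cocircuit⁺ : ∀ {D} → N.IsCocircuit D → MinimalDependent (DualBasis M) D
  cocircuit⁺ = N.cocircuit⇒minimalDependent id λ {B} → subst IsBasis (sym (∁-involutive B))

  cocircuit⁻ : ∀ {D} → MinimalDependent (DualBasis M) D → N.IsCocircuit D
  cocircuit⁻ = N.minimalDependent⇒cocircuit id λ {B} → subst IsBasis (sym (∁-involutive B))

  circuit⁺ : ∀ {C} → N*.IsCocircuit C → MinimalDependent IsBasis C
  circuit⁺ = N*.cocircuit⇒minimalDependent (λ {B} → subst IsBasis (sym (∁-involutive B))) id

  circuit⁻ : ∀ {C} → MinimalDependent IsBasis C → N*.IsCocircuit C
  circuit⁻ = N*.minimalDependent⇒cocircuit (λ {B} → subst IsBasis (sym (∁-involutive B))) id

  isCocircuit : (D : Cocircuit M) → N.IsCocircuit (value D)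
  isCocircuit (D , [ d ]) = recompute (N.isCocircuit? D) (cocircuit⁻ d)

  isCircuit : (C : Circuit M) → N*.IsCocircuit (value C)
  isCircuit (C , [ c ]) = recompute (N*.isCocircuit? C) (circuit⁻ c)

  module _ {𝓓 𝓜 : Pred (Subset n) 0ℓ} (𝓓? : Decidable 𝓓) (𝓓⇒𝓜 : ∀ {D} → 𝓓 D → 𝓜 D)
           (f : (D : [ D ∈ Subset n ∣ 𝓜 D ]) → Element (value D) → H*) where

    -- Potentials and matching index signatures by plain subsets and elements, so the value 1 is
    -- supplied elsewhere.
    extend : Subset n → Fin n → H*
    extend D x with 𝓓? D | x ∈? D
    ... | yes c | yes x∈ = f (D , [ 𝓓⇒𝓜 c ]) (x , [ x∈ ])
    ... | yes _ | no _   = 1*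
    ... | no _  | _      = 1*

    extend-value : ∀ D x → 𝓓 (value D) → extend (value D) (value x) ≡ f D x
    extend-value D x d with 𝓓? (value D) | value x ∈? value D
    ... | yes c | yes x∈ = refl
    ... | yes _ | no x∉  = contradiction (member x) x∉
    ... | no ¬d | _      = contradiction d ¬d

  module _ (c : T.Coordinate → H*) where

    -- The argument is a bare family of coordinates, orthogonal or not, so these are maps on the
    -- whole power of `H*` in which the pairs form a subspace.
    η-of γ*-of : Subset n → Fin n → H*
    η-of  = extend N.isCocircuit? cocircuit⁺ λ D y → τ* (c (inj₂ (D , y)))
    γ*-of = extend N*.isCocircuit? circuit⁺ λ C x → σ (sgn (value x) full) ∙ c (inj₁ (C , x))

    η-of-value : ∀ D y → η-of (value D) (value y) ≡ τ* (c (inj₂ (D , y)))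
    η-of-value D y = extend-value N.isCocircuit? cocircuit⁺ _ D y (isCocircuit D)

    γ*-of-value : ∀ C x → γ*-of (value C) (value x) ≡ σ (sgn (value x) full) ∙ c (inj₁ (C , x))
    γ*-of-value C x = extend-value N*.isCocircuit? circuit⁺ _ C x (isCircuit C)

  module _ {γ* η : Subset n → Fin n → H*} {C D : Subset n} {γC : Element C → H*} {δD : Element D → H*}
           (γ-agrees : ∀ x → γ* C (value x) ≡ σ (sgn (value x) full) ∙ γC x)
           (δ-agrees : ∀ y → η D (value y) ≡ τ* (δD y)) where

    private
      S : Subset n
      S = C ∩ D
      agrees : ∀ e → T.orthogonalityTerm C D γC δD e ≡ restrict S (orthTerm γ* η C D) (value e)
      agrees e = sym (trans (restrict-∈ {f = orthTerm γ* η C D} (member e)) (cong ↑_ (begin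
        σ (sgn z full) ∙ (γ* C z ∙ η D z)
          ≡⟨ cong₂ (λ p q → σ (sgn z full) ∙ (p ∙ q)) (γ-agrees x) (δ-agrees y) ⟩
        σ (sgn z full) ∙ ((σ (sgn z full) ∙ γC x) ∙ τ* (δD y))
          ≡⟨ cong (σ (sgn z full) ∙_) (∙-assoc (σ (sgn z full)) (γC x) (τ* (δD y))) ⟩
        σ (sgn z full) ∙ (σ (sgn z full) ∙ (γC x ∙ τ* (δD y)))
          ≡⟨ σ-cancel (sgn z full) (γC x ∙ τ* (δD y)) ⟩
        γC x ∙ τ* (δD y) ∎)))
        where
        open ≡-Reasoning
        z = value e
        x = Refinement.refine (p∩q⊆p C D) e
        y = Refinement.refine (p∩q⊆q C D) e

      terms≡ : List.map (T.orthogonalityTerm C D γC δD) (elements S) ≡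
               List.map (restrict S (orthTerm γ* η C D)) (filter (_∈? S) (allFin n))
      terms≡ = elements-map agrees

      filter! = Uniqueᴸ.filter⁺ (_∈? S) (Uniqueᴸ.allFin⁺ n)

    orthogonal⇒zeroSum : 0# ∈ᴾ ⊞Σ (List.map (T.orthogonalityTerm C D γC δD) (elements S)) →
                         ZeroSum S (orthTerm γ* η C D)
    orthogonal⇒zeroSum 0∈ = zeroSum⁺ {f = orthTerm γ* η C D} filter! (∈-filter⁺ (_∈? S) (∈-allFin _))
      (subst (λ ts → 0# ∈ᴾ ⊞Σ ts) terms≡ 0∈)

    zeroSum⇒orthogonal : ZeroSum S (orthTerm γ* η C D) →
                         0# ∈ᴾ ⊞Σ (List.map (T.orthogonalityTerm C D γC δD) (elements S))
    zeroSum⇒orthogonal sum = subst (λ ts → 0# ∈ᴾ ⊞Σ ts) (sym terms≡)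
      (zeroSum⁻ {f = orthTerm γ* η C D} filter! (∈-filter⁺ (_∈? S) (∈-allFin _)) sum)

  pair-orthogonal : ∀ (p : OrthogonalPair) → Orthogonal • (γ*-of (T.coordinates p)) (η-of (T.coordinates p))
  pair-orthogonal p {C} {D} c d req = orthogonal⇒zeroSum
    {γ*-of (T.coordinates p)} {η-of (T.coordinates p)} {C} {D} {γ C′} {δ D′}
    (γ*-of-value (T.coordinates p) C′) (η-of-value (T.coordinates p) D′) (orthogonal C′ D′ req)
    where
    open OrthogonalPair p
    C′ : Circuit M
    C′ = C , [ circuit⁺ c ]
    D′ : Cocircuit M
    D′ = D , [ cocircuit⁺ d ]

  module _ (γ* η : Subset n → Fin n → H*) where

    restricted : T.Coordinate → H*
    restricted (inj₁ (C , x)) = σ (sgn (value x) full) ∙ γ* (value C) (value x)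
    restricted (inj₂ (D , y)) = τ* (η (value D) (value y))

    restricted-γ : ∀ C x → γ* (value C) (value x) ≡ σ (sgn (value x) full) ∙ restricted (inj₁ (C , x))
    restricted-γ C x = sym (σ-cancel (sgn (value x) full) (γ* (value C) (value x)))

    restricted-η : ∀ D y → η (value D) (value y) ≡ τ* (restricted (inj₂ (D , y)))
    restricted-η D y = sym (τ*-involutive (η (value D) (value y)))

    restrictedPair : Orthogonal • γ* η → OrthogonalPair
    restrictedPair orth = record
      { γ          = λ C x → restricted (inj₁ (C , x))
      ; δ          = λ D y → restricted (inj₂ (D , y))
      ; orthogonal = λ C D req → zeroSum⇒orthogonal
          {γ*} {η} {value C} {value D}
          {λ x → restricted (inj₁ (C , x))} {λ y → restricted (inj₂ (D , y))}
          (restricted-γ C) (restricted-η D) (orth (isCircuit C) (isCocircuit D) req)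
      }

    coordinates-restrictedPair : ∀ (orth : Orthogonal • γ* η) i → T.coordinates (restrictedPair orth) i ≡ restricted i
    coordinates-restrictedPair orth (inj₁ _) = refl
    coordinates-restrictedPair orth (inj₂ _) = refl

-- Rescaling by a function on the ground set.

module Products (H : Hyperfield a) where
  open Values H

  ∏ : ∀ {n} → (Fin n → H*) → Subset n → H*
  ∏ h []            = 1*
  ∏ h (inside  ∷ S) = h zero ∙ ∏ (h ∘ suc) S
  ∏ h (outside ∷ S) = ∏ (h ∘ suc) S

  ∏-⊕ : ∀ {n} (h : Fin n → H*) (S : Subset n) {x} → x ∉ S → ∏ h (S ⊕ x) ≡ h x ∙ ∏ h S
  ∏-⊕ h (inside  ∷ S) {zero}  x∉ = contradiction Vec.here x∉
  ∏-⊕ h (outside ∷ S) {zero}  x∉ = refl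
  ∏-⊕ h (inside  ∷ S) {suc x} x∉ = trans (cong (h zero ∙_) (∏-⊕ (h ∘ suc) S (x∉ ∘ Vec.there)))
    (solve 3 (λ p q r → p :∙ (q :∙ r) ⊜ q :∙ (p :∙ r)) refl (h zero) (h (suc x)) (∏ (h ∘ suc) S))
  ∏-⊕ h (outside ∷ S) {suc x} x∉ = ∏-⊕ (h ∘ suc) S (x∉ ∘ Vec.there)

  ∏-empty : ∀ n (h : Fin n → H*) → ∏ h empty ≡ 1*
  ∏-empty zero    h = refl
  ∏-empty (suc n) h = ∏-empty n (h ∘ suc)

  ⨀≡∏ : ∀ {n d} (h : Fin n → H*) {xs : Vec (Fin n) d} → Unique xs → ⨀ h xs ≡ ↑ ∏ h (entries xs)
  ⨀≡∏ {n} h {[]}     _   = cong ↑_ (sym (∏-empty n h))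
  ⨀≡∏ h {x ∷ xs} xs! = trans (cong (↑ h x ⊙_) (⨀≡∏ h (unique-tail xs!)))
    (cong ↑_ (sym (trans (cong (∏ h) (entries-∷ x xs)) (∏-⊕ h (entries xs) (unique-head xs!)))))

module Twisting (H : Hyperfield a) {n : ℕ} (N : Matroid n) where
  open Values H
  open Cocircuits N
  open Matching H N

  -- The weight `w` is abstract to serve both sides: it is the product of `h` over a basis, and for
  -- the dual a product over the complement, where inserting `x` deletes a factor and `h` is the
  -- inverse function.
  matches-twist : ∀ {η η′ : Subset n → Fin n → H*} {Φ Φ′ : Subset n → H*}
    (h : Fin n → H*) (c : H*) (w : Subset n → H*) →
    (∀ J {x} → x ∉ J → w (J ⊕ x) ≡ h x ∙ w J) →
    (∀ {B} → IsBasis B → Φ′ B ≡ c ∙ (w B ∙ Φ B)) →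
    (∀ {D} → IsCocircuit D → ∃ λ b → ∀ {x} → x ∈ D → η′ D x ≡ b ∙ (h x ∙ η D x)) →
    Matches η Φ → Matches η′ Φ′
  matches-twist {η} {η′} {Φ} {Φ′} h c w w-⊕ Φ′≡ η′≡ m {J} {D} sp =
    let b , eq = η′≡ (J , sp)
    in ∝-trans (∝-scaled b eq) (∝-trans (∝-∙ (∝-refl {f = h}) (m sp))
         (∝-sym (∝-scaled (c ∙ w J) λ {x} x∈ →
           let x∉J , bx = ∈-spans⁻ sp x∈
           in trans (cong (σ (sgn x J) ∙_) (trans (Φ′≡ bx) (cong (λ t → c ∙ (t ∙ Φ (J ⊕ x))) (w-⊕ J x∉J))))
                (solve 5 (λ s c h w f → s :∙ (c :∙ ((h :∙ w) :∙ f)) ⊜ (c :∙ w) :∙ (h :∙ (s :∙ f))) refl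
                  (σ (sgn x J)) c (h x) (w J) (Φ (J ⊕ x))))))

-- The correspondence of signature pairs and Grassmann-Plücker functions.

module Links (H : Hyperfield a) (inv : Involution H) {n d : ℕ} (M : Matroid n) (rank : HasRank M d)
             (• : Strength) where
  open Values H
  open Products H
  open Involution inv using (τ)
  open Matroid M using (IsBasis; isBasis?; nonempty)
  open Matching H M
  open Orthogonality H M
  open BasisFunctions H M rank •
  open TotalSignatures H inv M •
  private
    module N   = Cocircuits M
    module N*  = Cocircuits (dual M)
    module P*  = Matching H (dual M)
    module GP  = GrassmannPlücker H M d •
    module T   = Signatures H inv M •
  open GP using (GPFunction)
  open T using (OrthogonalPair)
  open GPFunction using (φ)
  open OrthogonalPair using (γ; δ)
  open GroupProperties H*-group using (⁻¹-involutive)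

  -- A relation instead of a map: it holds between `p` and `toGP p` and between `fromGP f` and `f`.
  -- Comparing equivalences across links once therefore gives well-definedness, injectivity and
  -- surjectivity together.
  record Link (p : OrthogonalPair) (f : GPFunction) : Set a where
    field
      Φ          : Subset n → H*
      represents : Represents (φ f) Φ
      matches    : Matches (η-of (T.coordinates p)) Φ
      matches*   : P*.Matches (γ*-of (T.coordinates p)) (Φ ∘ ∁)

  signed-potential : (T.Coordinate → H*) → Subset n → H*
  signed-potential c = Potential.potential H M (signed (η-of c))

  toGP : OrthogonalPair → GPFunction
  toGP p = record
    { φ           = ordered Φ
    ; nonzero     = xs , represents⇒nonzero {ordered Φ} {Φ} rep xs (subst IsBasis (sym (entries-listing B (rank b))) b)
    ; alternating = represents⇒alternating {ordered Φ} {Φ} rep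
    ; relations   = proj₂ (relations⇔ H d M rank • {ordered Φ} {Φ} rep)
                      (orthogonal⇒relations {•} {γ*-of c} {η-of c} {Φ}
                        (potential-matches* {•} {γ*-of c} {η-of c} orth)
                        (potential-matches {•} {γ*-of c} {η-of c} orth) orth)
    ; basis⇒≢0    = represents⇒nonzero {ordered Φ} {Φ} rep
    ; nonbasis⇒≡0 = proj₂ rep
    }
    where
    c = T.coordinates p
    Φ = signed-potential c
    rep : Represents (ordered Φ) Φ
    rep = ordered-represents Φ
    orth : Orthogonal • (γ*-of c) (η-of c)
    orth = pair-orthogonal p
    B = proj₁ nonempty
    b = proj₂ nonempty
    xs = listing B (rank b)

  toGP-link : ∀ p → Link p (toGP p)
  toGP-link p = record
    { Φ          = signed-potential (T.coordinates p)
    ; represents = ordered-represents (signed-potential (T.coordinates p))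
    ; matches    = potential-matches {•} {γ*-of (T.coordinates p)} {η-of (T.coordinates p)} (pair-orthogonal p)
    ; matches*   = potential-matches* {•} {γ*-of (T.coordinates p)} {η-of (T.coordinates p)} (pair-orthogonal p)
    }

  module _ (Φ : Subset n → H*) (gp : GPRelations • Φ) where

    private
      γ* η : Subset n → Fin n → H*
      γ* = P*.signature (Φ ∘ ∁)
      η  = signature Φ

      m : Matches η Φ
      m = signature-matches {•} {Φ} gp

      m* : P*.Matches γ* (Φ ∘ ∁)
      m* = P*.signature-matches {•} {Φ ∘ ∁} (relations-dual {•} {Φ} gp)

    signaturePair : OrthogonalPair
    signaturePair = restrictedPair γ* η (relations⇒orthogonal {•} {γ*} {η} {Φ} m* m gp)

    signaturePair-matches : Matches (η-of (T.coordinates signaturePair)) Φ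
    signaturePair-matches {J} {D} sp = ∝-trans (∝-cong (η-of-coordinates (J , sp))) (m sp)
      where
      η-of-coordinates : ∀ {D} → N.IsCocircuit D → ∀ {x} → x ∈ D →
                         η-of (T.coordinates signaturePair) D x ≡ η D x
      η-of-coordinates {D} d {x} x∈ =
        let D′ = D , [ cocircuit⁺ d ] ; x′ = x , [ x∈ ]
        in trans (η-of-value (T.coordinates signaturePair) D′ x′) (sym (restricted-η γ* η D′ x′))

    signaturePair-matches* : P*.Matches (γ*-of (T.coordinates signaturePair)) (Φ ∘ ∁)
    signaturePair-matches* {J} {C} sp = ∝-trans (∝-cong (γ*-of-coordinates (J , sp))) (m* sp)
      where
      γ*-of-coordinates : ∀ {C} → N*.IsCocircuit C → ∀ {x} → x ∈ C →
                          γ*-of (T.coordinates signaturePair) C x ≡ γ* C x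
      γ*-of-coordinates {C} c {x} x∈ =
        let C′ = C , [ circuit⁺ c ] ; x′ = x , [ x∈ ]
        in trans (γ*-of-value (T.coordinates signaturePair) C′ x′) (sym (restricted-γ γ* η C′ x′))

  gpΦ : GPFunction → Subset n → H*
  gpΦ f = onBases (φ f) (GPFunction.basis⇒≢0 f)

  fromGP : GPFunction → OrthogonalPair
  fromGP f = signaturePair (gpΦ f)
    (proj₁ (relations⇔ H d M rank • {φ f} {gpΦ f} (gp-represents f)) (GPFunction.relations f))

  NonzeroOnBases : (Vec (Fin n) d → Carrier) → Set a
  NonzeroOnBases ψ = ∀ xs → IsBasis (entries xs) → ψ xs ≢ 0#

  gpCoordinates : (ψ : Vec (Fin n) d → Carrier) → NonzeroOnBases ψ → T.Coordinate → H*
  gpCoordinates ψ ψ≢0 = restricted (P*.signature (onBases ψ ψ≢0 ∘ ∁)) (signature (onBases ψ ψ≢0))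

  coordinates-fromGP : ∀ f i → T.coordinates (fromGP f) i ≡ gpCoordinates (φ f) (GPFunction.basis⇒≢0 f) i
  coordinates-fromGP f = coordinates-restrictedPair (P*.signature (gpΦ f ∘ ∁)) (signature (gpΦ f))
    (relations⇒orthogonal {•} {P*.signature (gpΦ f ∘ ∁)} {signature (gpΦ f)} {gpΦ f}
      (P*.signature-matches {•} {gpΦ f ∘ ∁} (relations-dual {•} {gpΦ f} gp)) (signature-matches {•} {gpΦ f} gp) gp)
    where
    gp = proj₁ (relations⇔ H d M rank • {φ f} {gpΦ f} (gp-represents f)) (GPFunction.relations f)

  fromGP-link : ∀ f → Link (fromGP f) f
  fromGP-link f = record
    { Φ          = Φ
    ; represents = gp-represents f
    ; matches    = signaturePair-matches Φ gp
    ; matches*   = signaturePair-matches* Φ gp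
    }
    where
    Φ = gpΦ f
    gp = proj₁ (relations⇔ H d M rank • {φ f} {gpΦ f} (gp-represents f)) (GPFunction.relations f)

  -- Scaling each circuit and cocircuit, combined with a twist by `h`. The twist by 1 is the
  -- equivalence of the first quotient and an arbitrary twist that of the second, so one argument
  -- serves both.
  TwistedPairs : OrthogonalPair → OrthogonalPair → (Fin n → H*) → Set a
  TwistedPairs p q h = ∃₂ λ (b : Circuit M → H*) (l : Cocircuit M → H*) →
    (∀ C x → γ p C x ≡ b C ∙ (h (value x) ∙ γ q C x)) ×
    (∀ D y → δ p D y ≡ l D ∙ (τ* (h (value y) ⁻¹) ∙ δ q D y))

  TwistedFunctions : GPFunction → GPFunction → (Fin n → H*) → Set a
  TwistedFunctions f g k = ∃ λ (c : H*) → ∀ xs → φ f xs ≡ ↑ c ⊙ (⨀ k xs ⊙ φ g xs)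

  -- The τ in the twist of δ cancels against the one in `η = τ ∘ δ`, so η is twisted by `h ⁻¹`.
  -- Multiplying the function of `q` by the product of `h ⁻¹` over each basis makes it match `p`,
  -- and uniqueness gives the scalar.
  pairs⇒functions : ∀ {p q f g h} → Link p f → Link q g → TwistedPairs p q h →
                    TwistedFunctions f g (λ x → h x ⁻¹)
  pairs⇒functions {p} {q} {f} {g} {h} Lp Lq (b , l , eqγ , eqδ) = c , λ xs → by-basis xs (isBasis? (entries xs))
    where
    module Lp = Link Lp
    module Lq = Link Lq
    h⁻¹ : Fin n → H*
    h⁻¹ x = h x ⁻¹
    Φ′ : Subset n → H*
    Φ′ B = ∏ h⁻¹ B ∙ Lq.Φ B
    B₀ : Subset n
    B₀ = proj₁ nonempty

    twisted : Matches (η-of (T.coordinates p)) Φ′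
    twisted = Twisting.matches-twist H M {η-of (T.coordinates q)} {η-of (T.coordinates p)} {Lq.Φ} {Φ′}
      h⁻¹ 1* (∏ h⁻¹) (∏-⊕ h⁻¹) (λ {B} _ → sym (∙-identityˡ (Φ′ B))) scaled Lq.matches
      where
      scaled : ∀ {D} → N.IsCocircuit D → ∃ λ b → ∀ {x} → x ∈ D →
               η-of (T.coordinates p) D x ≡ b ∙ (h⁻¹ x ∙ η-of (T.coordinates q) D x)
      scaled {D} d = τ* (l D′) , λ {x} x∈ → let x′ = x , [ x∈ ] in begin
        η-of (T.coordinates p) D x
          ≡⟨ η-of-value (T.coordinates p) D′ x′ ⟩
        τ* (δ p D′ x′)
          ≡⟨ cong τ* (eqδ D′ x′) ⟩
        τ* (l D′ ∙ (τ* (h⁻¹ x) ∙ δ q D′ x′))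
          ≡⟨ trans (τ*-∙ (l D′) (τ* (h⁻¹ x) ∙ δ q D′ x′)) (cong (τ* (l D′) ∙_) (τ*-∙ (τ* (h⁻¹ x)) (δ q D′ x′))) ⟩
        τ* (l D′) ∙ (τ* (τ* (h⁻¹ x)) ∙ τ* (δ q D′ x′))
          ≡⟨ cong₂ (λ s t → τ* (l D′) ∙ (s ∙ t)) (τ*-involutive (h⁻¹ x)) (sym (η-of-value (T.coordinates q) D′ x′)) ⟩
        τ* (l D′) ∙ (h⁻¹ x ∙ η-of (T.coordinates q) D x) ∎
        where
        open ≡-Reasoning
        D′ : Cocircuit M
        D′ = D , [ cocircuit⁺ d ]

    c : H*
    c = Lp.Φ B₀ ∙ Φ′ B₀ ⁻¹

    Φ≡ : ∀ {B} → IsBasis B → Lp.Φ B ≡ c ∙ Φ′ B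
    Φ≡ {B} bB = ∙-cancelʳ (Φ′ B₀) _ _ (begin
      Lp.Φ B ∙ Φ′ B₀                      ≡⟨ matches-unique {η-of (T.coordinates p)} {Lp.Φ} {Φ′} Lp.matches twisted bB ⟩
      Lp.Φ B₀ ∙ Φ′ B                      ≡⟨ ∙-identityʳ _ ⟨
      (Lp.Φ B₀ ∙ Φ′ B) ∙ 1*               ≡⟨ cong ((Lp.Φ B₀ ∙ Φ′ B) ∙_) (⁻¹-inverseˡ (Φ′ B₀)) ⟨
      (Lp.Φ B₀ ∙ Φ′ B) ∙ (Φ′ B₀ ⁻¹ ∙ Φ′ B₀)
        ≡⟨ solve 4 (λ p q r⁻¹ r → (p :∙ q) :∙ (r⁻¹ :∙ r) ⊜ ((p :∙ r⁻¹) :∙ q) :∙ r) refl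
             (Lp.Φ B₀) (Φ′ B) (Φ′ B₀ ⁻¹) (Φ′ B₀) ⟩
      (c ∙ Φ′ B) ∙ Φ′ B₀                  ∎)
      where open ≡-Reasoning

    by-basis : ∀ xs → Dec (IsBasis (entries xs)) → φ f xs ≡ ↑ c ⊙ (⨀ h⁻¹ xs ⊙ φ g xs)
    by-basis xs (no ¬b) = trans (proj₂ Lp.represents xs ¬b) (sym (trans
      (cong (λ t → ↑ c ⊙ (⨀ h⁻¹ xs ⊙ t)) (proj₂ Lq.represents xs ¬b))
      (trans (cong (↑ c ⊙_) (zeroʳ (⨀ h⁻¹ xs))) (zeroʳ (↑ c)))))
    by-basis xs (yes b) = begin
      φ f xs
        ≡⟨ proj₁ Lp.represents xs b ⟩
      ↑ (σ (sgnᵛ xs) ∙ Lp.Φ (entries xs))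
        ≡⟨ cong ↑_ (trans (cong (σ (sgnᵛ xs) ∙_) (Φ≡ b))
             (solve 4 (λ s c h f → s :∙ (c :∙ (h :∙ f)) ⊜ c :∙ (h :∙ (s :∙ f))) refl
               (σ (sgnᵛ xs)) c (∏ h⁻¹ (entries xs)) (Lq.Φ (entries xs)))) ⟩
      ↑ c ⊙ (↑ ∏ h⁻¹ (entries xs) ⊙ ↑ (σ (sgnᵛ xs) ∙ Lq.Φ (entries xs)))
        ≡⟨ cong₂ (λ s t → ↑ c ⊙ (s ⊙ t)) (⨀≡∏ h⁻¹ (basis⇒unique {xs} b)) (proj₁ Lq.represents xs b) ⟨
      ↑ c ⊙ (⨀ h⁻¹ xs ⊙ φ g xs) ∎
      where open ≡-Reasoning

  -- A product of `k` over bases contributes the factor `k x` to `Φ (J ⊕ x)`, hence to cocircuits,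
  -- and lacks this factor in `Φ (I ⊖ x)`, hence `k x ⁻¹` on circuits.
  functions⇒pairs : ∀ {p q f g k} → Link p f → Link q g → TwistedFunctions f g k →
                    TwistedPairs p q (λ x → k x ⁻¹)
  functions⇒pairs {p} {q} {f} {g} {k} Lp Lq (c , eq) =
    (λ C → proj₁ (circuit-scale (isCircuit C))) , (λ D → τ* (proj₁ (cocircuit-scale (isCocircuit D)))) ,
    on-circuits , on-cocircuits
    where
    module Lp = Link Lp
    module Lq = Link Lq
    k⁻¹ : Fin n → H*
    k⁻¹ x = k x ⁻¹
    ηp = η-of (T.coordinates p)
    ηq = η-of (T.coordinates q)
    γp = γ*-of (T.coordinates p)
    γq = γ*-of (T.coordinates q)

    Φ≡ : ∀ {B} → IsBasis B → Lp.Φ B ≡ c ∙ (∏ k B ∙ Lq.Φ B)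
    Φ≡ {B} b = subst (λ S → Lp.Φ S ≡ c ∙ (∏ k S ∙ Lq.Φ S)) (entries-listing B (rank b))
      (∙-cancelˡ (σ (sgnᵛ xs)) _ _ (trans
        (↑-injective (begin
          ↑ (σ (sgnᵛ xs) ∙ Lp.Φ (entries xs))                          ≡⟨ proj₁ Lp.represents xs b′ ⟨
          φ f xs                                                        ≡⟨ eq xs ⟩
          ↑ c ⊙ (⨀ k xs ⊙ φ g xs)
            ≡⟨ cong₂ (λ s t → ↑ c ⊙ (s ⊙ t)) (⨀≡∏ k (unique-listing B (rank b))) (proj₁ Lq.represents xs b′) ⟩
          ↑ (c ∙ (∏ k (entries xs) ∙ (σ (sgnᵛ xs) ∙ Lq.Φ (entries xs)))) ∎))
        (solve 4 (λ s c h f → c :∙ (h :∙ (s :∙ f)) ⊜ s :∙ (c :∙ (h :∙ f))) refl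
          (σ (sgnᵛ xs)) c (∏ k (entries xs)) (Lq.Φ (entries xs)))))
      where
      open ≡-Reasoning
      xs = listing B (rank b)
      b′ : IsBasis (entries xs)
      b′ = subst IsBasis (sym (entries-listing B (rank b))) b

    ∏-removal : ∀ J {x} → x ∉ J → ∏ k (∁ (J ⊕ x)) ≡ k⁻¹ x ∙ ∏ k (∁ J)
    ∏-removal J {x} x∉J = ∙-cancelˡ (k x) _ _ (begin
      k x ∙ ∏ k (∁ (J ⊕ x))        ≡⟨ cong (λ S → k x ∙ ∏ k S) (∁-⊕ J x) ⟩
      k x ∙ ∏ k (∁ J ⊖ x)          ≡⟨ ∏-⊕ k (∁ J ⊖ x) (x∉S⊖x (∁ J) x) ⟨
      ∏ k (∁ J ⊖ x ⊕ x)            ≡⟨ cong (∏ k) (⊖-⊕ (x∉p⇒x∈∁p x∉J)) ⟩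
      ∏ k (∁ J)                    ≡⟨ ∙-identityˡ _ ⟨
      1* ∙ ∏ k (∁ J)               ≡⟨ cong (_∙ ∏ k (∁ J)) (⁻¹-inverseʳ (k x)) ⟨
      (k x ∙ k⁻¹ x) ∙ ∏ k (∁ J)    ≡⟨ ∙-assoc (k x) (k⁻¹ x) (∏ k (∁ J)) ⟩
      k x ∙ (k⁻¹ x ∙ ∏ k (∁ J))    ∎)
      where open ≡-Reasoning

    twisted : Matches (λ D x → k x ∙ ηq D x) Lp.Φ
    twisted = Twisting.matches-twist H M {ηq} {λ D x → k x ∙ ηq D x} {Lq.Φ} {Lp.Φ}
      k c (∏ k) (∏-⊕ k) Φ≡ (λ {D} _ → 1* , λ {x} _ → sym (∙-identityˡ (k x ∙ ηq D x))) Lq.matches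

    twisted* : P*.Matches (λ C x → k⁻¹ x ∙ γq C x) (Lp.Φ ∘ ∁)
    twisted* = Twisting.matches-twist H (dual M) {γq} {λ C x → k⁻¹ x ∙ γq C x} {Lq.Φ ∘ ∁} {Lp.Φ ∘ ∁}
      k⁻¹ c (∏ k ∘ ∁) ∏-removal Φ≡ (λ {C} _ → 1* , λ {x} _ → sym (∙-identityˡ (k⁻¹ x ∙ γq C x))) Lq.matches*

    cocircuit-scale : ∀ {D} → N.IsCocircuit D → ∃ λ l → ∀ {x} → x ∈ D → ηp D x ≡ l ∙ (k x ∙ ηq D x)
    cocircuit-scale {D} d@(_ , _ , x₀ , x₀∈) =
      (k x₀ ∙ ηq D x₀) ⁻¹ ∙ ηp D x₀ , ∝⇒scaled {f = λ x → k x ∙ ηq D x} {g = ηp D} x₀∈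
      (matches-unique* {λ D x → k x ∙ ηq D x} {ηp} {Lp.Φ} twisted Lp.matches d)

    circuit-scale : ∀ {C} → N*.IsCocircuit C → ∃ λ l → ∀ {x} → x ∈ C → γp C x ≡ l ∙ (k⁻¹ x ∙ γq C x)
    circuit-scale {C} c@(_ , _ , x₀ , x₀∈) =
      (k⁻¹ x₀ ∙ γq C x₀) ⁻¹ ∙ γp C x₀ , ∝⇒scaled {f = λ x → k⁻¹ x ∙ γq C x} {g = γp C} x₀∈
      (P*.matches-unique* {λ C x → k⁻¹ x ∙ γq C x} {γp} {Lp.Φ ∘ ∁} twisted* Lp.matches* c)

    on-circuits : ∀ C x → γ p C x ≡ proj₁ (circuit-scale (isCircuit C)) ∙ (k⁻¹ (value x) ∙ γ q C x)
    on-circuits C x = ∙-cancelˡ t _ _ (begin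
      t ∙ γ p C x                              ≡⟨ γ*-of-value (T.coordinates p) C x ⟨
      γp (value C) (value x)                   ≡⟨ proj₂ (circuit-scale (isCircuit C)) (member x) ⟩
      b ∙ (k⁻¹ (value x) ∙ γq (value C) (value x))
        ≡⟨ cong (λ s → b ∙ (k⁻¹ (value x) ∙ s)) (γ*-of-value (T.coordinates q) C x) ⟩
      b ∙ (k⁻¹ (value x) ∙ (t ∙ γ q C x))
        ≡⟨ solve 4 (λ t b k g → b :∙ (k :∙ (t :∙ g)) ⊜ t :∙ (b :∙ (k :∙ g))) refl
             t b (k⁻¹ (value x)) (γ q C x) ⟩
      t ∙ (b ∙ (k⁻¹ (value x) ∙ γ q C x))      ∎)
      where
      open ≡-Reasoning
      t b : H*
      t = σ (sgn (value x) full)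
      b = proj₁ (circuit-scale (isCircuit C))

    on-cocircuits : ∀ D y → δ p D y ≡ τ* (proj₁ (cocircuit-scale (isCocircuit D))) ∙
                                      (τ* (k⁻¹ (value y) ⁻¹) ∙ δ q D y)
    on-cocircuits D y = begin
      δ p D y                                  ≡⟨ τ*-involutive (δ p D y) ⟨
      τ* (τ* (δ p D y))                        ≡⟨ cong τ* (η-of-value (T.coordinates p) D y) ⟨
      τ* (ηp (value D) (value y))              ≡⟨ cong τ* (proj₂ (cocircuit-scale (isCocircuit D)) (member y)) ⟩
      τ* (l ∙ (k (value y) ∙ ηq (value D) (value y)))
        ≡⟨ trans (τ*-∙ l (k (value y) ∙ ηq (value D) (value y)))
             (cong (τ* l ∙_) (τ*-∙ (k (value y)) (ηq (value D) (value y)))) ⟩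
      τ* l ∙ (τ* (k (value y)) ∙ τ* (ηq (value D) (value y)))
        ≡⟨ cong₂ (λ s t → τ* l ∙ (τ* s ∙ t)) (sym (⁻¹-involutive (k (value y))))
             (trans (cong τ* (η-of-value (T.coordinates q) D y)) (τ*-involutive (δ q D y))) ⟩
      τ* l ∙ (τ* (k⁻¹ (value y) ⁻¹) ∙ δ q D y) ∎
      where
      open ≡-Reasoning
      l : H*
      l = proj₁ (cocircuit-scale (isCocircuit D))

  ⨀-trivial : ∀ {e} {k : Fin n → H*} → (∀ x → k x ≡ 1*) → (xs : Vec (Fin n) e) → ⨀ k xs ≡ 1#
  ⨀-trivial k≡1 []       = refl
  ⨀-trivial k≡1 (x ∷ xs) = trans (cong₂ _⊙_ (cong ↑_ (k≡1 x)) (⨀-trivial k≡1 xs)) (⊙-identityˡ 1#)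

  1*⁻¹ : 1* ⁻¹ ≡ 1*
  1*⁻¹ = GroupProperties.ε⁻¹≈ε H*-group

  τ*-trivial : ∀ {x} → x ≡ 1* → τ* (x ⁻¹) ≡ 1*
  τ*-trivial refl = trans (cong τ* 1*⁻¹) (↑-injective (Involution.1-homo inv))

  ~⇒twistedPairs : ∀ {p q} → p T.~ q → TwistedPairs p q (λ _ → 1*)
  ~⇒twistedPairs {p} {q} (b , l , eqγ , eqδ) = b , l ,
    (λ C x → trans (↑-injective (eqγ C x)) (cong (b C ∙_) (sym (∙-identityˡ (γ q C x))))) ,
    (λ D y → trans (↑-injective (eqδ D y)) (cong (l D ∙_)
      (trans (sym (∙-identityˡ (δ q D y))) (cong (_∙ δ q D y) (sym (τ*-trivial refl))))))

  twistedPairs⇒~ : ∀ {p q h} → (∀ x → h x ≡ 1*) → TwistedPairs p q h → p T.~ q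
  twistedPairs⇒~ {p} {q} h≡1 (b , l , eqγ , eqδ) = b , l ,
    (λ C x → cong ↑_ (trans (eqγ C x) (cong (b C ∙_)
      (trans (cong (_∙ γ q C x) (h≡1 (value x))) (∙-identityˡ (γ q C x)))))) ,
    (λ D y → cong ↑_ (trans (eqδ D y) (cong (l D ∙_)
      (trans (cong (_∙ δ q D y) (τ*-trivial (h≡1 (value y)))) (∙-identityˡ (δ q D y))))))

  ≅⇒twistedPairs : ∀ {p q} → p T.≅ q → ∃ (TwistedPairs p q)
  ≅⇒twistedPairs {p} {q} (p′ , q′ , (b , l , eq₁ , eq₂) , q~q′ , (h , eq₃ , eq₄))
    with b′ , l′ , eq₅ , eq₆ ← IsEquivalence.sym T.~-isEquivalence {q} {q′} q~q′ =
    h , (λ C → b C ∙ b′ C) , (λ D → l D ∙ l′ D) ,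
    (λ C x → trans (↑-injective (eq₁ C x)) (trans
      (cong (b C ∙_) (trans (↑-injective {γ p′ C x} {h (value x) ∙ γ q′ C x} (eq₃ C x))
        (cong (h (value x) ∙_) (↑-injective {γ q′ C x} {b′ C ∙ γ q C x} (eq₅ C x)))))
      (rearrange (b C) (h (value x)) (b′ C) (γ q C x)))) ,
    (λ D y → trans (↑-injective (eq₂ D y)) (trans
      (cong (l D ∙_) (trans (↑-injective {δ p′ D y} {τ* (h (value y) ⁻¹) ∙ δ q′ D y} (eq₄ D y))
        (cong (τ* (h (value y) ⁻¹) ∙_) (↑-injective {δ q′ D y} {l′ D ∙ δ q D y} (eq₆ D y)))))
      (rearrange (l D) (τ* (h (value y) ⁻¹)) (l′ D) (δ q D y))))
    where
    rearrange : ∀ p q r t → p ∙ (q ∙ (r ∙ t)) ≡ (p ∙ r) ∙ (q ∙ t)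
    rearrange = solve 4 (λ p q r t → p :∙ (q :∙ (r :∙ t)) ⊜ (p :∙ r) :∙ (q :∙ t)) refl

  twistedPairs⇒≅ : ∀ {p q h} → TwistedPairs p q h → p T.≅ q
  twistedPairs⇒≅ {p} {q} {h} (b , l , eqγ , eqδ) = p′ , q ,
    IsEquivalence.sym T.~-isEquivalence {p′} {p} (b⁻¹ , l⁻¹ , (λ _ _ → refl) , (λ _ _ → refl)) ,
    IsEquivalence.refl T.~-isEquivalence {q} ,
    h , (λ C x → sym (⁻¹-solve (b C) (cong ↑_ (eqγ C x)))) ,
        (λ D y → sym (⁻¹-solve (l D) (cong ↑_ (eqδ D y))))
    where
    b⁻¹ = λ C → b C ⁻¹
    l⁻¹ = λ D → l D ⁻¹
    p′ = T.scale b⁻¹ l⁻¹ p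

  ~⇒twistedFunctions : ∀ {f g} → f GP.~ g → TwistedFunctions f g (λ _ → 1*)
  ~⇒twistedFunctions {f} {g} (c , eq) = c , λ xs → trans (eq xs)
    (cong (↑ c ⊙_) (sym (trans (cong (_⊙ φ g xs) (⨀-1 xs)) (⊙-identityˡ (φ g xs)))))

  twistedFunctions⇒~ : ∀ {f g k} → (∀ x → k x ≡ 1*) → TwistedFunctions f g k → f GP.~ g
  twistedFunctions⇒~ {f} {g} k≡1 (c , eq) = c , λ xs → trans (eq xs)
    (cong (↑ c ⊙_) (trans (cong (_⊙ φ g xs) (⨀-trivial k≡1 xs)) (⊙-identityˡ (φ g xs))))

  ≅⇒twistedFunctions : ∀ {f g} → f GP.≅ g → ∃ (TwistedFunctions f g)
  ≅⇒twistedFunctions {f} {g} (f′ , g′ , (c , eq₁) , g~g′ , (k , eq₂))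
    with c′ , eq₃ ← IsEquivalence.sym GP.~-isEquivalence {g} {g′} g~g′ =
    k , c ∙ c′ , λ xs → trans (eq₁ xs) (trans
      (cong (↑ c ⊙_) (trans (eq₂ xs) (trans (cong (⨀ k xs ⊙_) (eq₃ xs)) (⊙-swap (⨀ k xs) (↑ c′) (φ g xs)))))
      (sym (⊙-assoc (↑ c) (↑ c′) (⨀ k xs ⊙ φ g xs))))

  twistedFunctions⇒≅ : ∀ {f g k} → TwistedFunctions f g k → f GP.≅ g
  twistedFunctions⇒≅ {f} {g} {k} (c , eq) = f′ , g ,
    IsEquivalence.sym GP.~-isEquivalence {f′} {f} (c ⁻¹ , λ _ → refl) ,
    IsEquivalence.refl GP.~-isEquivalence {g} ,
    k , λ xs → sym (⁻¹-solve c (eq xs))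
    where
    f′ = GP.scale (c ⁻¹) f

  module _ {p q f g} (Lp : Link p f) (Lq : Link q g) where

    ~⇒~ᵖ : p T.~ q → f GP.~ g
    ~⇒~ᵖ p~q = twistedFunctions⇒~ {f} {g} (λ _ → 1*⁻¹) (pairs⇒functions Lp Lq (~⇒twistedPairs {p} {q} p~q))

    ~ᵖ⇒~ : f GP.~ g → p T.~ q
    ~ᵖ⇒~ f~g = twistedPairs⇒~ {p} {q} (λ _ → 1*⁻¹) (functions⇒pairs Lp Lq (~⇒twistedFunctions {f} {g} f~g))

    ≅⇒≅ᵖ : p T.≅ q → f GP.≅ g
    ≅⇒≅ᵖ p≅q = twistedFunctions⇒≅ {f} {g} (pairs⇒functions Lp Lq (proj₂ (≅⇒twistedPairs {p} {q} p≅q)))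

    ≅ᵖ⇒≅ : f GP.≅ g → p T.≅ q
    ≅ᵖ⇒≅ f≅g = twistedPairs⇒≅ {p} {q} (functions⇒pairs Lp Lq (proj₂ (≅⇒twistedFunctions {f} {g} f≅g)))

  -- The witness of surjectivity is `fromGP f`, so the inverse whose continuity is at stake is
  -- `fromGP` itself.
  Υ : Bijection T.𝓜 GP.𝓜
  Υ = record
    { to        = toGP
    ; cong      = λ {p} {q} → ~⇒~ᵖ (toGP-link p) (toGP-link q)
    ; bijective = (λ {p} {q} → ~ᵖ⇒~ (toGP-link p) (toGP-link q)) ,
                  λ f → fromGP f , λ {p} → ~⇒~ᵖ (toGP-link p) (fromGP-link f)
    }

  Ῡ : Bijection T.𝓡 GP.𝓡
  Ῡ = record
    { to        = toGP
    ; cong      = λ {p} {q} → ≅⇒≅ᵖ (toGP-link p) (toGP-link q)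
    ; bijective = (λ {p} {q} → ≅ᵖ⇒≅ (toGP-link p) (toGP-link q)) ,
                  λ f → fromGP f , λ {p} → ≅⇒≅ᵖ (toGP-link p) (fromGP-link f)
    }

-- Continuity in terms of finitely many coordinates.

-- Maps on a type A whose points have the coordinates ev, continuous for the
-- topology induced by ev from the product topology.
module Coordinates {ℓ} {A : Set ℓ} {I : Set} {X : Set a} (TX : Topology o (setoid X)) (ev : A → I → X) where

  Near : A → List (Condition I TX) → Set (lsuc a ⊔ o)
  Near s = Allᴸ (Satisfies I TX (ev s))

  Cont : ∀ {Y : Set a} {o′} → Topology o′ (setoid Y) → (A → Y) → Set (lsuc a ⊔ o ⊔ ℓ ⊔ o′)
  Cont TY F = ∀ {U} → Topology.Open TY U → ∀ s → F s ∈ᴾ U →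
              ∃ λ cs → Near s cs × (∀ {t} → Near t cs → F t ∈ᴾ U)

  cont-coordinate : ∀ i → Cont TX (λ s → ev s i)
  cont-coordinate i {U} oU s s∈ = (i , U , oU) ∷ [] , s∈ ∷ [] , λ { (t∈ ∷ []) → t∈ }

  cont-const : ∀ {Y : Set a} {o′} (TY : Topology o′ (setoid Y)) y → Cont TY (λ _ → y)
  cont-const TY y oU s s∈ = [] , [] , λ _ → s∈

  cont-∘ : ∀ {Y Z : Set a} {o₁ o₂} {TY : Topology o₁ (setoid Y)} {TZ : Topology o₂ (setoid Z)} {F : A → Y} {G : Y → Z} →
           Continuous TY TZ G → Cont TY F → Cont TZ (G ∘ F)
  cont-∘ contG contF oU s s∈ = contF (contG oU) s s∈

  cont-binary : ∀ {Y₁ Y₂ Z : Set a} {o₁ o₂} {T₁ : Topology o₁ (setoid Y₁)} {T₂ : Topology o₁ (setoid Y₂)}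
                {TZ : Topology o₂ (setoid Z)} {F : A → Y₁} {G : A → Y₂} {_*_ : Y₁ → Y₂ → Z} →
                Continuous (product T₁ T₂) TZ (uncurry _*_) → Cont T₁ F → Cont T₂ G → Cont TZ (λ s → F s * G s)
  cont-binary cont* contF contG oU s s∈ =
    let _ , _ , oV , oW , ∈V , ∈W , VW⊆ = cont* oU s∈
        cs , near-cs , cs⊆ = contF oV s ∈V
        ds , near-ds , ds⊆ = contG oW s ∈W
    in cs ++ ds , ++⁺ near-cs near-ds , λ near → VW⊆ (cs⊆ (++⁻ˡ cs near)) (ds⊆ (++⁻ʳ cs near))

  module _ {J : Set} {Y : Set a} {o′} {TY : Topology o′ (setoid Y)} {G : A → J → Y}
           (contG : ∀ j → Cont TY (λ s → G s j)) where

    private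
      pull : ∀ s ds → Allᴸ (Satisfies J TY (G s)) ds →
             ∃ λ cs → Near s cs × (∀ {t} → Near t cs → Allᴸ (Satisfies J TY (G t)) ds)
      pull s []                 []           = [] , [] , λ _ → []
      pull s ((j , U , oU) ∷ ds) (s∈ ∷ s∈ds) =
        let cs  , near  , cs⊆  = contG j oU s s∈
            cs′ , near′ , cs′⊆ = pull s ds s∈ds
        in cs ++ cs′ , ++⁺ near near′ , λ n → cs⊆ (++⁻ˡ cs n) ∷ cs′⊆ (++⁻ʳ cs n)

    cont-power : ∀ {W} → Topology.Open (power J TY) W → ∀ s → G s ∈ᴾ W →
                 ∃ λ cs → Near s cs × (∀ {t} → Near t cs → G t ∈ᴾ W)
    cont-power oW s s∈ =
      let ds , s∈ds , ds⊆ = oW s∈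
          cs , near , cs⊆ = pull s ds s∈ds
      in cs , near , λ n → ds⊆ (cs⊆ n)

-- A finite enumeration turns being nonzero on all bases into finitely many coordinate conditions,
-- as a basic open set demands.
vectors : ∀ n d → List (Vec (Fin n) d)
vectors n zero    = [] ∷ []
vectors n (suc d) = cartesianProductWith _∷_ (allFin n) (vectors n d)

∈-vectors : ∀ {n d} (xs : Vec (Fin n) d) → xs ∈ᴸ vectors n d
∈-vectors []       = here refl
∈-vectors (x ∷ xs) = ∈-cartesianProductWith⁺ _∷_ (∈-allFin x) (∈-vectors xs)

-- Continuity of the two maps and of their quotients.

module Homeomorphisms (H : Hyperfield a) (inv : Involution H) {n d : ℕ} (M : Matroid n) (rank : HasRank M d)
                      (• : Strength) (top : TopologicalHyperfield o H)
                      (τ-continuous : Continuous (TopologicalHyperfield.topology top)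
                                        (TopologicalHyperfield.topology top) (Involution.τ inv)) where
  open Values H
  open Involution inv using (τ)
  open TopologicalHyperfield top
  open Matroid M using (IsBasis; isBasis?)
  open Orthogonality H M using (signed)
  open BasisFunctions H M rank •
  open TotalSignatures H inv M •
  open Links H inv M rank •
  private
    module N   = Cocircuits M
    module P   = Matching H M
    module P*  = Matching H (dual M)
    module GP  = GrassmannPlücker H M d •
    module T   = Signatures H inv M •
    module Pot = Potential H M
  open GP using (GPFunction)

  module Values-continuous {ℓ} {A : Set ℓ} {I : Set} {X : Set a} {o′} (TX : Topology o′ (setoid X)) (ev : A → I → X) where
    open Coordinates TX ev public

    cont-↑ : ∀ {F : A → H*} → Cont topology* F → Cont topology (λ s → ↑ F s)
    cont-↑ contF {U} oU = contF (U , oU , id , id)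

    cont-lift : ∀ {F : A → H*} → Cont topology (λ s → ↑ F s) → Cont topology* F
    cont-lift contF (W , oW , U⊆ , ⊆U) s s∈ =
      let cs , near , cs⊆ = contF oW s (U⊆ s∈) in cs , near , λ n → ⊆U (cs⊆ n)

    cont-∙ : ∀ {F G : A → H*} → Cont topology* F → Cont topology* G → Cont topology* (λ s → F s ∙ G s)
    cont-∙ {F} {G} contF contG = cont-lift {λ s → F s ∙ G s}
      (cont-binary {T₁ = topology} {T₂ = topology} {TZ = topology} {_*_ = _⊙_}
        ⊙-continuous (cont-↑ {F} contF) (cont-↑ {G} contG))

    cont-⁻¹ : ∀ {F : A → H*} → Cont topology* F → Cont topology* (λ s → F s ⁻¹)
    cont-⁻¹ = cont-∘ {TY = topology*} {TZ = topology*} ⁻¹-continuous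

    cont-τ* : ∀ {F : A → H*} → Cont topology* F → Cont topology* (λ s → τ* (F s))
    cont-τ* {F} contF = cont-lift {λ s → τ* (F s)}
      (cont-∘ {TY = topology} {TZ = topology} {G = τ} τ-continuous (cont-↑ {F} contF))

    cont-1* : ∀ x → Cont topology* (λ _ → x)
    cont-1* = cont-const topology*

    cont-extend : ∀ {𝓓 𝓜 : Pred (Subset n) 0ℓ} (𝓓? : Decidable 𝓓) (𝓓⇒𝓜 : ∀ {D} → 𝓓 D → 𝓜 D)
                  (f : A → (D : [ D ∈ Subset n ∣ 𝓜 D ]) → Element (value D) → H*) →
                  (∀ D x → Cont topology* (λ s → f s D x)) →
                  ∀ D x → Cont topology* (λ s → extend 𝓓? 𝓓⇒𝓜 (f s) D x)
    cont-extend 𝓓? 𝓓⇒𝓜 f contf D x with 𝓓? D | x ∈? D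
    ... | yes c | yes x∈ = contf (D , [ 𝓓⇒𝓜 c ]) (x , [ x∈ ])
    ... | yes _ | no _  = cont-1* 1*
    ... | no _  | _     = cont-1* 1*

    -- Fuel and descents do not depend on the parameter, so the potential is one and the same
    -- expression in products and inverses for all of them.
    cont-potential : ∀ {g : A → Subset n → Fin n → H*} → (∀ S x → Cont topology* (λ s → g s S x)) →
                     ∀ B → Cont topology* (λ s → Pot.potential (g s) B)
    cont-potential {g} contg B = go (Pot.dist B) B
      where
      go : ∀ k B → Cont topology* (λ s → Pot.potential′ (g s) k B)
      descends : ∀ k B (dec : Dec (Pot.Descent B)) → Cont topology* (λ s → Pot.descend (g s) (Pot.potential′ (g s) k) B dec)
      go zero    B = cont-1* 1*
      go (suc k) B = descends k B (Pot.descent? B)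
      descends k B (yes (x , b , _)) =
        cont-∙ {λ s → g s (B ⊖ x) x ∙ g s (B ⊖ x) b ⁻¹} {λ s → Pot.potential′ (g s) k (B ⊖ x ⊕ b)}
          (cont-∙ {λ s → g s (B ⊖ x) x} {λ s → g s (B ⊖ x) b ⁻¹}
            (contg (B ⊖ x) x) (cont-⁻¹ {λ s → g s (B ⊖ x) b} (contg (B ⊖ x) b)))
          (go k (B ⊖ x ⊕ b))
      descends k B (no _) = cont-1* 1*

  private
    module C where
      open Values-continuous {A = T.Coordinate → H*} topology* (λ c → c) public

      cont-ordered : ∀ xs → Cont topology (λ c → ordered (signed-potential c) xs)
      cont-ordered xs with isBasis? (entries xs)
      ... | no  _ = cont-const topology 0#
      ... | yes _ = cont-↑ {λ c → σ (sgnᵛ xs) ∙ signed-potential c (entries xs)}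
        (cont-∙ {λ _ → σ (sgnᵛ xs)} {λ c → signed-potential c (entries xs)} (cont-1* (σ (sgnᵛ xs)))
          (cont-potential {λ c → signed (η-of c)} (λ S x →
            cont-∙ {λ _ → σ (sgn x S)} {λ c → η-of c (N.completion S) x} (cont-1* (σ (sgn x S)))
              (cont-extend N.isCocircuit? cocircuit⁺ (λ c D y → τ* (c (inj₂ (D , y))))
                (λ D y → cont-τ* {λ c → c (inj₂ (D , y))} (cont-coordinate (inj₂ (D , y))))
                (N.completion S) x)) (entries xs)))

  toGP-continuous : Continuous (T.topology𝓝 top) (GP.topology𝓝 top) toGP
  toGP-continuous (W , oW , U⊆ , ⊆U) =
    -- The preimage is taken among all families of coordinates, and the subspace topology then
    -- restricts it to orthogonal pairs.
    (λ c → ordered (signed-potential c) ∈ᴾ W) ,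
    (λ {c} c∈ → C.cont-power {TY = topology} {G = λ c → ordered (signed-potential c)}
                  C.cont-ordered oW c c∈) ,
    U⊆ , ⊆U

  private
    -- The domain on which signature coordinates make sense: a value must be nonzero on a basis to
    -- count as an element of `H*`.
    Point : Set a
    Point = Σ (Vec (Fin n) d → Carrier) NonzeroOnBases

    φ-coordinates : Point → T.Coordinate → H*
    φ-coordinates = uncurry gpCoordinates

    module D where
      open Values-continuous {A = Point} topology proj₁ public

      cont-onBases : ∀ B → Cont topology* (λ (ψ , ψ≢0) → onBases ψ ψ≢0 B)
      cont-onBases B with isBasis? B
      ... | no  _ = cont-1* 1*
      ... | yes b = let xs = listing B (rank b) in
        cont-∙ {λ _ → σ (sgnᵛ xs)} {λ (ψ , ψ≢0) → ψ xs , ψ≢0 xs (subst IsBasis (sym (entries-listing B (rank b))) b)}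
          (cont-1* (σ (sgnᵛ xs)))
          (cont-lift {λ (ψ , ψ≢0) → ψ xs , ψ≢0 xs (subst IsBasis (sym (entries-listing B (rank b))) b)}
            (cont-coordinate xs))

      cont-signature : ∀ (N : Matroid n) {Φ : Point → Subset n → H*} →
                       (∀ B → Cont topology* (λ s → Φ s B)) →
                       ∀ D x → Cont topology* (λ s → Matching.signature H N (Φ s) D x)
      cont-signature N {Φ} contΦ D x with Cocircuits.isCocircuit? N D
      ... | no  _       = cont-1* 1*
      ... | yes (J , _) = cont-∙ {λ _ → σ (sgn x J)} {λ s → Φ s (J ⊕ x)} (cont-1* (σ (sgn x J))) (contΦ (J ⊕ x))

      cont-coordinates : ∀ i → Cont topology* (λ s → φ-coordinates s i)
      cont-coordinates (inj₁ (C , x)) =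
        cont-∙ {λ _ → σ (sgn (value x) full)} {λ (ψ , ψ≢0) → P*.signature (onBases ψ ψ≢0 ∘ ∁) (value C) (value x)}
          (cont-1* (σ (sgn (value x) full)))
          (cont-signature (dual M) {λ (ψ , ψ≢0) → onBases ψ ψ≢0 ∘ ∁} (λ B → cont-onBases (∁ B)) (value C) (value x))
      cont-coordinates (inj₂ (D , y)) =
        cont-τ* {λ (ψ , ψ≢0) → P.signature (onBases ψ ψ≢0) (value D) (value y)}
          (cont-signature M {λ (ψ , ψ≢0) → onBases ψ ψ≢0} cont-onBases (value D) (value y))

  private
    nonzeroOn : List (Vec (Fin n) d) → List (Condition (Vec (Fin n) d) topology)
    nonzeroOn []         = []
    nonzeroOn (xs ∷ xss) with isBasis? (entries xs)
    ... | yes _ = (xs , (_≢ 0#) , H*-open) ∷ nonzeroOn xss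
    ... | no  _ = nonzeroOn xss

    nonzeroOn⁺ : ∀ {ψ} → NonzeroOnBases ψ → ∀ xss → Allᴸ (Satisfies (Vec (Fin n) d) topology ψ) (nonzeroOn xss)
    nonzeroOn⁺ ψ≢0 []         = []
    nonzeroOn⁺ ψ≢0 (xs ∷ xss) with isBasis? (entries xs)
    ... | yes b = ψ≢0 xs b ∷ nonzeroOn⁺ ψ≢0 xss
    ... | no  _ = nonzeroOn⁺ ψ≢0 xss

    nonzeroOn⁻ : ∀ {ψ} xss → Allᴸ (Satisfies (Vec (Fin n) d) topology ψ) (nonzeroOn xss) →
                 ∀ {xs} → xs ∈ᴸ xss → IsBasis (entries xs) → ψ xs ≢ 0#
    nonzeroOn⁻ (xs ∷ xss) sat xs∈ b with isBasis? (entries xs)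
    nonzeroOn⁻ (xs ∷ xss) (ψxs≢0 ∷ _) (here refl) b | yes _ = ψxs≢0
    nonzeroOn⁻ (xs ∷ xss) (_ ∷ sat)   (there xs∈) b | yes _ = nonzeroOn⁻ xss sat xs∈ b
    nonzeroOn⁻ (xs ∷ xss) sat         (here refl) b | no ¬b = contradiction b ¬b
    nonzeroOn⁻ (xs ∷ xss) sat         (there xs∈) b | no _  = nonzeroOn⁻ xss sat xs∈ b

  fromGP-continuous : Continuous (GP.topology𝓝 top) (T.topology𝓝 top) fromGP
  fromGP-continuous {U} (W , oW , U⊆ , ⊆U) =
    W′ , open′ ,
    (λ {f} f∈ → GPFunction.basis⇒≢0 f , Power.Open-≈ oW (agree f) (U⊆ f∈)) ,
    (λ {f} (_ , f∈) → ⊆U (Power.Open-≈ oW (sym ∘ agree f) f∈))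
    where
    module Power = Topology (power T.Coordinate topology*)
    agree : ∀ f i → T.coordinates (fromGP f) i ≡ gpCoordinates (GPFunction.φ f) (GPFunction.basis⇒≢0 f) i
    agree f = coordinates-fromGP f
    W′ : Pred (Vec (Fin n) d → Carrier) a
    W′ ψ = ∃ λ (ψ≢0 : NonzeroOnBases ψ) → φ-coordinates (ψ , ψ≢0) ∈ᴾ W
    open′ : Topology.Open (power (Vec (Fin n) d) topology) W′
    open′ {ψ} (ψ≢0 , ψ∈)
      with cs , near , cs⊆ ← D.cont-power {TY = topology*} {G = φ-coordinates}
                               D.cont-coordinates oW (ψ , ψ≢0) ψ∈ =
      -- The conditions `nz`, open because `H*` is, keep nearby functions nonzero on the bases, so
      -- that the conditions `cs` on their coordinates can be applied.
      nz ++ cs , ++⁺ (nonzeroOn⁺ ψ≢0 (vectors n d)) near , λ {χ} near′ →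
        let χ≢0 : NonzeroOnBases χ
            χ≢0 = λ xs b → nonzeroOn⁻ (vectors n d) (++⁻ˡ nz near′) (∈-vectors xs) b
        in χ≢0 , cs⊆ {χ , χ≢0} (++⁻ʳ nz near′)
      where
      nz : List (Condition (Vec (Fin n) d) topology)
      nz = nonzeroOn (vectors n d)

  -- The quotients keep the points of `𝓝` and only coarsen equality, so continuity on
  -- representatives and compatibility with the equivalences suffice.
  Υ-homeomorphism : IsHomeomorphism (T.topology𝓜 top) (GP.topology𝓜 top) Υ
  Υ-homeomorphism =
    (λ (respects , oU) → (λ {p} {q} p~q → respects {toGP p} {toGP q} (~⇒~ᵖ (toGP-link p) (toGP-link q) p~q)) ,
      toGP-continuous oU) ,
    (λ (respects , oU) → (λ {f} {g} f~g → respects {fromGP f} {fromGP g} (~ᵖ⇒~ (fromGP-link f) (fromGP-link g) f~g)) ,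
      fromGP-continuous oU)

  Ῡ-homeomorphism : IsHomeomorphism (T.topology𝓡 top) (GP.topology𝓡 top) Ῡ
  Ῡ-homeomorphism =
    (λ (respects , oU) → (λ {p} {q} p≅q → respects {toGP p} {toGP q} (≅⇒≅ᵖ (toGP-link p) (toGP-link q) p≅q)) ,
      proj₁ Υ-homeomorphism oU) ,
    (λ (respects , oU) → (λ {f} {g} f≅g → respects {fromGP f} {fromGP g} (≅ᵖ⇒≅ (fromGP-link f) (fromGP-link g) f≅g)) ,
      proj₂ Υ-homeomorphism oU)

proposition2p15 :
    ∀ {a o : Level} {n d : ℕ} (M : Matroid n) → HasRank M d →
    (H : Hyperfield a) (inv : Involution H) (• : Strength) →
    let module P = GrassmannPlücker H M d •
        module T = Signatures H inv M •
    in
    Σ (Bijection T.𝓜 P.𝓜) λ Υ →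
    Σ (Bijection T.𝓡 P.𝓡) λ Ῡ →
      (∀ m → Setoid._≈_ P.𝓡 (Bijection.to Ῡ (Func.to T.𝓜⟶𝓡 m))
                             (Func.to P.𝓜⟶𝓡 (Bijection.to Υ m)))
      ×
      (∀ (top : TopologicalHyperfield o H) →
        Continuous (TopologicalHyperfield.topology top)
                   (TopologicalHyperfield.topology top) (Involution.τ inv) →
        IsHomeomorphism (T.topology𝓜 top) (P.topology𝓜 top) Υ ×
        IsHomeomorphism (T.topology𝓡 top) (P.topology𝓡 top) Ῡ)
proposition2p15 M rank H inv • =
  -- Both bijections are `toGP` on representatives, so the square commutes by reflexivity.
  Υ , Ῡ , (λ p → Setoid.refl (GrassmannPlücker.𝓡 H M _ •) {toGP p}) ,
  λ top τ-continuous → Homeomorphisms.Υ-homeomorphism H inv M rank • top τ-continuous ,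
                       Homeomorphisms.Ῡ-homeomorphism H inv M rank • top τ-continuous
  where open Links H inv M rank •
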